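{- Fix a finite set of colors $\Omega$ and a subset $\Omega_\circ\subseteq\Omega$ of looped colors. Let $G = (V,E)$ be a finite graph without isolated vertices, and assign a subset $\Omega_v \subseteq \Omega$ to each $v \in V$. Then the number of semiproper colorings of $G$ in which each $v \in V$ receives a color from $\Omega_v$ is at most \[ \prod_{uv \in E} N(\Omega_u,\Omega_v;d_v,d_u)^{1/(d_ud_v)}, \] where $d_v$ is the degree of $v$ in $G$.
   Context: A semiproper coloring of a graph is an assignment of a color from $\Omega$ to each vertex such that no two adjacent vertices receive the same non-looped color (a color in $\Omega\setminus\Omega_\circ$). For $A,B\subseteq\Omega$ and nonnegative integers $a,b$, $N(A,B;a,b)$ denotes the number of semiproper colorings of the complete bipartite graph $K_{a,b}$ in which the $a$ vertices of the first part receive colors from $A$ and the $b$ vertices of the second part receive colors from $B$. The product is over edges of $G$, each counted once. -}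

module Defs where

open import Data.Nat using (ℕ; zero; suc; _+_; _*_; _<ᵇ_)
open import Data.Fin as Fin using (Fin; toℕ)
open import Data.Fin.Subset using (Subset)
open import Data.Bool using (Bool; true; false; _∧_; _∨_; not)
open import Data.List using (List; []; _∷_; map; concatMap; allFin; filterᵇ; length; foldr)
open import Data.Product using (_×_; _,_)
open import Data.Vec using (lookup)
import Data.Vec.Functional as VF
open import Relation.Nullary.Decidable using (does)

-- Colours are Fin c.  Subsets of colours are Subset c (= Vec Bool c);
-- a colour x is in S iff lookup S x ≡ true (= inside).

-- A finite simple graph on vertex set Fin n is given by a Bool-valued
-- adjacency relation (symmetry / irreflexivity are hypotheses of the theorem).
Adj : ℕ → Set
Adj n = Fin n → Fin n → Bool

allColourings : ∀ {c} n → List (Fin n → Fin c)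
allColourings {c} zero = (λ ()) ∷ []
allColourings {c} (suc n) =
  concatMap (λ f → map (λ x → x VF.∷ f) (allFin c)) (allColourings n)

allPairs : ∀ n → List (Fin n × Fin n)
allPairs n = concatMap (λ u → map (u ,_) (allFin n)) (allFin n)

allᵇ : ∀ {A : Set} → (A → Bool) → List A → Bool
allᵇ p = foldr (λ x r → p x ∧ r) true

isSemiproper : ∀ {n c} → Adj n → Subset c → (Fin n → Fin c) → Bool
isSemiproper {n} adj Ω∘ f =
  allᵇ (λ { (u , v) → not (adj u v) ∨ not (does (f u Fin.≟ f v)) ∨ lookup Ω∘ (f u) })
      (allPairs n)

respectsLists : ∀ {n c} → (Fin n → Subset c) → (Fin n → Fin c) → Bool
respectsLists {n} Ωs f = allᵇ (λ v → lookup (Ωs v) (f v)) (allFin n)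

countColourings : ∀ {c} n → Adj n → Subset c → (Fin n → Subset c) → ℕ
countColourings n adj Ω∘ Ωs =
  length (filterᵇ (λ f → isSemiproper adj Ω∘ f ∧ respectsLists Ωs f) (allColourings n))

inFirst : ∀ a {b} → Fin (a + b) → Bool
inFirst a i = toℕ i <ᵇ a

Kbip : ∀ a b → Adj (a + b)
Kbip a b i j = not (inFirst a {b} i ∧ inFirst a {b} j)
             ∧ (inFirst a {b} i ∨ inFirst a {b} j)

N : ∀ {c} → Subset c → Subset c → Subset c → ℕ → ℕ → ℕ
N Ω∘ A B a b =
  countColourings (a + b) (Kbip a b) Ω∘ (λ i → if′ (inFirst a {b} i))
  where
  if′ : Bool → Subset _
  if′ true = A
  if′ false = B

degree : ∀ {n} → Adj n → Fin n → ℕ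
degree {n} adj v = length (filterᵇ (adj v) (allFin n))

edges : ∀ {n} → Adj n → List (Fin n × Fin n)
edges {n} adj = filterᵇ (λ { (u , v) → adj u v ∧ (toℕ u <ᵇ toℕ v) }) (allPairs n)

{-# OPTIONS --safe #-}
module Submission where

-- Induction on the number of edges.  Let w be a vertex of maximum degree Δ, and condition on its colour x: this
-- isolates w and removes from the lists of its neighbours the colours incompatible with x.  Bound each term by
-- induction; the sum over x is then split into one estimate per edge by Hölder's inequality in entropy form.
-- For an edge uv with only v adjacent to w, the estimate is two applications of Hölder's inequality.  If u and v are
-- both adjacent to w, it is reduced to the first case by negative correlation: if x is compatible with all colours in
-- zs, then no colour is incompatible both with x and with a member of zs, because incompatibility is transitive.
-- All roots are avoided by raising to powers; the only limit is the approximation of c^{1/Δ} by fractions.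

open import Defs
open import Data.Nat using (ℕ; _*_; _^_; _≤_; _≥_)
open import Data.Fin using (Fin)
open import Data.Fin.Subset using (Subset)
open import Data.Bool using (Bool; true; false)
open import Data.List using (map)
open import Data.Nat.ListAction using (product)
open import Data.Product using (_,_)
open import Relation.Binary.PropositionalEquality using (_≡_)

open import Data.Bool using (_∧_; _∨_; not; if_then_else_)
open import Data.Bool.Properties using (∧-zeroʳ; ∧-identityʳ; ∧-comm)
open import Data.Fin as Fin using (zero; suc; #_; toℕ; _↑ˡ_; _↑ʳ_; splitAt)
open import Data.Fin.Properties using (splitAt⁻¹-↑ˡ; splitAt⁻¹-↑ʳ; toℕ-injective)
open import Data.List using (List; []; _∷_; _++_; concatMap; filterᵇ; allFin; tabulate; length)
open import Data.List.Membership.Propositional using (_∈_; lose)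
open import Data.List.Membership.Propositional.Properties using (∈-allFin; ∈-map⁺; ∈-concatMap⁺; ∈-tabulate⁺)
open import Data.List.Properties using (map-++; map-tabulate; length-tabulate)
open import Data.List.Relation.Unary.All as All using (All; []; _∷_)
open import Data.List.Relation.Unary.Any using (here; there)
open import Data.Nat using (zero; suc; _+_; _<_; _<ᵇ_; _!; z≤n; s≤s; NonZero; >-nonZero; >-nonZero⁻¹)
open import Data.Nat.DivMod using (_/_; m/n*n≡m)
open import Data.Nat.Divisibility using (m∣m*n; m≤n⇒m!∣n!; ∣-trans)
open import Data.Nat.ListAction using (sum)
open import Data.Nat.ListAction.Properties using (sum-++; product-++)
open import Data.Nat.Properties
open import Data.Nat.Tactic.RingSolver using (solve-∀)
open import Data.Product using (_×_; ∃; ∃₂; proj₁; proj₂)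
open import Data.Sum using (_⊎_; inj₁; inj₂)
open import Data.Vec as Vec using (Vec; []; _∷_; lookup)
import Data.Vec.Functional as VF
open import Data.Vec.Relation.Binary.Pointwise.Inductive using (Pointwise; []; _∷_; Pointwise-≡⇒≡)
open import Function using (_∘_; const)
open import Relation.Binary.PropositionalEquality using (_≢_; refl; sym; trans; cong; cong₂; subst; subst₂; module ≡-Reasoning)
open import Relation.Nullary using (Dec; yes; no; contradiction; does)
open import Relation.Nullary.Decidable using (dec-true; dec-false)

-- Monomials with variable exponents

-- Removing `w` changes the exponents 1/(d_u d_v), and the accounts must balance exactly. Work with
-- logarithms, averaged over a distribution on the colours of `w`. Let `v` be a neighbour of `w`
-- that keeps p = d_v - 1 ≥ 1 edges. Each of these pays 1/(Δ p) of the entropy on behalf of `v` and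
-- receives 1/(Δ d_v p) of the logarithm of the count belonging to `vw`. Together they restore the
-- missing factor with its exponent 1/(Δ d_v) and pay 1/Δ; the Δ neighbours pay the one unit of
-- entropy that turns a bound on the average logarithm of the terms into a bound on their sum.
-- Bounds of this form multiply and their entropies add, so each edge can be treated alone.
--
-- The maximality of Δ lets the second use of Hölder's inequality have the exponents q and Δ - q for
-- a degree q.
--
-- The induction creates isolated vertices, so the statement proved by induction admits them, with
-- the size of the list as their factor. If a neighbour of `w` has degree 1, this new factor
-- replaces the edges that would have carried its shares.

infixl 7 _⊗_
infixr 8 _↑_

-- The exponents that occur are polynomials in degrees and weights. Comparing two monomials base by
-- base turns an identity between powers into one ring identity per base.
data Monomial (k : ℕ) : Set where
  var : Fin k → Monomial k
  _⊗_ : Monomial k → Monomial k → Monomial k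
  _↑_ : Monomial k → ℕ → Monomial k

⟦_⟧ : ∀ {k} → Monomial k → Vec ℕ k → ℕ
⟦ var i ⟧ ρ = lookup ρ i
⟦ a ⊗ b ⟧ ρ = ⟦ a ⟧ ρ * ⟦ b ⟧ ρ
⟦ a ↑ n ⟧ ρ = ⟦ a ⟧ ρ ^ n

exponents : ∀ {k} → Monomial k → Vec ℕ k
exponents (var i) = Vec.replicate _ 0 Vec.[ i ]≔ 1
exponents (a ⊗ b) = Vec.zipWith _+_ (exponents a) (exponents b)
exponents (a ↑ n) = Vec.map (_* n) (exponents a)

evaluate : ∀ {k} → Vec ℕ k → Vec ℕ k → ℕ
evaluate []      []      = 1
evaluate (x ∷ ρ) (e ∷ ε) = x ^ e * evaluate ρ ε

*-interchange : ∀ a b c d → (a * b) * (c * d) ≡ (a * c) * (b * d)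
*-interchange = solve-∀

evaluate-0 : ∀ {k} (ρ : Vec ℕ k) → evaluate ρ (Vec.replicate k 0) ≡ 1
evaluate-0 []      = refl
evaluate-0 (x ∷ ρ) = trans (*-identityˡ _) (evaluate-0 ρ)

evaluate-unit : ∀ {k} (ρ : Vec ℕ k) i → evaluate ρ (Vec.replicate k 0 Vec.[ i ]≔ 1) ≡ lookup ρ i
evaluate-unit (x ∷ ρ) zero    = trans (cong₂ _*_ (^-identityʳ x) (evaluate-0 ρ)) (*-identityʳ x)
evaluate-unit (x ∷ ρ) (suc i) = trans (*-identityˡ _) (evaluate-unit ρ i)

evaluate-+ : ∀ {k} (ρ ε δ : Vec ℕ k) → evaluate ρ (Vec.zipWith _+_ ε δ) ≡ evaluate ρ ε * evaluate ρ δ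
evaluate-+ []      []      []      = refl
evaluate-+ (x ∷ ρ) (e ∷ ε) (d ∷ δ) =
  trans (cong₂ _*_ (^-distribˡ-+-* x e d) (evaluate-+ ρ ε δ)) (*-interchange (x ^ e) _ _ _)

^-distribʳ-* : ∀ n a b → (a * b) ^ n ≡ a ^ n * b ^ n
^-distribʳ-* zero    a b = refl
^-distribʳ-* (suc n) a b = trans (cong (a * b *_) (^-distribʳ-* n a b)) (*-interchange a b _ _)

evaluate-* : ∀ {k} n (ρ ε : Vec ℕ k) → evaluate ρ (Vec.map (_* n) ε) ≡ evaluate ρ ε ^ n
evaluate-* n []      []      = sym (^-zeroˡ n)
evaluate-* n (x ∷ ρ) (e ∷ ε) =
  trans (cong₂ _*_ (sym (^-*-assoc x e n)) (evaluate-* n ρ ε)) (sym (^-distribʳ-* n (x ^ e) _))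

normalise : ∀ {k} (ρ : Vec ℕ k) (a : Monomial k) → ⟦ a ⟧ ρ ≡ evaluate ρ (exponents a)
normalise ρ (var i) = sym (evaluate-unit ρ i)
normalise ρ (a ⊗ b) = trans (cong₂ _*_ (normalise ρ a) (normalise ρ b)) (sym (evaluate-+ ρ (exponents a) (exponents b)))
normalise ρ (a ↑ n) = trans (cong (_^ n) (normalise ρ a)) (sym (evaluate-* n ρ (exponents a)))

monomial-≡ : ∀ {k} (ρ : Vec ℕ k) (a b : Monomial k) →
  Pointwise _≡_ (exponents a) (exponents b) → ⟦ a ⟧ ρ ≡ ⟦ b ⟧ ρ
monomial-≡ ρ a b eq = trans (normalise ρ a)
  (trans (cong (evaluate ρ) (Pointwise-≡⇒≡ eq)) (sym (normalise ρ b)))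

-- Gibbs' inequality and Hölder's inequality for natural numbers

^-cancelˡ-≤ : ∀ n .{{_ : NonZero n}} {a b} → a ^ n ≤ b ^ n → a ≤ b
^-cancelˡ-≤ n le = ≮⇒≥ (λ b<a → <⇒≱ (^-monoˡ-< n b<a) le)

-- True at 0 as well, because `0 ^ 0` is 1: factors `m x ^ m x` can be cancelled even where the
-- weight `m x` vanishes.
n^n≢0 : ∀ n → NonZero (n ^ n)
n^n≢0 zero    = _
n^n≢0 (suc n) = m^n≢0 (suc n) (suc n)

2mn≤m²+n² : ∀ m n → 2 * (m * n) ≤ m * m + n * n
2mn≤m²+n² m n with ≤-total m n
... | inj₁ m≤n with k , refl ← m≤n⇒∃[o]m+o≡n m≤n = subst (2 * (m * (m + k)) ≤_) (square m k) (m≤m+n _ (k * k))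
  where
  square : ∀ m k → 2 * (m * (m + k)) + k * k ≡ m * m + (m + k) * (m + k)
  square = solve-∀
... | inj₂ n≤m with k , refl ← m≤n⇒∃[o]m+o≡n n≤m = subst (2 * ((n + k) * n) ≤_) (square n k) (m≤m+n _ (k * k))
  where
  square : ∀ n k → 2 * ((n + k) * n) + k * k ≡ (n + k) * (n + k) + n * n
  square = solve-∀

-- Induction on `k`: the previous case is multiplied by `u`, and the mixed term is bounded by
-- `2mn≤m²+n²`. The same term is added to both sides to avoid subtraction.
young : ∀ k u v → suc k * (u * v ^ k) ≤ u ^ suc k + k * v ^ suc k
young zero    u v = ≤-reflexive (lemma u)
  where
  lemma : ∀ u → 1 * (u * 1) ≡ u * 1 + 0
  lemma = solve-∀
young (suc k) u v = +-cancelʳ-≤ (k * (u * (v * v ^ k))) _ _ (begin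
  suc (suc k) * (u * (v * v ^ k)) + k * (u * (v * v ^ k))  ≡⟨ e₁ k u v (v ^ k) ⟩
  suc k * (2 * (u * v)) * v ^ k                            ≤⟨ *-monoˡ-≤ (v ^ k) (*-monoʳ-≤ (suc k) (2mn≤m²+n² u v)) ⟩
  suc k * (u * u + v * v) * v ^ k                          ≡⟨ e₂ k u v (v ^ k) ⟩
  u * (suc k * (u * v ^ k)) + suc k * (v * (v * v ^ k))    ≤⟨ +-monoˡ-≤ _ (*-monoʳ-≤ u (young k u v)) ⟩
  u * (u ^ suc k + k * v ^ suc k) + suc k * (v * (v * v ^ k))
                                                           ≡⟨ e₃ k u v (v ^ k) (u ^ suc k) ⟩
  u * u ^ suc k + suc k * (v * (v * v ^ k)) + k * (u * (v * v ^ k)) ∎)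
  where
  open ≤-Reasoning
  e₁ : ∀ k u v w → suc (suc k) * (u * (v * w)) + k * (u * (v * w)) ≡ suc k * (2 * (u * v)) * w
  e₁ = solve-∀
  e₂ : ∀ k u v w → suc k * (u * u + v * v) * w ≡ u * (suc k * (u * w)) + suc k * (v * (v * w))
  e₂ = solve-∀
  e₃ : ∀ k u v w z → u * (z + k * (v * w)) + suc k * (v * (v * w)) ≡ u * z + suc k * (v * (v * w)) + k * (u * (v * w))
  e₃ = solve-∀

-- Young's inequality with u = k (t + s) and v = (k + 1) s.
am-gm-step : ∀ k t s → t * s ^ k * suc k ^ suc k ≤ (t + s) ^ suc k * k ^ k
am-gm-step zero      t s = ≤-trans (≤-reflexive (e t)) (≤-trans (m≤m+n t s) (≤-reflexive (e′ (t + s))))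
  where
  e : ∀ t → t * 1 * 1 ≡ t
  e = solve-∀
  e′ : ∀ t → t ≡ t * 1 * 1
  e′ = solve-∀
am-gm-step k@(suc j) t s = *-cancelˡ-≤ k (+-cancelˡ-≤ (k * (s * s ^ k * suc k ^ suc k)) _ _ (begin
  k * (s * s ^ k * suc k ^ suc k) + k * (t * s ^ k * suc k ^ suc k)  ≡⟨ e₁ k s t (s ^ k) (suc k ^ k) ⟩
  suc k * (k * (t + s) * (suc k ^ k * s ^ k))                        ≡⟨ cong (λ z → suc k * (k * (t + s) * z)) (sym (^-distribʳ-* k (suc k) s)) ⟩
  suc k * (k * (t + s) * (suc k * s) ^ k)                            ≤⟨ young k (k * (t + s)) (suc k * s) ⟩
  (k * (t + s)) ^ suc k + k * (suc k * s) ^ suc k                    ≡⟨ cong₂ (λ y z → y + k * z) (^-distribʳ-* (suc k) k (t + s)) (^-distribʳ-* (suc k) (suc k) s) ⟩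
  k * k ^ k * (t + s) ^ suc k + k * (suc k ^ suc k * s ^ suc k)      ≡⟨ e₂ k (k ^ k) ((t + s) ^ suc k) (suc k ^ suc k) (s * s ^ k) ⟩
  k * (s * s ^ k * suc k ^ suc k) + k * ((t + s) ^ suc k * k ^ k)    ∎))
  where
  open ≤-Reasoning
  e₁ : ∀ k s t x y → k * (s * x * (suc k * y)) + k * (t * x * (suc k * y)) ≡ suc k * (k * (t + s) * (y * x))
  e₁ = solve-∀
  e₂ : ∀ k a b c d → k * a * b + k * (c * d) ≡ k * (d * c) + k * (b * a)
  e₂ = solve-∀

-- One number is averaged in at a time: `am-gm-step` with `t = a` joins another `a` to the sum
-- `m * a + n * b` of the previous `m + n` numbers.
weighted-am-gm : ∀ m n a b → a ^ m * b ^ n * (m + n) ^ (m + n) ≤ (m * a + n * b) ^ (m + n)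
weighted-am-gm zero    n a b = ≤-reflexive (trans (cong (_* n ^ n) (+-identityʳ (b ^ n)))
  (trans (sym (^-distribʳ-* n b n)) (cong (_^ n) (*-comm b n))))
weighted-am-gm (suc m) n a b = *-cancelʳ-≤ _ _ (k ^ k) {{n^n≢0 k}} (begin
  a * a ^ m * b ^ n * suc k ^ suc k * k ^ k     ≡⟨ e a (a ^ m) (b ^ n) (suc k ^ suc k) (k ^ k) ⟩
  a * (a ^ m * b ^ n * k ^ k) * suc k ^ suc k   ≤⟨ *-monoˡ-≤ _ (*-monoʳ-≤ a (weighted-am-gm m n a b)) ⟩
  a * (m * a + n * b) ^ k * suc k ^ suc k       ≤⟨ am-gm-step k a (m * a + n * b) ⟩
  (a + (m * a + n * b)) ^ suc k * k ^ k         ≡⟨ cong (λ z → z ^ suc k * k ^ k) (sym (+-assoc a (m * a) (n * b))) ⟩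
  (suc m * a + n * b) ^ suc k * k ^ k           ∎)
  where
  open ≤-Reasoning
  k = m + n
  e : ∀ a x y z w → a * x * y * z * w ≡ a * (x * y * w) * z
  e = solve-∀

-- Weighted AM-GM for `v * n` and `u * m`, whose weighted sum is `m * n * (v + u)`. The common
-- factor `n ^ m * m ^ n` cancels only for positive weights, so zero weights are separate cases.
gibbs₂ : ∀ m n v u → v ^ m * u ^ n * (m + n) ^ (m + n) ≤ (v + u) ^ (m + n) * (m ^ m * n ^ n)
gibbs₂ zero n v u = begin
  1 * u ^ n * n ^ n         ≡⟨ cong (_* n ^ n) (*-identityˡ (u ^ n)) ⟩
  u ^ n * n ^ n             ≤⟨ *-monoˡ-≤ (n ^ n) (^-monoˡ-≤ n (m≤n+m u v)) ⟩
  (v + u) ^ n * n ^ n       ≡⟨ cong ((v + u) ^ n *_) (sym (*-identityˡ (n ^ n))) ⟩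
  (v + u) ^ n * (1 * n ^ n) ∎
  where open ≤-Reasoning
gibbs₂ m@(suc _) zero v u = begin
  v ^ m * 1 * (m + 0) ^ (m + 0)     ≡⟨ cong₂ (λ y z → y * z ^ z) (*-identityʳ (v ^ m)) (+-identityʳ m) ⟩
  v ^ m * m ^ m                     ≤⟨ *-monoˡ-≤ (m ^ m) (^-monoˡ-≤ m (m≤m+n v u)) ⟩
  (v + u) ^ m * m ^ m               ≡⟨ cong₂ (λ y z → (v + u) ^ y * z) (sym (+-identityʳ m)) (sym (*-identityʳ (m ^ m))) ⟩
  (v + u) ^ (m + 0) * (m ^ m * 1)   ∎
  where open ≤-Reasoning
gibbs₂ m@(suc _) n@(suc _) v u =
  *-cancelˡ-≤ (n ^ m * m ^ n) {{m*n≢0 _ _ {{m^n≢0 n m}} {{m^n≢0 m n}}}} (begin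
  n ^ m * m ^ n * (v ^ m * u ^ n * (m + n) ^ (m + n))         ≡⟨ e₁ (n ^ m) (m ^ n) (v ^ m) (u ^ n) ((m + n) ^ (m + n)) ⟩
  v ^ m * n ^ m * (u ^ n * m ^ n) * (m + n) ^ (m + n)         ≡⟨ cong₂ (λ y z → y * z * (m + n) ^ (m + n)) (sym (^-distribʳ-* m v n)) (sym (^-distribʳ-* n u m)) ⟩
  (v * n) ^ m * (u * m) ^ n * (m + n) ^ (m + n)               ≤⟨ weighted-am-gm m n (v * n) (u * m) ⟩
  (m * (v * n) + n * (u * m)) ^ (m + n)                       ≡⟨ cong (_^ (m + n)) (e₂ m n v u) ⟩
  (m * n * (v + u)) ^ (m + n)                                 ≡⟨ e₃ (v + u) ⟩
  n ^ m * m ^ n * ((v + u) ^ (m + n) * (m ^ m * n ^ n))       ∎)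
  where
  open ≤-Reasoning
  e₁ : ∀ a b c d f → a * b * (c * d * f) ≡ c * a * (d * b) * f
  e₁ = solve-∀
  e₂ : ∀ m n v u → m * (v * n) + n * (u * m) ≡ m * n * (v + u)
  e₂ = solve-∀
  e₃ : ∀ w → (m * n * w) ^ (m + n) ≡ n ^ m * m ^ n * (w ^ (m + n) * (m ^ m * n ^ n))
  e₃ w = monomial-≡ (m ∷ n ∷ w ∷ [])
    ((μ ⊗ ν ⊗ ω) ↑ (m + n)) (ν ↑ m ⊗ μ ↑ n ⊗ (ω ↑ (m + n) ⊗ (μ ↑ m ⊗ ν ↑ n)))
    (e₄ m n ∷ e₅ m n ∷ e₆ (m + n) ∷ [])
    where
    μ ν ω : Monomial 3
    μ = var (# 0)
    ν = var (# 1)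
    ω = var (# 2)
    -- The zeros and ones are the exponents of the base in each variable, as `exponents` computes
    -- them; the ring identities after later uses of `monomial-≡` arise in the same way.
    e₄ : ∀ m n → (1 + 0 + 0) * (m + n) ≡ 0 * m + 1 * n + (0 + (1 * m + 0))
    e₄ = solve-∀
    e₅ : ∀ m n → (0 + 1 + 0) * (m + n) ≡ 1 * m + 0 * n + (0 + (0 * m + 1 * n))
    e₅ = solve-∀
    e₆ : ∀ k → 1 * k ≡ 1 * k + 0
    e₆ = solve-∀

-- Finite sums and products

∑ ∏ : {A : Set} → List A → (A → ℕ) → ℕ
∑ L f = sum (map f L)
∏ L f = product (map f L)

module _ {A : Set} where

  ∑-cong : ∀ (L : List A) {f g : A → ℕ} → (∀ x → f x ≡ g x) → ∑ L f ≡ ∑ L g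
  ∑-cong []      eq = refl
  ∑-cong (x ∷ L) eq = cong₂ _+_ (eq x) (∑-cong L eq)

  ∑-mono : ∀ (L : List A) {f g : A → ℕ} → (∀ x → f x ≤ g x) → ∑ L f ≤ ∑ L g
  ∑-mono []      le = z≤n
  ∑-mono (x ∷ L) le = +-mono-≤ (le x) (∑-mono L le)

  ∑-zero : ∀ (L : List A) → ∑ L (const 0) ≡ 0
  ∑-zero []      = refl
  ∑-zero (x ∷ L) = ∑-zero L

  ∑-one : ∀ (L : List A) → ∑ L (const 1) ≡ length L
  ∑-one []      = refl
  ∑-one (x ∷ L) = cong suc (∑-one L)

  ∑-+ : ∀ (L : List A) (f g : A → ℕ) → ∑ L (λ x → f x + g x) ≡ ∑ L f + ∑ L g
  ∑-+ []      f g = refl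
  ∑-+ (x ∷ L) f g = trans (cong (f x + g x +_) (∑-+ L f g)) (lemma (f x) (g x) _ _)
    where
    lemma : ∀ a b c d → a + b + (c + d) ≡ a + c + (b + d)
    lemma = solve-∀

  *-distribˡ-∑ : ∀ c (L : List A) (f : A → ℕ) → c * ∑ L f ≡ ∑ L (λ x → c * f x)
  *-distribˡ-∑ c []      f = *-zeroʳ c
  *-distribˡ-∑ c (x ∷ L) f = trans (*-distribˡ-+ c (f x) _) (cong (c * f x +_) (*-distribˡ-∑ c L f))

  *-distribʳ-∑ : ∀ c (L : List A) (f : A → ℕ) → ∑ L f * c ≡ ∑ L (λ x → f x * c)
  *-distribʳ-∑ c L f = trans (*-comm (∑ L f) c) (trans (*-distribˡ-∑ c L f) (∑-cong L (λ x → *-comm c (f x))))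

  ∏-cong : ∀ (L : List A) {f g : A → ℕ} → (∀ x → f x ≡ g x) → ∏ L f ≡ ∏ L g
  ∏-cong []      eq = refl
  ∏-cong (x ∷ L) eq = cong₂ _*_ (eq x) (∏-cong L eq)

  ∏-mono : ∀ (L : List A) {f g : A → ℕ} → (∀ x → f x ≤ g x) → ∏ L f ≤ ∏ L g
  ∏-mono []      le = ≤-refl
  ∏-mono (x ∷ L) le = *-mono-≤ (le x) (∏-mono L le)

  ∏-one : ∀ (L : List A) → ∏ L (const 1) ≡ 1
  ∏-one []      = refl
  ∏-one (x ∷ L) = trans (*-identityˡ _) (∏-one L)

  ∏-* : ∀ (L : List A) (f g : A → ℕ) → ∏ L (λ x → f x * g x) ≡ ∏ L f * ∏ L g
  ∏-* []      f g = refl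
  ∏-* (x ∷ L) f g = trans (cong (f x * g x *_) (∏-* L f g)) (*-interchange (f x) _ _ _)

  ∏-^ : ∀ (L : List A) (f : A → ℕ) n → ∏ L (λ x → f x ^ n) ≡ ∏ L f ^ n
  ∏-^ []      f n = sym (^-zeroˡ n)
  ∏-^ (x ∷ L) f n = trans (cong (f x ^ n *_) (∏-^ L f n)) (sym (^-distribʳ-* n (f x) _))

  ∏-^-∑ : ∀ (L : List A) c (m : A → ℕ) → ∏ L (λ x → c ^ m x) ≡ c ^ ∑ L m
  ∏-^-∑ []      c m = refl
  ∏-^-∑ (x ∷ L) c m = trans (cong (c ^ m x *_) (∏-^-∑ L c m)) (sym (^-distribˡ-+-* c (m x) _))

  ∏≢0 : ∀ (L : List A) {f : A → ℕ} → (∀ x → NonZero (f x)) → NonZero (∏ L f)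
  ∏≢0 []      nz = _
  ∏≢0 (x ∷ L) nz = m*n≢0 _ _ {{nz x}} {{∏≢0 L nz}}

  ∑-++ : ∀ (L M : List A) (f : A → ℕ) → ∑ (L ++ M) f ≡ ∑ L f + ∑ M f
  ∑-++ L M f = trans (cong sum (map-++ f L M)) (sum-++ (map f L) (map f M))

module _ {A B : Set} where

  ∑-swap : ∀ (L : List A) (M : List B) (f : A → B → ℕ) →
    ∑ L (λ x → ∑ M (f x)) ≡ ∑ M (λ y → ∑ L (λ x → f x y))
  ∑-swap []      M f = sym (∑-zero M)
  ∑-swap (x ∷ L) M f = trans (cong (∑ M (f x) +_) (∑-swap L M f)) (sym (∑-+ M (f x) _))

  ∏-swap : ∀ (L : List A) (M : List B) (f : A → B → ℕ) →
    ∏ L (λ x → ∏ M (f x)) ≡ ∏ M (λ y → ∏ L (λ x → f x y))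
  ∏-swap []      M f = sym (∏-one M)
  ∏-swap (x ∷ L) M f = trans (cong (∏ M (f x) *_) (∏-swap L M f)) (sym (∏-* M (f x) _))

  ∑-map : ∀ (g : B → A) (L : List B) (f : A → ℕ) → ∑ (map g L) f ≡ ∑ L (f ∘ g)
  ∑-map g []      f = refl
  ∑-map g (x ∷ L) f = cong (f (g x) +_) (∑-map g L f)

  ∑-concatMap : ∀ (g : B → List A) (L : List B) (f : A → ℕ) →
    ∑ (concatMap g L) f ≡ ∑ L (λ x → ∑ (g x) f)
  ∑-concatMap g []      f = refl
  ∑-concatMap g (x ∷ L) f = trans (∑-++ (g x) (concatMap g L) f) (cong (∑ (g x) f +_) (∑-concatMap g L f))

-- The inequalities of Gibbs and Hölder for lists

module _ {A : Set} where

  -- With `π = m / ∑ m` this is `∑ π log (v / ∑ v) ≤ ∑ π log π`, cleared of logarithms and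
  -- denominators. The tail is merged into a single outcome of weight `M` and value `V`, to which
  -- `gibbs₂` applies.
  gibbs : ∀ (L : List A) (v m : A → ℕ) →
    ∏ L (λ x → v x ^ m x) * ∑ L m ^ ∑ L m ≤ ∑ L v ^ ∑ L m * ∏ L (λ x → m x ^ m x)
  gibbs []      v m = ≤-refl
  gibbs (x ∷ L) v m = *-cancelʳ-≤ _ _ (M ^ M) {{n^n≢0 M}} (begin
    v x ^ m x * P * (m x + M) ^ (m x + M) * M ^ M          ≡⟨ e₁ (v x ^ m x) P _ (M ^ M) ⟩
    v x ^ m x * (P * M ^ M) * (m x + M) ^ (m x + M)        ≤⟨ *-monoˡ-≤ _ (*-monoʳ-≤ (v x ^ m x) (gibbs L v m)) ⟩
    v x ^ m x * (V ^ M * Q) * (m x + M) ^ (m x + M)        ≡⟨ e₂ (v x ^ m x) (V ^ M) Q _ ⟩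
    v x ^ m x * V ^ M * (m x + M) ^ (m x + M) * Q          ≤⟨ *-monoˡ-≤ Q (gibbs₂ (m x) M (v x) V) ⟩
    (v x + V) ^ (m x + M) * (m x ^ m x * M ^ M) * Q        ≡⟨ e₃ ((v x + V) ^ (m x + M)) (m x ^ m x) (M ^ M) Q ⟩
    (v x + V) ^ (m x + M) * (m x ^ m x * Q) * M ^ M        ∎)
    where
    open ≤-Reasoning
    P = ∏ L (λ x → v x ^ m x)
    Q = ∏ L (λ x → m x ^ m x)
    M = ∑ L m
    V = ∑ L v
    e₁ : ∀ a b c d → a * b * c * d ≡ a * (b * d) * c
    e₁ = solve-∀
    e₂ : ∀ a b c d → a * (b * c) * d ≡ a * b * d * c
    e₂ = solve-∀
    e₃ : ∀ a b c d → a * (b * c) * d ≡ a * (b * d) * c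
    e₃ = solve-∀

  -- Gibbs' inequality for f ^ (r + q) and for g ^ (r + q), both with the weights f ^ r * g ^ q.
  hölder : ∀ (L : List A) (f g : A → ℕ) r q →
    ∑ L (λ x → f x ^ r * g x ^ q) ^ (r + q)
      ≤ ∑ L (λ x → f x ^ (r + q)) ^ r * ∑ L (λ x → g x ^ (r + q)) ^ q
  hölder L f g r q with ∑ L (λ x → f x ^ r * g x ^ q) in S≡
  -- A vanishing sum makes the left side 0 except here, where `0 ^ 0` is 1.
  hölder L f g zero    zero    | zero = ≤-refl
  hölder L f g (suc r) q       | zero = z≤n
  hölder L f g zero    (suc q) | zero = z≤n
  -- By the choice of weights, `F ^ r * G ^ q` on the left of the combined Gibbs bounds equals the
  -- `Y ^ w` on their right, so it cancels.
  hölder L f g r q | s@(suc _) = ^-cancelˡ-≤ s (*-cancelʳ-≤ _ _ (Y ^ w) {{m^n≢0 Y w {{∏≢0 L (λ x → n^n≢0 (y x))}}}} (begin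
    (s ^ w) ^ s * Y ^ w                              ≡⟨ cong ((s ^ w) ^ s *_) Y^w ⟩
    (s ^ w) ^ s * (F ^ r * G ^ q)                    ≡⟨ e₁ F G ⟩
    (F * s ^ s) ^ r * (G * s ^ s) ^ q                ≤⟨ *-mono-≤ (^-monoˡ-≤ r (bound f)) (^-monoˡ-≤ q (bound g)) ⟩
    (a ^ s * Y) ^ r * (b ^ s * Y) ^ q                ≡⟨ e₂ ⟩
    (a ^ r * b ^ q) ^ s * Y ^ w                      ∎))
    where
    open ≤-Reasoning
    w = r + q
    y : A → ℕ
    y x = f x ^ r * g x ^ q
    Y = ∏ L (λ x → y x ^ y x)
    F = ∏ L (λ x → (f x ^ w) ^ y x)
    G = ∏ L (λ x → (g x ^ w) ^ y x)
    a = ∑ L (λ x → f x ^ w)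
    b = ∑ L (λ x → g x ^ w)
    bound : ∀ (h : A → ℕ) → ∏ L (λ x → (h x ^ w) ^ y x) * s ^ s ≤ ∑ L (λ x → h x ^ w) ^ s * Y
    bound h = subst (λ z → ∏ L (λ x → (h x ^ w) ^ y x) * z ^ z ≤ ∑ L (λ x → h x ^ w) ^ z * Y) S≡
      (gibbs L (λ x → h x ^ w) y)
    e₁ : ∀ F G → (s ^ w) ^ s * (F ^ r * G ^ q) ≡ (F * s ^ s) ^ r * (G * s ^ s) ^ q
    e₁ F G = monomial-≡ (s ∷ F ∷ G ∷ [])
      ((σ ↑ w) ↑ s ⊗ (φ ↑ r ⊗ γ ↑ q)) ((φ ⊗ σ ↑ s) ↑ r ⊗ (γ ⊗ σ ↑ s) ↑ q)
      (i s r q ∷ j r q ∷ k s r q ∷ [])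
      where
      σ φ γ : Monomial 3
      σ = var (# 0)
      φ = var (# 1)
      γ = var (# 2)
      i : ∀ s r q → 1 * (r + q) * s + (0 * r + 0 * q) ≡ (0 + 1 * s) * r + (0 + 1 * s) * q
      i = solve-∀
      j : ∀ r q → 0 + (1 * r + 0 * q) ≡ (1 + 0) * r + 0 * q
      j = solve-∀
      k : ∀ s r q → 0 * (r + q) * s + (0 * r + 1 * q) ≡ (0 + 0 * s) * r + (1 + 0 * s) * q
      k = solve-∀
    e₂ : (a ^ s * Y) ^ r * (b ^ s * Y) ^ q ≡ (a ^ r * b ^ q) ^ s * Y ^ w
    e₂ = monomial-≡ (a ∷ b ∷ Y ∷ [])
      ((α ↑ s ⊗ υ) ↑ r ⊗ (β ↑ s ⊗ υ) ↑ q) ((α ↑ r ⊗ β ↑ q) ↑ s ⊗ υ ↑ w)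
      (i s r q ∷ j s r q ∷ k s r q ∷ [])
      where
      α β υ : Monomial 3
      α = var (# 0)
      β = var (# 1)
      υ = var (# 2)
      i : ∀ s r q → (1 * s + 0) * r + (0 * s + 0) * q ≡ (1 * r + 0 * q) * s + 0 * (r + q)
      i = solve-∀
      j : ∀ s r q → (0 * s + 0) * r + (1 * s + 0) * q ≡ (0 * r + 1 * q) * s + 0 * (r + q)
      j = solve-∀
      k : ∀ s r q → (0 * s + 1) * r + (0 * s + 1) * q ≡ (0 * r + 0 * q) * s + 1 * (r + q)
      k = solve-∀
    Y^w : Y ^ w ≡ F ^ r * G ^ q
    Y^w = trans (sym (∏-^ L (λ x → y x ^ y x) w)) (trans (∏-cong L pt)
      (trans (∏-* L _ _) (cong₂ _*_ (∏-^ L _ r) (∏-^ L _ q))))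
      where
      pt : ∀ x → (y x ^ y x) ^ w ≡ ((f x ^ w) ^ y x) ^ r * ((g x ^ w) ^ y x) ^ q
      pt x = monomial-≡ (f x ∷ g x ∷ [])
        (((φ ↑ r ⊗ γ ↑ q) ↑ y x) ↑ w) (((φ ↑ w) ↑ y x) ↑ r ⊗ ((γ ↑ w) ↑ y x) ↑ q)
        (i r q (y x) ∷ j r q (y x) ∷ [])
        where
        φ γ : Monomial 2
        φ = var (# 0)
        γ = var (# 1)
        i : ∀ r q y → (1 * r + 0 * q) * y * (r + q) ≡ 1 * (r + q) * y * r + 0 * (r + q) * y * q
        i = solve-∀
        j : ∀ r q y → (0 * r + 1 * q) * y * (r + q) ≡ 0 * (r + q) * y * r + 1 * (r + q) * y * q
        j = solve-∀

-- Colourings of complete bipartite graphs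

ind : Bool → ℕ
ind true  = 1
ind false = 0

-- The head varies fastest, as in `allColourings`, so that sums over both satisfy the same
-- recursion.
tuples : {A : Set} → ℕ → List A → List (List A)
tuples zero    L = [] ∷ []
tuples (suc a) L = concatMap (λ ys → map (_∷ ys) L) (tuples a L)

module _ {A : Set} where

  ∑-tuples-suc : ∀ a (L : List A) (F : List A → ℕ) →
    ∑ (tuples (suc a) L) F ≡ ∑ (tuples a L) (λ ys → ∑ L (λ y → F (y ∷ ys)))
  ∑-tuples-suc a L F = trans (∑-concatMap (λ ys → map (_∷ ys) L) (tuples a L) F)
    (∑-cong (tuples a L) (λ ys → ∑-map (_∷ ys) L F))

  ∑-^ : ∀ a (L : List A) (f : A → ℕ) → ∑ L f ^ a ≡ ∑ (tuples a L) (λ ys → ∏ ys f)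
  ∑-^ zero    L f = refl
  ∑-^ (suc a) L f = begin
    ∑ L f * ∑ L f ^ a                                    ≡⟨ cong (∑ L f *_) (∑-^ a L f) ⟩
    ∑ L f * ∑ (tuples a L) (λ ys → ∏ ys f)               ≡⟨ *-distribˡ-∑ (∑ L f) (tuples a L) _ ⟩
    ∑ (tuples a L) (λ ys → ∑ L f * ∏ ys f)               ≡⟨ ∑-cong (tuples a L) (λ ys → *-distribʳ-∑ (∏ ys f) L f) ⟩
    ∑ (tuples a L) (λ ys → ∑ L (λ y → f y * ∏ ys f))     ≡⟨ sym (∑-tuples-suc a L (λ ys → ∏ ys f)) ⟩
    ∑ (tuples (suc a) L) (λ ys → ∏ ys f)                 ∎
    where open ≡-Reasoning

  ∑-tuples-one : ∀ a (L : List A) → ∑ (tuples a L) (const 1) ≡ ∑ L (const 1) ^ a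
  ∑-tuples-one a L = trans (∑-cong (tuples a L) (λ ys → sym (∏-one ys))) (sym (∑-^ a L (const 1)))

  ∑-filterᵇ : ∀ (p : A → Bool) (L : List A) (f : A → ℕ) →
    ∑ (filterᵇ p L) f ≡ ∑ L (λ x → ind (p x) * f x)
  ∑-filterᵇ p []      f = refl
  ∑-filterᵇ p (x ∷ L) f with p x
  ... | true  = cong₂ _+_ (sym (*-identityˡ (f x))) (∑-filterᵇ p L f)
  ... | false = ∑-filterᵇ p L f

  ∑-tuples-filterᵇ : ∀ a (p : A → Bool) (L : List A) (F : List A → ℕ) →
    ∑ (tuples a (filterᵇ p L)) F ≡ ∑ (tuples a L) (λ ys → ∏ ys (ind ∘ p) * F ys)
  ∑-tuples-filterᵇ zero    p L F = cong (_+ 0) (sym (*-identityˡ (F [])))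
  ∑-tuples-filterᵇ (suc a) p L F = begin
    ∑ (tuples (suc a) L′) F                                                    ≡⟨ ∑-tuples-suc a L′ F ⟩
    ∑ (tuples a L′) (λ ys → ∑ L′ (λ y → F (y ∷ ys)))                           ≡⟨ ∑-tuples-filterᵇ a p L _ ⟩
    ∑ (tuples a L) (λ ys → ∏ ys w * ∑ L′ (λ y → F (y ∷ ys)))                   ≡⟨ ∑-cong (tuples a L) (λ ys → cong (∏ ys w *_) (∑-filterᵇ p L _)) ⟩
    ∑ (tuples a L) (λ ys → ∏ ys w * ∑ L (λ y → w y * F (y ∷ ys)))              ≡⟨ ∑-cong (tuples a L) (λ ys → *-distribˡ-∑ (∏ ys w) L _) ⟩
    ∑ (tuples a L) (λ ys → ∑ L (λ y → ∏ ys w * (w y * F (y ∷ ys))))            ≡⟨ ∑-cong (tuples a L) (λ ys → ∑-cong L (λ y → rearrange (∏ ys w) (w y) _)) ⟩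
    ∑ (tuples a L) (λ ys → ∑ L (λ y → ∏ (y ∷ ys) w * F (y ∷ ys)))              ≡⟨ sym (∑-tuples-suc a L _) ⟩
    ∑ (tuples (suc a) L) (λ ys → ∏ ys w * F ys)                                ∎
    where
    open ≡-Reasoning
    L′ = filterᵇ p L
    w = ind ∘ p
    rearrange : ∀ a b c → a * (b * c) ≡ b * a * c
    rearrange = solve-∀

  ∏-ind : ∀ (p : A → Bool) (L : List A) →
    ∏ L (ind ∘ p) ≡ 0 ⊎ (∏ L (ind ∘ p) ≡ 1 × All (λ x → p x ≡ true) L)
  ∏-ind p []      = inj₂ (refl , [])
  ∏-ind p (x ∷ L) with p x in px | ∏-ind p L
  ... | false | _                = inj₁ refl
  ... | true  | inj₁ z           = inj₁ (trans (*-identityˡ _) z)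
  ... | true  | inj₂ (one , all) = inj₂ (trans (*-identityˡ _) one , px ∷ all)

  ∏-ind-true : ∀ (p : A → Bool) {L : List A} → All (λ x → p x ≡ true) L → ∏ L (ind ∘ p) ≡ 1
  ∏-ind-true p []         = refl
  ∏-ind-true p (px ∷ all) rewrite px = trans (*-identityˡ _) (∏-ind-true p all)

  -- The two complements are disjoint, so the events f and g are negatively correlated.
  covering-correlation : ∀ (L : List A) (f g : A → ℕ) →
    (∀ x → (f x ≡ 1 × (g x ≡ 0 ⊎ g x ≡ 1)) ⊎ (f x ≡ 0 × g x ≡ 1)) →
    ∑ L (λ x → f x * g x) * ∑ L (const 1) ≤ ∑ L f * ∑ L g
  covering-correlation L f g cover with decompose L
    where
    decompose : ∀ L → ∃₂ λ j k → let i = ∑ L (λ x → f x * g x) in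
      ∑ L f ≡ i + j × ∑ L g ≡ i + k × ∑ L (const 1) ≡ i + (j + k)
    decompose []      = 0 , 0 , refl , refl , refl
    decompose (x ∷ L) with cover x | decompose L
    ... | inj₁ (fx , inj₁ gx) | j , k , p , q , r rewrite fx | gx | p | q | r =
      suc j , k , sym (+-suc _ j) , refl , sym (+-suc _ (j + k))
    ... | inj₁ (fx , inj₂ gx) | j , k , p , q , r rewrite fx | gx | p | q | r =
      j , k , refl , refl , refl
    ... | inj₂ (fx , gx)      | j , k , p , q , r rewrite fx | gx | p | q | r =
      j , suc k , refl , sym (+-suc _ k) , trans (sym (+-suc i (j + k))) (cong (i +_) (sym (+-suc j k)))
      where i = ∑ L (λ x → f x * g x)
  ... | j , k , p , q , r rewrite p | q | r =
    ≤-trans (m≤m+n _ (j * k)) (≤-reflexive (expand (∑ L (λ x → f x * g x)) j k))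
    where
    expand : ∀ i j k → i * (i + (j + k)) + j * k ≡ (i + j) * (i + k)
    expand = solve-∀

module Biclique {C : Set} (e : C → C → Bool) (e-sym : ∀ x y → e x y ≡ e y x) where

  E : C → C → ℕ
  E x y = ind (e x y)

  common : List C → List C → ℕ
  common Q ys = ∑ Q (λ z → ∏ ys (E z))

  -- The number of compatible colourings of K_{a,b} with colours in P on the first part and in Q on the second.
  T : List C → List C → ℕ → ℕ → ℕ
  T P Q a b = ∑ (tuples a P) (λ ys → common Q ys ^ b)

  restrict : C → List C → List C
  restrict x = filterᵇ (e x)

  shrink : Bool → C → List C → List C
  shrink σ x Q = if σ then restrict x Q else Q

  -- Compatible colourings of K_{a,b}, weighted by `h` on the first part, are counted once by the
  -- colours of the first part and once by those of the second.
  weighted-double-count : ∀ (P Q : List C) (h : C → ℕ) a b →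
    ∑ (tuples a P) (λ ys → ∏ ys h * common Q ys ^ b)
      ≡ ∑ (tuples b Q) (λ zs → ∑ P (λ y → h y * ∏ zs (E y)) ^ a)
  weighted-double-count P Q h a b = begin
    ∑ 𝐏 (λ ys → ∏ ys h * common Q ys ^ b)
      ≡⟨ ∑-cong 𝐏 (λ ys → cong (∏ ys h *_) (∑-^ b Q _)) ⟩
    ∑ 𝐏 (λ ys → ∏ ys h * ∑ 𝐐 (λ zs → ∏ zs (λ z → ∏ ys (E z))))
      ≡⟨ ∑-cong 𝐏 (λ ys → *-distribˡ-∑ (∏ ys h) 𝐐 _) ⟩
    ∑ 𝐏 (λ ys → ∑ 𝐐 (λ zs → ∏ ys h * ∏ zs (λ z → ∏ ys (E z))))
      ≡⟨ ∑-swap 𝐏 𝐐 _ ⟩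
    ∑ 𝐐 (λ zs → ∑ 𝐏 (λ ys → ∏ ys h * ∏ zs (λ z → ∏ ys (E z))))
      ≡⟨ ∑-cong 𝐐 (λ zs → ∑-cong 𝐏 (λ ys → exchange ys zs)) ⟩
    ∑ 𝐐 (λ zs → ∑ 𝐏 (λ ys → ∏ ys (λ y → h y * ∏ zs (E y))))
      ≡⟨ ∑-cong 𝐐 (λ zs → sym (∑-^ a P _)) ⟩
    ∑ 𝐐 (λ zs → ∑ P (λ y → h y * ∏ zs (E y)) ^ a) ∎
    where
    open ≡-Reasoning
    𝐏 = tuples a P
    𝐐 = tuples b Q
    exchange : ∀ ys zs → ∏ ys h * ∏ zs (λ z → ∏ ys (E z)) ≡ ∏ ys (λ y → h y * ∏ zs (E y))
    exchange ys zs = trans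
      (cong (∏ ys h *_) (trans (∏-swap zs ys E) (∏-cong ys (λ y → ∏-cong zs (λ z → cong ind (e-sym z y))))))
      (sym (∏-* ys h _))

  T-sym : ∀ P Q a b → T P Q a b ≡ T Q P b a
  T-sym P Q a b = begin
    T P Q a b                                                     ≡⟨ ∑-cong (tuples a P) (λ ys → sym (unit (∏-one ys))) ⟩
    ∑ (tuples a P) (λ ys → ∏ ys (const 1) * common Q ys ^ b)      ≡⟨ weighted-double-count P Q (const 1) a b ⟩
    ∑ (tuples b Q) (λ zs → ∑ P (λ y → 1 * ∏ zs (E y)) ^ a)        ≡⟨ ∑-cong (tuples b Q) (λ zs → cong (_^ a) (∑-cong P (λ y → *-identityˡ _))) ⟩
    T Q P b a                                                     ∎
    where
    open ≡-Reasoning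
    unit : ∀ {m n} → m ≡ 1 → m * n ≡ n
    unit refl = *-identityˡ _

  T-restrict : ∀ x P Q a b →
    T P (restrict x Q) a b ≡ ∑ (tuples b Q) (λ zs → ∏ zs (E x) * common P zs ^ a)
  T-restrict x P Q a b = trans (T-sym P (restrict x Q) a b) (∑-tuples-filterᵇ b (e x) Q _)

  -- Hölder's inequality against the constant 1 over `tuples a P`. It passes from a part of `q`
  -- vertices to one of `suc q`, the degree before the removal of `w`.
  T-reduceʳ : ∀ P Q a q → T P Q a q ^ suc q ≤ ∑ P (const 1) ^ a * T P Q a (suc q) ^ q
  T-reduceʳ P Q a q = begin
    T P Q a q ^ suc q
      ≡⟨ cong (_^ suc q) (∑-cong (tuples a P) (λ ys → sym (*-identityˡ _))) ⟩
    ∑ (tuples a P) (λ ys → 1 ^ 1 * common Q ys ^ q) ^ suc q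
      ≤⟨ hölder (tuples a P) (const 1) (common Q) 1 q ⟩
    ∑ (tuples a P) (const (1 ^ suc q)) ^ 1 * T P Q a (suc q) ^ q
      ≡⟨ cong (_* T P Q a (suc q) ^ q) (trans (^-identityʳ _)
           (trans (∑-cong (tuples a P) (λ _ → ^-zeroˡ (suc q))) (∑-tuples-one a P))) ⟩
    ∑ P (const 1) ^ a * T P Q a (suc q) ^ q ∎
    where open ≤-Reasoning

  T-reduceʳ-to-1 : ∀ P Q a q → T P Q a 1 ^ suc q ≤ (∑ P (const 1) ^ a) ^ q * T P Q a (suc q)
  T-reduceʳ-to-1 P Q a q = begin
    T P Q a 1 ^ suc q
      ≡⟨ cong (_^ suc q) (∑-cong (tuples a P) (λ ys → sym (trans (cong (common Q ys ^ 1 *_) (^-zeroˡ q)) (*-identityʳ _)))) ⟩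
    ∑ (tuples a P) (λ ys → common Q ys ^ 1 * 1 ^ q) ^ suc q
      ≤⟨ hölder (tuples a P) (common Q) (const 1) 1 q ⟩
    T P Q a (suc q) ^ 1 * ∑ (tuples a P) (const (1 ^ suc q)) ^ q
      ≡⟨ cong₂ (λ y z → y * z ^ q) (^-identityʳ (T P Q a (suc q)))
           (trans (∑-cong (tuples a P) (λ _ → ^-zeroˡ (suc q))) (∑-tuples-one a P)) ⟩
    T P Q a (suc q) * (∑ P (const 1) ^ a) ^ q
      ≡⟨ *-comm (T P Q a (suc q)) _ ⟩
    (∑ P (const 1) ^ a) ^ q * T P Q a (suc q) ∎
    where open ≤-Reasoning

  -- The core estimate for an edge `uv` with only `v` adjacent to `w`. Here `U`, `Q`, `X` are the
  -- lists of `u`, `v`, `w`, the degrees of `u` and `v` are `q` and `suc p`, and `q + r` will be Δ.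
  -- Hölder's inequality is used over the tuples of `q` colours from `Q` and then, after double
  -- counting, over the tuples of `suc p` colours from `X`.
  restricted-sum-bound : ∀ X U Q (t : C → ℕ) p q r →
    ∑ X (λ x → T U (restrict x Q) p q * t x ^ r) ^ (suc p * (q + r))
      ≤ T U Q (suc p) q ^ (p * (q + r))
        * (∑ X (λ x → t x ^ (q + r)) ^ (suc p * r) * T X Q (suc p) (q + r) ^ q)
  restricted-sum-bound X U Q t p q r = begin
    V ^ (suc p * (q + r))                                 ≡⟨ sym (^-*-assoc V (suc p) (q + r)) ⟩
    (V ^ suc p) ^ (q + r)                                 ≤⟨ ^-monoˡ-≤ (q + r) first ⟩
    (W * 𝒩 ^ p) ^ (q + r)                                 ≡⟨ ^-distribʳ-* (q + r) W (𝒩 ^ p) ⟩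
    W ^ (q + r) * (𝒩 ^ p) ^ (q + r)                       ≤⟨ *-monoˡ-≤ _ second ⟩
    M ^ q * S ^ (suc p * r) * (𝒩 ^ p) ^ (q + r)           ≡⟨ cong (M ^ q * S ^ (suc p * r) *_) (^-*-assoc 𝒩 p (q + r)) ⟩
    M ^ q * S ^ (suc p * r) * 𝒩 ^ (p * (q + r))           ≡⟨ rearrange (M ^ q) (S ^ (suc p * r)) (𝒩 ^ (p * (q + r))) ⟩
    𝒩 ^ (p * (q + r)) * (S ^ (suc p * r) * M ^ q)         ∎
    where
    open ≤-Reasoning
    V = ∑ X (λ x → T U (restrict x Q) p q * t x ^ r)
    𝒩 = T U Q (suc p) q
    M = T X Q (suc p) (q + r)
    S = ∑ X (λ x → t x ^ (q + r))
    k : List C → ℕ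
    k zs = ∑ X (λ x → t x ^ r * ∏ zs (E x))
    W = ∑ (tuples q Q) (λ zs → k zs ^ suc p)
    rearrange : ∀ a b c → a * b * c ≡ c * (b * a)
    rearrange = solve-∀
    rearrange′ : ∀ a b c → a * b * c ≡ c * a * b
    rearrange′ = solve-∀
    -- After the exchange of sums, `x` has to be compatible with all of `zs`: it acts as one more
    -- vertex beside the `p` vertices coloured from `U`. Hence the exponents 1 and `p`.
    V≡ : V ≡ ∑ (tuples q Q) (λ zs → k zs ^ 1 * common U zs ^ p)
    V≡ = trans (∑-cong X (λ x → trans (cong (_* t x ^ r) (T-restrict x U Q p q)) (*-distribʳ-∑ (t x ^ r) (tuples q Q) _)))
      (trans (∑-swap X (tuples q Q) _) (∑-cong (tuples q Q) (λ zs → trans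
        (∑-cong X (λ x → rearrange′ (∏ zs (E x)) (common U zs ^ p) (t x ^ r)))
        (trans (sym (*-distribʳ-∑ (common U zs ^ p) X _)) (cong (_* common U zs ^ p) (sym (^-identityʳ (k zs))))))))
    first : V ^ suc p ≤ W * 𝒩 ^ p
    first = begin
      V ^ suc p                                                       ≡⟨ cong (_^ suc p) V≡ ⟩
      ∑ (tuples q Q) (λ zs → k zs ^ 1 * common U zs ^ p) ^ suc p      ≤⟨ hölder (tuples q Q) k (common U) 1 p ⟩
      W ^ 1 * T Q U q (suc p) ^ p                                     ≡⟨ cong₂ (λ y z → y * z ^ p) (^-identityʳ W) (T-sym Q U q (suc p)) ⟩
      W * 𝒩 ^ p                                                       ∎
    second : W ^ (q + r) ≤ M ^ q * S ^ (suc p * r)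
    second = begin
      W ^ (q + r)
        ≡⟨ cong (_^ (q + r)) (sym (weighted-double-count X Q (λ x → t x ^ r) (suc p) q)) ⟩
      ∑ (tuples (suc p) X) (λ xs → ∏ xs (λ x → t x ^ r) * common Q xs ^ q) ^ (q + r)
        ≡⟨ cong (_^ (q + r)) (∑-cong (tuples (suc p) X) (λ xs → trans (cong (_* common Q xs ^ q) (∏-^ xs t r)) (*-comm _ (common Q xs ^ q)))) ⟩
      ∑ (tuples (suc p) X) (λ xs → common Q xs ^ q * ∏ xs t ^ r) ^ (q + r)
        ≤⟨ hölder (tuples (suc p) X) (common Q) (λ xs → ∏ xs t) q r ⟩
      M ^ q * ∑ (tuples (suc p) X) (λ xs → ∏ xs t ^ (q + r)) ^ r
        ≡⟨ cong (λ z → M ^ q * z ^ r) (trans (∑-cong (tuples (suc p) X) (λ xs → sym (∏-^ xs t (q + r)))) (sym (∑-^ (suc p) X _))) ⟩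
      M ^ q * (S ^ suc p) ^ r
        ≡⟨ cong (M ^ q *_) (^-*-assoc S (suc p) r) ⟩
      M ^ q * S ^ (suc p * r) ∎

  module _ (e-cotrans : ∀ x y z → e x z ≡ true → e x y ≡ true ⊎ e z y ≡ true) where

    common-restrict : ∀ x A {zs} → All (λ z → e x z ≡ true) zs →
      ∑ A (const 1) * common (restrict x A) zs ≤ ∑ (restrict x A) (const 1) * common A zs
    common-restrict x A {zs} x~zs = begin
      ∑ A (const 1) * common (restrict x A) zs                      ≡⟨ *-comm (∑ A (const 1)) _ ⟩
      common (restrict x A) zs * ∑ A (const 1)                      ≡⟨ cong (_* ∑ A (const 1)) (∑-filterᵇ (e x) A _) ⟩
      ∑ A (λ y → E x y * ∏ zs (E y)) * ∑ A (const 1)                ≤⟨ covering-correlation A (E x) (λ y → ∏ zs (E y)) cover ⟩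
      ∑ A (E x) * common A zs                                       ≡⟨ cong (_* common A zs) (∑-cong A (λ y → sym (*-identityʳ (E x y)))) ⟩
      ∑ A (λ y → E x y * 1) * common A zs                           ≡⟨ cong (_* common A zs) (sym (∑-filterᵇ (e x) A (const 1))) ⟩
      ∑ (restrict x A) (const 1) * common A zs                      ∎
      where
      open ≤-Reasoning
      cover : ∀ y → (E x y ≡ 1 × (∏ zs (E y) ≡ 0 ⊎ ∏ zs (E y) ≡ 1)) ⊎ (E x y ≡ 0 × ∏ zs (E y) ≡ 1)
      cover y with e x y in xy
      ... | true with ∏-ind (e y) zs
      ...   | inj₁ z       = inj₁ (refl , inj₁ z)
      ...   | inj₂ (o , _) = inj₁ (refl , inj₂ o)
      cover y | false = inj₂ (refl , ∏-ind-true (e y) (All.map y~z x~zs))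
        where
        y~z : ∀ {z} → e x z ≡ true → e y z ≡ true
        y~z {z} xz with e-cotrans x y z xz
        ... | inj₁ xy′ = contradiction (trans (sym xy) xy′) λ ()
        ... | inj₂ zy  = trans (e-sym y z) zy

    -- The p-th power of `common-restrict`, summed over the tuples compatible with `x`; for other
    -- tuples both sides vanish. Restricting the first list thus costs no more than the factor
    -- (|A_x| / |A|)^p, where A_x is `restrict x A`.
    T-restrict-both : ∀ x A B p q →
      ∑ A (const 1) ^ p * T (restrict x A) (restrict x B) p q
        ≤ ∑ (restrict x A) (const 1) ^ p * T A (restrict x B) p q
    T-restrict-both x A B p q = begin
      α ^ p * T (restrict x A) (restrict x B) p q                                     ≡⟨ cong (α ^ p *_) (T-restrict x (restrict x A) B p q) ⟩
      α ^ p * ∑ (tuples q B) (λ zs → ∏ zs (E x) * common (restrict x A) zs ^ p)       ≡⟨ *-distribˡ-∑ (α ^ p) (tuples q B) _ ⟩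
      ∑ (tuples q B) (λ zs → α ^ p * (∏ zs (E x) * common (restrict x A) zs ^ p))     ≤⟨ ∑-mono (tuples q B) pointwise ⟩
      ∑ (tuples q B) (λ zs → β ^ p * (∏ zs (E x) * common A zs ^ p))                  ≡⟨ sym (*-distribˡ-∑ (β ^ p) (tuples q B) _) ⟩
      β ^ p * ∑ (tuples q B) (λ zs → ∏ zs (E x) * common A zs ^ p)                    ≡⟨ cong (β ^ p *_) (sym (T-restrict x A B p q)) ⟩
      β ^ p * T A (restrict x B) p q                                                  ∎
      where
      open ≤-Reasoning
      α = ∑ A (const 1)
      β = ∑ (restrict x A) (const 1)
      pointwise : ∀ zs → α ^ p * (∏ zs (E x) * common (restrict x A) zs ^ p) ≤ β ^ p * (∏ zs (E x) * common A zs ^ p)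
      pointwise zs with ∏-ind (e x) zs
      ... | inj₁ z rewrite z = ≤-trans (≤-reflexive (*-zeroʳ (α ^ p))) z≤n
      ... | inj₂ (o , x~zs) rewrite o = begin
        α ^ p * (1 * common (restrict x A) zs ^ p)  ≡⟨ cong (α ^ p *_) (*-identityˡ _) ⟩
        α ^ p * common (restrict x A) zs ^ p        ≡⟨ sym (^-distribʳ-* p α _) ⟩
        (α * common (restrict x A) zs) ^ p          ≤⟨ ^-monoˡ-≤ p (common-restrict x A x~zs) ⟩
        (β * common A zs) ^ p                       ≡⟨ ^-distribʳ-* p β _ ⟩
        β ^ p * common A zs ^ p                     ≡⟨ cong (β ^ p *_) (sym (*-identityˡ _)) ⟩
        β ^ p * (1 * common A zs ^ p)               ∎

-- Entropy bounds

-- This is (1 - 1/(k+1))^m ≥ 1 - m/(k+1), cleared of denominators and of subtraction.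
bernoulli : ∀ m k → suc k ^ m * suc k ≤ k ^ m * suc k + m * suc k ^ m
bernoulli zero    k = ≤-reflexive (sym (+-identityʳ _))
bernoulli (suc m) k = begin
  suc k * x * suc k                                  ≡⟨ e₁ k x ⟩
  k * (x * suc k) + suc k * x                        ≤⟨ +-monoˡ-≤ _ (*-monoʳ-≤ k (bernoulli m k)) ⟩
  k * (y * suc k + m * x) + suc k * x                ≤⟨ m≤m+n _ (m * x) ⟩
  k * (y * suc k + m * x) + suc k * x + m * x        ≡⟨ e₂ k x y m ⟩
  k * y * suc k + suc m * (suc k * x)                ∎
  where
  open ≤-Reasoning
  x = suc k ^ m
  y = k ^ m
  e₁ : ∀ k x → suc k * x * suc k ≡ k * (x * suc k) + suc k * x
  e₁ = solve-∀
  e₂ : ∀ k x y m → k * (y * suc k + m * x) + suc k * x + m * x ≡ k * y * suc k + suc m * (suc k * x)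
  e₂ = solve-∀

-- Bernoulli's inequality gives (1 + 1/k)^m ≤ (m + s) / s when `suc k` is `m + s`. If `b < a`, the
-- hypothesis then yields `suc b * s ≤ b * (m + s)`, that is `s ≤ b * m`; the choice
-- `s = suc (b * m)` contradicts this.
≤-limit : ∀ m a b → (∀ k .{{_ : NonZero k}} → a * k ^ m ≤ suc k ^ m * b) → a ≤ b
≤-limit zero      a b le = subst₂ _≤_ (*-identityʳ a) (*-identityˡ b) (le 1)
≤-limit m@(suc _) a b le = ≮⇒≥ λ b<a → <⇒≱ (n<1+n (b * m)) (bounded b<a)
  where
  open ≤-Reasoning
  k = m + b * m
  s = suc (b * m)
  x = suc k ^ m
  y = k ^ m
  k+1≡m+s : suc k ≡ m + s
  k+1≡m+s = sym (+-suc m (b * m))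
  xs≤y[m+s] : x * s ≤ y * (m + s)
  xs≤y[m+s] = +-cancelʳ-≤ (m * x) _ _ (begin
    x * s + m * x        ≡⟨ e x s m ⟩
    x * (m + s)          ≡⟨ cong (x *_) (sym k+1≡m+s) ⟩
    x * suc k            ≤⟨ bernoulli m k ⟩
    y * suc k + m * x    ≡⟨ cong (λ z → y * z + m * x) k+1≡m+s ⟩
    y * (m + s) + m * x  ∎)
    where
    e : ∀ x s m → x * s + m * x ≡ x * (m + s)
    e = solve-∀
  bounded : b < a → s ≤ b * m
  bounded b<a = +-cancelˡ-≤ (b * s) _ _ (*-cancelˡ-≤ x {{m^n≢0 (suc k) m}} (begin
    x * (b * s + s)      ≡⟨ e₁ x b s ⟩
    suc b * (x * s)      ≤⟨ *-monoʳ-≤ (suc b) xs≤y[m+s] ⟩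
    suc b * (y * (m + s))  ≡⟨ sym (*-assoc (suc b) y (m + s)) ⟩
    suc b * y * (m + s)  ≤⟨ *-monoˡ-≤ (m + s) (*-monoˡ-≤ y b<a) ⟩
    a * y * (m + s)      ≤⟨ *-monoˡ-≤ (m + s) (le k) ⟩
    x * b * (m + s)      ≡⟨ e₂ x b m s ⟩
    x * (b * s + b * m)  ∎))
    where
    e₁ : ∀ x b s → x * (b * s + s) ≡ suc b * (x * s)
    e₁ = solve-∀
    e₂ : ∀ x b m s → x * b * (m + s) ≡ x * (b * s + b * m)
    e₂ = solve-∀

-- In terms of the distribution π = m / S on X, Bound F s R says that
-- 𝔼 (log F) ≤ log R − s H(π), where H is the entropy.
module Entropy {C : Set} (X : List C) (m : C → ℕ) where

  S T̂ : ℕ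
  S = ∑ X m
  T̂ = ∏ X (λ x → m x ^ m x)

  𝔸 : (C → ℕ) → ℕ
  𝔸 F = ∏ X (λ x → F x ^ m x)

  record Bound (F : C → ℕ) (s R : ℕ) : Set where
    constructor mkBound
    field bound : 𝔸 F * (S ^ S) ^ s ≤ T̂ ^ s * R ^ S

  T̂≢0 : NonZero T̂
  T̂≢0 = ∏≢0 X (λ x → n^n≢0 (m x))

  𝔸-mono : ∀ {F G} → (∀ x → F x ≤ G x) → 𝔸 F ≤ 𝔸 G
  𝔸-mono le = ∏-mono X (λ x → ^-monoˡ-≤ (m x) (le x))

  𝔸-* : ∀ F G → 𝔸 (λ x → F x * G x) ≡ 𝔸 F * 𝔸 G
  𝔸-* F G = trans (∏-cong X (λ x → ^-distribʳ-* (m x) (F x) (G x))) (∏-* X _ _)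

  𝔸-^ : ∀ F n → 𝔸 (λ x → F x ^ n) ≡ 𝔸 F ^ n
  𝔸-^ F n = trans (∏-cong X (λ x → trans (^-*-assoc (F x) n (m x))
    (trans (cong (F x ^_) (*-comm n (m x))) (sym (^-*-assoc (F x) (m x) n))))) (∏-^ X _ n)

  𝔸-const : ∀ κ → 𝔸 (const κ) ≡ κ ^ S
  𝔸-const κ = ∏-^-∑ X κ m

  bound-mono : ∀ {F G s Q R} → (∀ x → F x ≤ G x) → Q ≤ R → Bound G s Q → Bound F s R
  bound-mono {s = s} F≤G Q≤R (mkBound b) = mkBound (
    ≤-trans (*-monoˡ-≤ _ (𝔸-mono F≤G)) (≤-trans b (*-monoʳ-≤ (T̂ ^ s) (^-monoˡ-≤ S Q≤R))))

  bound-cong : ∀ {F G s t Q R} → (∀ x → F x ≡ G x) → s ≡ t → Q ≡ R → Bound F s Q → Bound G t R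
  bound-cong F≡G refl refl = bound-mono (λ x → ≤-reflexive (sym (F≡G x))) ≤-refl

  bound-const : ∀ κ → Bound (const κ) 0 κ
  bound-const κ = mkBound (≤-reflexive (trans (*-identityʳ _) (trans (𝔸-const κ) (sym (*-identityˡ _)))))

  bound-* : ∀ {F G s t Q R} → Bound F s Q → Bound G t R → Bound (λ x → F x * G x) (s + t) (Q * R)
  bound-* {F} {G} {s} {t} {Q} {R} (mkBound b) (mkBound c) = mkBound (begin
    𝔸 (λ x → F x * G x) * (S ^ S) ^ (s + t)            ≡⟨ cong₂ _*_ (𝔸-* F G) (^-distribˡ-+-* (S ^ S) s t) ⟩
    𝔸 F * 𝔸 G * ((S ^ S) ^ s * (S ^ S) ^ t)            ≡⟨ *-interchange (𝔸 F) _ _ _ ⟩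
    𝔸 F * (S ^ S) ^ s * (𝔸 G * (S ^ S) ^ t)            ≤⟨ *-mono-≤ b c ⟩
    T̂ ^ s * Q ^ S * (T̂ ^ t * R ^ S)                    ≡⟨ *-interchange (T̂ ^ s) _ _ _ ⟩
    T̂ ^ s * T̂ ^ t * (Q ^ S * R ^ S)                    ≡⟨ cong₂ _*_ (sym (^-distribˡ-+-* T̂ s t)) (sym (^-distribʳ-* S Q R)) ⟩
    T̂ ^ (s + t) * (Q * R) ^ S                          ∎)
    where open ≤-Reasoning

  bound-^ : ∀ {F s R} n → Bound F s R → Bound (λ x → F x ^ n) (s * n) (R ^ n)
  bound-^ {F} {s} {R} n (mkBound b) = mkBound (begin
    𝔸 (λ x → F x ^ n) * (S ^ S) ^ (s * n)    ≡⟨ cong₂ _*_ (𝔸-^ F n) (sym (^-*-assoc (S ^ S) s n)) ⟩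
    𝔸 F ^ n * ((S ^ S) ^ s) ^ n              ≡⟨ sym (^-distribʳ-* n (𝔸 F) _) ⟩
    (𝔸 F * (S ^ S) ^ s) ^ n                  ≤⟨ ^-monoˡ-≤ n b ⟩
    (T̂ ^ s * R ^ S) ^ n                      ≡⟨ ^-distribʳ-* n (T̂ ^ s) _ ⟩
    (T̂ ^ s) ^ n * (R ^ S) ^ n                ≡⟨ cong₂ _*_ (^-*-assoc T̂ s n) (^-*-assoc R S n) ⟩
    T̂ ^ (s * n) * R ^ (S * n)                ≡⟨ cong (λ z → T̂ ^ (s * n) * R ^ z) (*-comm S n) ⟩
    T̂ ^ (s * n) * R ^ (n * S)                ≡⟨ cong (T̂ ^ (s * n) *_) (sym (^-*-assoc R n S)) ⟩
    T̂ ^ (s * n) * (R ^ n) ^ S                ∎)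
    where open ≤-Reasoning

  bound-∏ : ∀ {I : Set} (L : List I) {F : I → C → ℕ} {s R : I → ℕ} →
    (∀ i → Bound (F i) (s i) (R i)) → Bound (λ x → ∏ L (λ i → F i x)) (∑ L s) (∏ L R)
  bound-∏ []      b = bound-const 1
  bound-∏ (i ∷ L) b = bound-* (b i) (bound-∏ L b)

  bound-cancel : ∀ {F s R} κ .{{_ : NonZero κ}} → Bound (λ x → κ * F x) s (κ * R) → Bound F s R
  bound-cancel {F} {s} {R} κ (mkBound b) = mkBound (*-cancelˡ-≤ (κ ^ S) {{m^n≢0 κ S}} (begin
    κ ^ S * (𝔸 F * (S ^ S) ^ s)              ≡⟨ sym (*-assoc (κ ^ S) _ _) ⟩
    κ ^ S * 𝔸 F * (S ^ S) ^ s                ≡⟨ cong (λ z → z * 𝔸 F * (S ^ S) ^ s) (sym (𝔸-const κ)) ⟩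
    𝔸 (const κ) * 𝔸 F * (S ^ S) ^ s          ≡⟨ cong (_* (S ^ S) ^ s) (sym (𝔸-* (const κ) F)) ⟩
    𝔸 (λ x → κ * F x) * (S ^ S) ^ s          ≤⟨ b ⟩
    T̂ ^ s * (κ * R) ^ S                      ≡⟨ cong (T̂ ^ s *_) (^-distribʳ-* S κ R) ⟩
    T̂ ^ s * (κ ^ S * R ^ S)                  ≡⟨ e (T̂ ^ s) (κ ^ S) (R ^ S) ⟩
    κ ^ S * (T̂ ^ s * R ^ S)                  ∎))
    where
    open ≤-Reasoning
    e : ∀ a b c → a * (b * c) ≡ b * (a * c)
    e = solve-∀

  bound-zero : .{{_ : NonZero S}} → ∀ {F s R} → (∀ x → F x ≡ 0) → Bound F s R
  bound-zero {F} {s} {R} F≡0 = mkBound (subst (λ z → z * (S ^ S) ^ s ≤ T̂ ^ s * R ^ S)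
    (sym (trans (∏-cong X (λ x → cong (_^ m x) (F≡0 x))) (trans (𝔸-const 0) (0^n S)))) z≤n)
    where
    0^n : ∀ n → .{{NonZero n}} → 0 ^ n ≡ 0
    0^n (suc n) = refl

  -- The average of `log m` plus the entropy is `log S`, because `𝔸 m` is `T̂`. This is the equality
  -- case of Gibbs' inequality, and it recovers a bound on a sum from a bound on an average
  -- logarithm.
  bound-weights : .{{_ : NonZero S}} → ∀ {F D R} → (∀ x → m x ^ D ≤ F x) → Bound F D R → S ^ D ≤ R
  bound-weights {F} {D} {R} m^D≤F (mkBound b) = ^-cancelˡ-≤ S (*-cancelˡ-≤ (T̂ ^ D) {{m^n≢0 T̂ D {{T̂≢0}}}} (begin
    T̂ ^ D * (S ^ D) ^ S          ≡⟨ cong (T̂ ^ D *_) (trans (^-*-assoc S D S) (trans (cong (S ^_) (*-comm D S)) (sym (^-*-assoc S S D)))) ⟩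
    T̂ ^ D * (S ^ S) ^ D          ≡⟨ cong (_* (S ^ S) ^ D) (sym (𝔸-^ m D)) ⟩
    𝔸 (λ x → m x ^ D) * (S ^ S) ^ D  ≤⟨ *-monoˡ-≤ _ (𝔸-mono m^D≤F) ⟩
    𝔸 F * (S ^ S) ^ D            ≤⟨ b ⟩
    T̂ ^ D * R ^ S                ∎))
    where open ≤-Reasoning

root : ∀ d .{{_ : NonZero d}} y → ∃ λ t → t ^ d ≤ y × y < suc t ^ d
root d@(suc j) y = search (suc y) (m≤m*n (suc y) _ {{m^n≢0 (suc y) j}})
  where
  search : ∀ k → y < k ^ d → ∃ λ t → t ^ d ≤ y × y < suc t ^ d
  search (suc k) y<k with k ^ d ≤? y
  ... | yes k≤y = k , k≤y , y<k
  ... | no  k≰y = search k (≰⇒> k≰y)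

-- t = ⌊k c^{1/d}⌋ satisfies k c^{1/d} ≤ (1 + 1/k) t, and k → ∞.
∑-by-powers : ∀ {C : Set} (X : List C) (c : C → ℕ) d D R .{{_ : NonZero d}} .{{_ : NonZero D}} →
  (∀ k .{{_ : NonZero k}} (t : C → ℕ) → (∀ x → t x ^ d ≤ k ^ d * c x) →
     {{_ : NonZero (∑ X (λ x → t x ^ d))}} → ∑ X (λ x → t x ^ d) ^ D ≤ (k ^ d) ^ D * R) →
  ∑ X c ^ D ≤ R
∑-by-powers {C} X c d D@(suc _) R powers = ≤-limit (d * D) _ R scaled
  where
  open ≤-Reasoning
  pointwise : ∀ k .{{_ : NonZero k}} c t → t ^ d ≤ k ^ d * c → k ^ d * c < suc t ^ d →
    c * (k ^ d * k ^ d) ≤ suc k ^ d * t ^ d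
  pointwise k zero        t lo hi = z≤n
  pointwise k c@(suc _)   t lo hi = begin
    c * (k ^ d * k ^ d)      ≡⟨ e c (k ^ d) ⟩
    k ^ d * c * k ^ d        ≤⟨ *-monoˡ-≤ (k ^ d) (<⇒≤ hi) ⟩
    suc t ^ d * k ^ d        ≡⟨ sym (^-distribʳ-* d (suc t) k) ⟩
    (suc t * k) ^ d          ≤⟨ ^-monoˡ-≤ d (+-mono-≤ k≤t (≤-reflexive (*-comm t k))) ⟩
    (suc k * t) ^ d          ≡⟨ ^-distribʳ-* d (suc k) t ⟩
    suc k ^ d * t ^ d        ∎
    where
    e : ∀ c z → c * (z * z) ≡ z * c * z
    e = solve-∀
    -- For positive `c` the root is at least `k`, so t + 1 ≤ (1 + 1/k) t; `c = 0` was the trivial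
    -- case.
    k≤t : k ≤ t
    k≤t = ≮⇒≥ λ t<k → <⇒≱ hi (≤-trans (^-monoˡ-≤ d t<k) (m≤m*n (k ^ d) c))
  scaled : ∀ k .{{_ : NonZero k}} → ∑ X c ^ D * k ^ (d * D) ≤ suc k ^ (d * D) * R
  scaled k = *-cancelʳ-≤ _ _ ((k ^ d) ^ D) {{m^n≢0 _ D {{m^n≢0 k d}}}} (begin
    ∑ X c ^ D * k ^ (d * D) * (k ^ d) ^ D      ≡⟨ cong (λ z → ∑ X c ^ D * z * (k ^ d) ^ D) (sym (^-*-assoc k d D)) ⟩
    ∑ X c ^ D * (k ^ d) ^ D * (k ^ d) ^ D      ≡⟨ *-assoc (∑ X c ^ D) _ _ ⟩
    ∑ X c ^ D * ((k ^ d) ^ D * (k ^ d) ^ D)    ≡⟨ cong (∑ X c ^ D *_) (sym (^-distribʳ-* D (k ^ d) (k ^ d))) ⟩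
    ∑ X c ^ D * (k ^ d * k ^ d) ^ D            ≡⟨ sym (^-distribʳ-* D (∑ X c) _) ⟩
    (∑ X c * (k ^ d * k ^ d)) ^ D              ≤⟨ ^-monoˡ-≤ D summed ⟩
    (suc k ^ d * S) ^ D                        ≡⟨ ^-distribʳ-* D (suc k ^ d) S ⟩
    (suc k ^ d) ^ D * S ^ D                    ≤⟨ *-monoʳ-≤ ((suc k ^ d) ^ D) S^D≤ ⟩
    (suc k ^ d) ^ D * ((k ^ d) ^ D * R)        ≡⟨ cong (_* ((k ^ d) ^ D * R)) (^-*-assoc (suc k) d D) ⟩
    suc k ^ (d * D) * ((k ^ d) ^ D * R)        ≡⟨ e (suc k ^ (d * D)) ((k ^ d) ^ D) R ⟩
    suc k ^ (d * D) * R * (k ^ d) ^ D          ∎)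
    where
    e : ∀ a b c → a * (b * c) ≡ a * c * b
    e = solve-∀
    rt : ∀ x → ∃ λ t → t ^ d ≤ k ^ d * c x × k ^ d * c x < suc t ^ d
    rt x = root d (k ^ d * c x)
    t : C → ℕ
    t x = proj₁ (rt x)
    S = ∑ X (λ x → t x ^ d)
    summed : ∑ X c * (k ^ d * k ^ d) ≤ suc k ^ d * S
    summed = begin
      ∑ X c * (k ^ d * k ^ d)                  ≡⟨ *-distribʳ-∑ (k ^ d * k ^ d) X c ⟩
      ∑ X (λ x → c x * (k ^ d * k ^ d))        ≤⟨ ∑-mono X (λ x → pointwise k (c x) (t x) (proj₁ (proj₂ (rt x))) (proj₂ (proj₂ (rt x)))) ⟩
      ∑ X (λ x → suc k ^ d * t x ^ d)          ≡⟨ sym (*-distribˡ-∑ (suc k ^ d) X _) ⟩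
      suc k ^ d * S                            ∎
    S^D≤ : S ^ D ≤ (k ^ d) ^ D * R
    S^D≤ with S in S≡
    ... | zero  = z≤n
    ... | suc s = subst (λ z → z ^ D ≤ (k ^ d) ^ D * R) S≡
      (powers k t (λ x → proj₁ (proj₂ (rt x))) {{subst NonZero (sym S≡) _}})

-- It is enough to bound averages for weights that are perfect `d`-th powers. With `d = Δ` the edge
-- estimates can use `t x ^ r`, which is the weight to the power r/Δ.
∑-by-entropy : ∀ {C : Set} (X : List C) (c : C → ℕ) d D R (G : C → ℕ) .{{_ : NonZero d}} .{{_ : NonZero D}} →
  (∀ x → c x ^ D ≤ G x) →
  (∀ t → {{_ : NonZero (∑ X (λ x → t x ^ d))}} → Entropy.Bound X (λ x → t x ^ d) G D R) →
  ∑ X c ^ D ≤ R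
∑-by-entropy X c d D R G c≤G bound = ∑-by-powers X c d D R λ k t t≤c →
  let open Entropy X (λ x → t x ^ d) in
  bound-weights
    (λ x → ≤-trans (^-monoˡ-≤ D (t≤c x)) (≤-trans (≤-reflexive (^-distribʳ-* D (k ^ d) (c x)))
       (*-monoʳ-≤ ((k ^ d) ^ D) (c≤G x))))
    (bound-* (bound-const ((k ^ d) ^ D)) (bound t))

-- Gibbs' bound A s ≤ v^S θ^q is raised to the power a (q + r), where the bound on v^(a (q + r)) applies.
gibbs-power : ∀ A s θ v n M a b q r (S : ℕ) → NonZero s → s ≡ S ^ S →
  A * s ≤ v ^ S * θ ^ q →
  v ^ (a * (q + r)) ≤ n ^ b * (S ^ (a * r) * M ^ q) →
  A ^ (a * (q + r)) * s ^ (q * a) ≤ (θ ^ (q + r)) ^ (q * a) * (n ^ b * M ^ q) ^ S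
gibbs-power A s θ v n M a b q r S s≢0 s≡ le₁ le₂ = *-cancelʳ-≤ _ _ (s ^ (a * r)) {{m^n≢0 s (a * r) {{s≢0}}}} (begin
  A ^ (a * (q + r)) * s ^ (q * a) * s ^ (a * r)                    ≡⟨ e₁ ⟩
  (A * s) ^ (a * (q + r))                                          ≤⟨ ^-monoˡ-≤ (a * (q + r)) le₁ ⟩
  (v ^ S * θ ^ q) ^ (a * (q + r))                                  ≡⟨ e₂ ⟩
  (v ^ (a * (q + r))) ^ S * (θ ^ (q + r)) ^ (q * a)                ≤⟨ *-monoˡ-≤ _ (^-monoˡ-≤ S le₂) ⟩
  (n ^ b * (S ^ (a * r) * M ^ q)) ^ S * (θ ^ (q + r)) ^ (q * a)    ≡⟨ e₃ ⟩
  (θ ^ (q + r)) ^ (q * a) * (n ^ b * M ^ q) ^ S * (S ^ S) ^ (a * r)  ≡⟨ cong (λ z → (θ ^ (q + r)) ^ (q * a) * (n ^ b * M ^ q) ^ S * z ^ (a * r)) (sym s≡) ⟩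
  (θ ^ (q + r)) ^ (q * a) * (n ^ b * M ^ q) ^ S * s ^ (a * r)      ∎)
  where
  open ≤-Reasoning
  e₁ : A ^ (a * (q + r)) * s ^ (q * a) * s ^ (a * r) ≡ (A * s) ^ (a * (q + r))
  e₁ = monomial-≡ (A ∷ s ∷ [])
    (var (# 0) ↑ (a * (q + r)) ⊗ var (# 1) ↑ (q * a) ⊗ var (# 1) ↑ (a * r))
    ((var (# 0) ⊗ var (# 1)) ↑ (a * (q + r)))
    (i a q r ∷ j a q r ∷ [])
    where
    i : ∀ a q r → 1 * (a * (q + r)) + 0 * (q * a) + 0 * (a * r) ≡ (1 + 0) * (a * (q + r))
    i = solve-∀
    j : ∀ a q r → 0 * (a * (q + r)) + 1 * (q * a) + 1 * (a * r) ≡ (0 + 1) * (a * (q + r))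
    j = solve-∀
  e₂ : (v ^ S * θ ^ q) ^ (a * (q + r)) ≡ (v ^ (a * (q + r))) ^ S * (θ ^ (q + r)) ^ (q * a)
  e₂ = monomial-≡ (v ∷ θ ∷ [])
    ((var (# 0) ↑ S ⊗ var (# 1) ↑ q) ↑ (a * (q + r)))
    ((var (# 0) ↑ (a * (q + r))) ↑ S ⊗ (var (# 1) ↑ (q + r)) ↑ (q * a))
    (i a q r S ∷ j a q r S ∷ [])
    where
    i : ∀ a q r S → (1 * S + 0 * q) * (a * (q + r)) ≡ 1 * (a * (q + r)) * S + 0 * (q + r) * (q * a)
    i = solve-∀
    j : ∀ a q r S → (0 * S + 1 * q) * (a * (q + r)) ≡ 0 * (a * (q + r)) * S + 1 * (q + r) * (q * a)
    j = solve-∀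
  e₃ : (n ^ b * (S ^ (a * r) * M ^ q)) ^ S * (θ ^ (q + r)) ^ (q * a)
     ≡ (θ ^ (q + r)) ^ (q * a) * (n ^ b * M ^ q) ^ S * (S ^ S) ^ (a * r)
  e₃ = monomial-≡ (n ^ b ∷ S ∷ M ^ q ∷ (θ ^ (q + r)) ^ (q * a) ∷ [])
    ((var (# 0) ⊗ (var (# 1) ↑ (a * r) ⊗ var (# 2))) ↑ S ⊗ var (# 3))
    (var (# 3) ⊗ (var (# 0) ⊗ var (# 2)) ↑ S ⊗ (var (# 1) ↑ S) ↑ (a * r))
    (i₀ a r S ∷ i₁ a r S ∷ i₂ a r S ∷ i₃ a r S ∷ [])
    where
    i₀ : ∀ a r S → (1 + (0 * (a * r) + 0)) * S + 0 ≡ 0 + (1 + 0) * S + 0 * S * (a * r)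
    i₀ = solve-∀
    i₁ : ∀ a r S → (0 + (1 * (a * r) + 0)) * S + 0 ≡ 0 + (0 + 0) * S + 1 * S * (a * r)
    i₁ = solve-∀
    i₂ : ∀ a r S → (0 + (0 * (a * r) + 1)) * S + 0 ≡ 0 + (0 + 1) * S + 0 * S * (a * r)
    i₂ = solve-∀
    i₃ : ∀ a r S → (0 + (0 * (a * r) + 0)) * S + 1 ≡ 1 + (0 + 0) * S + 0 * S * (a * r)
    i₃ = solve-∀

-- Entropy bounds for a single edge

module Local {C : Set} (e : C → C → Bool) (e-sym : ∀ x y → e x y ≡ e y x)
  (X : List C) (t : C → ℕ) (Δ : ℕ) (Δ≢0 : NonZero Δ) where

  open Biclique e e-sym
  open Entropy X (λ x → t x ^ Δ)

  -- Gibbs' inequality for `H x * t x ^ r`. Since `T̂` is `𝔸 t` to the power `q + r`, the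
  -- contribution of `t x ^ r` cancels and `q` factors remain.
  gibbs-restrict : ∀ (H : C → ℕ) q r → q + r ≡ Δ →
    𝔸 H * S ^ S ≤ ∑ X (λ x → H x * t x ^ r) ^ S * 𝔸 t ^ q
  gibbs-restrict H q r refl = *-cancelʳ-≤ _ _ (θ ^ r) {{m^n≢0 θ r {{θ≢0}}}} (begin
    𝔸 H * S ^ S * θ ^ r                   ≡⟨ e₁ (𝔸 H) (S ^ S) (θ ^ r) ⟩
    𝔸 H * θ ^ r * S ^ S                   ≡⟨ cong (_* S ^ S) (sym (trans (𝔸-* H _) (cong (𝔸 H *_) (𝔸-^ t r)))) ⟩
    𝔸 (λ x → H x * t x ^ r) * S ^ S       ≤⟨ gibbs X (λ x → H x * t x ^ r) (λ x → t x ^ Δ) ⟩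
    V ^ S * T̂                             ≡⟨ cong (V ^ S *_) (𝔸-^ t Δ) ⟩
    V ^ S * θ ^ (q + r)                   ≡⟨ cong (V ^ S *_) (^-distribˡ-+-* θ q r) ⟩
    V ^ S * (θ ^ q * θ ^ r)               ≡⟨ sym (*-assoc (V ^ S) _ _) ⟩
    V ^ S * θ ^ q * θ ^ r                 ∎)
    where
    open ≤-Reasoning
    θ = 𝔸 t
    V = ∑ X (λ x → H x * t x ^ r)
    e₁ : ∀ a b c → a * b * c ≡ a * c * b
    e₁ = solve-∀
    -- At `t = 0` the exponent `0 ^ d` is 0 for positive `d`, and `0 ^ 0` is 1.
    t^t^d≢0 : ∀ t d → NonZero d → NonZero (t ^ (t ^ d))
    t^t^d≢0 zero    (suc d) _ = _
    t^t^d≢0 (suc t) d       _ = m^n≢0 (suc t) (suc t ^ d)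
    θ≢0 : NonZero θ
    θ≢0 = ∏≢0 X (λ x → t^t^d≢0 (t x) Δ Δ≢0)

  -- `gibbs-restrict` leads to the sum `V`, and `restricted-sum-bound` bounds a power of `V`. The
  -- powers of `S` in the latter cancel part of the entropy, which leaves `q * suc p`.
  bound-T-restrict : ∀ U Q p q → q ≤ Δ →
    Bound (λ x → T U (restrict x Q) p q ^ (suc p * Δ)) (q * suc p)
      (T U Q (suc p) q ^ (p * Δ) * T X Q (suc p) Δ ^ q)
  bound-T-restrict U Q p q q≤Δ with r , q+r≡Δ ← m≤n⇒∃[o]m+o≡n q≤Δ =
    mkBound (subst₂ (λ y z → y * (S ^ S) ^ (q * suc p) ≤ z ^ (q * suc p) * R ^ S) (sym (𝔸-^ H (suc p * Δ))) (sym (𝔸-^ t Δ))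
      (subst (λ z → 𝔸 H ^ (suc p * z) * (S ^ S) ^ (q * suc p) ≤ (𝔸 t ^ z) ^ (q * suc p) * R ^ S) q+r≡Δ
        (gibbs-power (𝔸 H) (S ^ S) (𝔸 t) V (T U Q (suc p) q) M (suc p) (p * Δ) q r S (n^n≢0 S) refl
          (gibbs-restrict H q r q+r≡Δ)
          (subst (λ z → V ^ (suc p * (q + r)) ≤ T U Q (suc p) q ^ (p * z) * (∑ X (λ x → t x ^ z) ^ (suc p * r) * T X Q (suc p) z ^ q)) q+r≡Δ
            (restricted-sum-bound X U Q t p q r)))))
    where
    H : C → ℕ
    H x = T U (restrict x Q) p q
    V = ∑ X (λ x → H x * t x ^ r)
    M = T X Q (suc p) Δ
    R = T U Q (suc p) q ^ (p * Δ) * M ^ q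

  -- The case `p = 0`, `q = 1` of `bound-T-restrict`: an empty part against a single vertex.
  bound-restrict : ∀ Q → Bound (λ x → ∑ (restrict x Q) (const 1) ^ Δ) 1 (T X Q 1 Δ)
  bound-restrict Q = bound-mono
    (λ x → ≤-reflexive (trans (cong (_^ Δ) (sym (trans (+-identityʳ _) (*-identityʳ _)))) (cong (T Q (restrict x Q) 0 1 ^_) (sym (*-identityˡ Δ)))))
    (≤-reflexive (trans (*-identityˡ _) (*-identityʳ _)))
    (bound-T-restrict Q Q 0 1 (>-nonZero⁻¹ Δ {{Δ≢0}}))

  module _ (e-cotrans : ∀ x y z → e x z ≡ true → e x y ≡ true ⊎ e z y ≡ true) (S≢0 : NonZero S) where

    -- `T-restrict-both` splits the count, multiplied by a power of `α`, into the size of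
    -- `restrict x A` and a count with one restricted list; both have entropy bounds already.
    -- Division by `α` needs a nonempty `A`; for empty `A` the count is 0 because `p` is nonzero.
    bound-T-restrict-both : ∀ A B p q .{{_ : NonZero p}} → q ≤ Δ → let a = suc p; b = suc q in
      Bound (λ x → T (restrict x A) (restrict x B) p q ^ (a * b * Δ)) (a * b * (p + q))
        (T X A b Δ ^ (p * a) * T X B a Δ ^ (q * b) * T A B a b ^ (p * q * Δ))
    bound-T-restrict-both [] B p@(suc p′) q q≤Δ = bound-zero {{S≢0}}
      (λ x → zero-power (suc p * suc q * Δ) {{m*n≢0 (suc p * suc q) Δ {{_}} {{Δ≢0}}}} (T-empty x))
      where
      zero-power : ∀ n {m} → .{{NonZero n}} → m ≡ 0 → m ^ n ≡ 0
      zero-power (suc n) refl = refl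
      T-empty : ∀ x → T [] (restrict x B) p q ≡ 0
      T-empty x = trans (∑-tuples-suc p′ [] (λ ys → common (restrict x B) ys ^ q)) (∑-zero (tuples p′ []))
    bound-T-restrict-both A@(_ ∷ _) B p q q≤Δ = bound-cancel κ {{m^n≢0 α (p * (a * b * Δ))}}
      (bound-mono pointwise constants
        (bound-cong (λ x → refl) (e₁ a b p q) refl
          (bound-* (bound-^ (p * a * b) (bound-restrict A)) (bound-^ b (bound-T-restrict A B p q q≤Δ)))))
      where
      open ≤-Reasoning
      a = suc p
      b = suc q
      α = ∑ A (const 1)
      κ = α ^ (p * (a * b * Δ))
      𝒩 = T A B a b
      M_A = T X A b Δ
      M_B = T X B a Δ
      e₁ : ∀ a b p q → 1 * (p * a * b) + q * a * b ≡ a * b * (p + q)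
      e₁ = solve-∀
      pointwise : ∀ x → κ * T (restrict x A) (restrict x B) p q ^ (a * b * Δ)
        ≤ (∑ (restrict x A) (const 1) ^ Δ) ^ (p * a * b) * (T A (restrict x B) p q ^ (a * Δ)) ^ b
      pointwise x = begin
        κ * Φ ^ (a * b * Δ)                             ≡⟨ cong (_* Φ ^ (a * b * Δ)) (sym (^-*-assoc α p (a * b * Δ))) ⟩
        (α ^ p) ^ (a * b * Δ) * Φ ^ (a * b * Δ)         ≡⟨ sym (^-distribʳ-* (a * b * Δ) (α ^ p) Φ) ⟩
        (α ^ p * Φ) ^ (a * b * Δ)                       ≤⟨ ^-monoˡ-≤ (a * b * Δ) (T-restrict-both e-cotrans x A B p q) ⟩
        (β ^ p * H) ^ (a * b * Δ)                       ≡⟨ e₂ β H a b p Δ ⟩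
        (β ^ Δ) ^ (p * a * b) * (H ^ (a * Δ)) ^ b       ∎
        where
        Φ = T (restrict x A) (restrict x B) p q
        H = T A (restrict x B) p q
        β = ∑ (restrict x A) (const 1)
        e₂ : ∀ β H a b p Δ → (β ^ p * H) ^ (a * b * Δ) ≡ (β ^ Δ) ^ (p * a * b) * (H ^ (a * Δ)) ^ b
        e₂ β H a b p Δ = monomial-≡ (β ∷ H ∷ [])
          ((var (# 0) ↑ p ⊗ var (# 1)) ↑ (a * b * Δ))
          ((var (# 0) ↑ Δ) ↑ (p * a * b) ⊗ (var (# 1) ↑ (a * Δ)) ↑ b)
          (i a b p Δ ∷ j a b p Δ ∷ [])
          where
          i : ∀ a b p Δ → (1 * p + 0) * (a * b * Δ) ≡ 1 * Δ * (p * a * b) + 0 * (a * Δ) * b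
          i = solve-∀
          j : ∀ a b p Δ → (0 * p + 1) * (a * b * Δ) ≡ 0 * Δ * (p * a * b) + 1 * (a * Δ) * b
          j = solve-∀
      -- The two reductions to the degrees `a` and `b` produce `α` with the exponents
      -- `Δ * q * p * a` and `a * p * Δ`. As `b` is `suc q`, these add up to the exponent in `κ`.
      constants : T X A 1 Δ ^ (p * a * b) * (T A B a q ^ (p * Δ) * M_B ^ q) ^ b
        ≤ κ * (M_A ^ (p * a) * M_B ^ (q * b) * 𝒩 ^ (p * q * Δ))
      constants = begin
        T X A 1 Δ ^ (p * a * b) * (T A B a q ^ (p * Δ) * M_B ^ q) ^ b
          ≡⟨ e₃ (T X A 1 Δ) (T A B a q) M_B a b p q Δ ⟩
        (T X A 1 Δ ^ b) ^ (p * a) * ((T A B a q ^ b) ^ (p * Δ) * M_B ^ (q * b))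
          ≤⟨ *-mono-≤ (^-monoˡ-≤ (p * a) reduceA) (*-monoˡ-≤ _ (^-monoˡ-≤ (p * Δ) (T-reduceʳ A B a q))) ⟩
        ((α ^ Δ) ^ q * M_A) ^ (p * a) * ((α ^ a * 𝒩 ^ q) ^ (p * Δ) * M_B ^ (q * b))
          ≡⟨ e₄ α M_A 𝒩 (M_B ^ (q * b)) a p q Δ ⟩
        κ * (M_A ^ (p * a) * M_B ^ (q * b) * 𝒩 ^ (p * q * Δ)) ∎
        where
        reduceA : T X A 1 Δ ^ b ≤ (α ^ Δ) ^ q * M_A
        reduceA = subst₂ (λ y z → y ^ b ≤ (α ^ Δ) ^ q * z) (T-sym A X Δ 1) (T-sym A X Δ b) (T-reduceʳ-to-1 A X Δ q)
        e₃ : ∀ x y m a b p q Δ → x ^ (p * a * b) * (y ^ (p * Δ) * m ^ q) ^ b ≡ (x ^ b) ^ (p * a) * ((y ^ b) ^ (p * Δ) * m ^ (q * b))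
        e₃ x y m a b p q Δ = monomial-≡ (x ∷ y ∷ m ∷ [])
          (var (# 0) ↑ (p * a * b) ⊗ (var (# 1) ↑ (p * Δ) ⊗ var (# 2) ↑ q) ↑ b)
          ((var (# 0) ↑ b) ↑ (p * a) ⊗ ((var (# 1) ↑ b) ↑ (p * Δ) ⊗ var (# 2) ↑ (q * b)))
          (i a b p q Δ ∷ j a b p q Δ ∷ k a b p q Δ ∷ [])
          where
          i : ∀ a b p q Δ → 1 * (p * a * b) + (0 * (p * Δ) + 0 * q) * b ≡ 1 * b * (p * a) + (0 * b * (p * Δ) + 0 * (q * b))
          i = solve-∀
          j : ∀ a b p q Δ → 0 * (p * a * b) + (1 * (p * Δ) + 0 * q) * b ≡ 0 * b * (p * a) + (1 * b * (p * Δ) + 0 * (q * b))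
          j = solve-∀
          k : ∀ a b p q Δ → 0 * (p * a * b) + (0 * (p * Δ) + 1 * q) * b ≡ 0 * b * (p * a) + (0 * b * (p * Δ) + 1 * (q * b))
          k = solve-∀
        e₄ : ∀ α m n w a p q Δ → ((α ^ Δ) ^ q * m) ^ (p * a) * ((α ^ a * n ^ q) ^ (p * Δ) * w)
          ≡ α ^ (p * (a * suc q * Δ)) * (m ^ (p * a) * w * n ^ (p * q * Δ))
        e₄ α m n w a p q Δ = monomial-≡ (α ∷ m ∷ n ∷ w ∷ [])
          (((var (# 0) ↑ Δ) ↑ q ⊗ var (# 1)) ↑ (p * a) ⊗ ((var (# 0) ↑ a ⊗ var (# 2) ↑ q) ↑ (p * Δ) ⊗ var (# 3)))
          (var (# 0) ↑ (p * (a * suc q * Δ)) ⊗ (var (# 1) ↑ (p * a) ⊗ var (# 3) ⊗ var (# 2) ↑ (p * q * Δ)))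
          (i a p q Δ ∷ j a p q Δ ∷ k a p q Δ ∷ l a p q Δ ∷ [])
          where
          i : ∀ a p q Δ → (1 * Δ * q + 0) * (p * a) + ((1 * a + 0 * q) * (p * Δ) + 0)
            ≡ 1 * (p * (a * suc q * Δ)) + (0 * (p * a) + 0 + 0 * (p * q * Δ))
          i = solve-∀
          j : ∀ a p q Δ → (0 * Δ * q + 1) * (p * a) + ((0 * a + 0 * q) * (p * Δ) + 0)
            ≡ 0 * (p * (a * suc q * Δ)) + (1 * (p * a) + 0 + 0 * (p * q * Δ))
          j = solve-∀
          k : ∀ a p q Δ → (0 * Δ * q + 0) * (p * a) + ((0 * a + 1 * q) * (p * Δ) + 0)
            ≡ 0 * (p * (a * suc q * Δ)) + (0 * (p * a) + 0 + 1 * (p * q * Δ))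
          k = solve-∀
          l : ∀ a p q Δ → (0 * Δ * q + 0) * (p * a) + ((0 * a + 0 * q) * (p * Δ) + 1)
            ≡ 0 * (p * (a * suc q * Δ)) + (0 * (p * a) + 1 + 0 * (p * q * Δ))
          l = solve-∀

-- Edge bounds over a common denominator

module Steps {C : Set} (e : C → C → Bool) (e-sym : ∀ x y → e x y ≡ e y x)
  (e-cotrans : ∀ x y z → e x z ≡ true → e x y ≡ true ⊎ e z y ≡ true)
  (X : List C) (t : C → ℕ) (Δ : ℕ) (Δ≢0 : NonZero Δ)
  (S≢0 : NonZero (∑ X (λ x → t x ^ Δ)))
  (F : ℕ) (r : ℕ → ℕ) (rΔ : r Δ * Δ ≡ F) where

  open Biclique e e-sym
  open Entropy X (λ x → t x ^ Δ)
  open Local e e-sym X t Δ Δ≢0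

  F³ : ℕ
  F³ = F * F * F

  -- The shares of one endpoint of an edge: σ tells whether it is adjacent to w, and p is its degree after the
  -- removal of w.
  α : Bool → ℕ → ℕ
  α σ p = ind σ * (F³ * r Δ * r p)

  -- With `r d` read as F/d and d = `ind σ + p`, the exponents are F^5/(Δ p) in `α` and F^5/(Δ d p)
  -- here, so `p` such shares give F^5/(Δ d). The outer power makes the share 1 when the endpoint is
  -- not adjacent to `w`.
  μ : Bool → List C → ℕ → ℕ
  μ σ Q p = (T X Q (ind σ + p) Δ ^ (F * F * r Δ * r (ind σ + p) * r p)) ^ ind σ

  ^-^-≡ : ∀ x m n k l → m * n ≡ k * l → (x ^ m) ^ n ≡ (x ^ k) ^ l
  ^-^-≡ x m n k l eq = trans (^-*-assoc x m n) (trans (cong (x ^_) eq) (sym (^-*-assoc x k l)))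

  edge-bound₁ : ∀ A B p q → r p * p ≡ F → r q * q ≡ F → r (suc p) * suc p ≡ F → q ≤ Δ →
    Bound (λ x → (T A (restrict x B) p q ^ (r q * r p)) ^ F³) (α true p)
      ((T A B (suc p) q ^ (r q * r (suc p))) ^ F³ * μ true B p)
  edge-bound₁ A B p q rp rq ra q≤Δ =
    bound-cong (λ x → ^-^-≡ (T A (restrict x B) p q) (suc p * Δ) ρ (r q * r p) F³ (e₁ (r p) (r q) (r a) (r Δ) a Δ F ra rΔ))
      (e₂ (r p) (r q) (r a) (r Δ) q a F rq ra)
      constants
      (bound-^ ρ (bound-T-restrict A B p q q≤Δ))
    where
    a = suc p
    -- Chosen so that `a * Δ * ρ` is `r q * r p * F³`, as `r a * a` and `r Δ * Δ` are both `F`.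
    ρ = r p * r q * r a * r Δ * F
    e₁ : ∀ rp rq ra rΔ a Δ F → ra * a ≡ F → rΔ * Δ ≡ F → a * Δ * (rp * rq * ra * rΔ * F) ≡ rq * rp * (F * F * F)
    e₁ rp rq ra rΔ a Δ F a≡ Δ≡ = trans (i rp rq ra rΔ a Δ F) (cong₂ (λ x y → rq * rp * (x * y * F)) a≡ Δ≡)
      where
      i : ∀ rp rq ra rΔ a Δ F → a * Δ * (rp * rq * ra * rΔ * F) ≡ rq * rp * (ra * a * (rΔ * Δ) * F)
      i = solve-∀
    e₂ : ∀ rp rq ra rΔ q a F → rq * q ≡ F → ra * a ≡ F → q * a * (rp * rq * ra * rΔ * F) ≡ 1 * (F * F * F * rΔ * rp)
    e₂ rp rq ra rΔ q a F q≡ a≡ = trans (i rp rq ra rΔ q a F) (cong₂ (λ x y → 1 * (x * y * F * rΔ * rp)) q≡ a≡)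
      where
      i : ∀ rp rq ra rΔ q a F → q * a * (rp * rq * ra * rΔ * F) ≡ 1 * (rq * q * (ra * a) * F * rΔ * rp)
      i = solve-∀
    e₃ : ∀ rp rq ra rΔ p Δ F → rp * p ≡ F → rΔ * Δ ≡ F → p * Δ * (rp * rq * ra * rΔ * F) ≡ rq * ra * (F * F * F)
    e₃ rp rq ra rΔ p Δ F p≡ Δ≡ = trans (i rp rq ra rΔ p Δ F) (cong₂ (λ x y → rq * ra * (x * y * F)) p≡ Δ≡)
      where
      i : ∀ rp rq ra rΔ p Δ F → p * Δ * (rp * rq * ra * rΔ * F) ≡ rq * ra * (rp * p * (rΔ * Δ) * F)
      i = solve-∀
    e₄ : ∀ rp rq ra rΔ q F → rq * q ≡ F → q * (rp * rq * ra * rΔ * F) ≡ F * F * rΔ * ra * rp * 1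
    e₄ rp rq ra rΔ q F q≡ = trans (i rp rq ra rΔ q F) (cong (λ x → x * F * rΔ * ra * rp * 1) q≡)
      where
      i : ∀ rp rq ra rΔ q F → q * (rp * rq * ra * rΔ * F) ≡ rq * q * F * rΔ * ra * rp * 1
      i = solve-∀
    constants : (T A B a q ^ (p * Δ) * T X B a Δ ^ q) ^ ρ ≡ (T A B a q ^ (r q * r a)) ^ F³ * μ true B p
    constants = trans (^-distribʳ-* ρ (T A B a q ^ (p * Δ)) (T X B a Δ ^ q))
      (cong₂ _*_ (^-^-≡ (T A B a q) (p * Δ) ρ (r q * r a) F³ (e₃ (r p) (r q) (r a) (r Δ) p Δ F rp rΔ))
                 (^-^-≡ (T X B a Δ) q ρ (F * F * r Δ * r a * r p) 1 (e₄ (r p) (r q) (r a) (r Δ) q F rq)))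

  edge-bound₂ : ∀ A B p q .{{_ : NonZero p}} →
    r p * p ≡ F → r q * q ≡ F → r (suc p) * suc p ≡ F → r (suc q) * suc q ≡ F → q ≤ Δ →
    Bound (λ x → (T (restrict x A) (restrict x B) p q ^ (r q * r p)) ^ F³) (α true q + α true p)
      ((T A B (suc p) (suc q) ^ (r (suc q) * r (suc p))) ^ F³ * (μ true A q * μ true B p))
  edge-bound₂ A B p q rp rq ra rb q≤Δ =
    bound-cong (λ x → ^-^-≡ (T (restrict x A) (restrict x B) p q) (a * b * Δ) ρ (r q * r p) F³ (e₁ (r p) (r q) (r a) (r b) (r Δ) a b Δ F ra rb rΔ))
      (e₂ (r p) (r q) (r a) (r b) (r Δ) p q a b F rp rq ra rb)
      constants
      (bound-^ ρ (bound-T-restrict-both e-cotrans S≢0 A B p q q≤Δ))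
    where
    a = suc p
    b = suc q
    ρ = r p * r q * r a * r b * r Δ
    𝒩 = T A B a b
    M_A = T X A b Δ
    M_B = T X B a Δ
    cong₃ : ∀ {A : Set} (f : ℕ → ℕ → ℕ → A) {x x′ y y′ z z′} → x ≡ x′ → y ≡ y′ → z ≡ z′ → f x y z ≡ f x′ y′ z′
    cong₃ f refl refl refl = refl
    e₁ : ∀ rp rq ra rb rΔ a b Δ F → ra * a ≡ F → rb * b ≡ F → rΔ * Δ ≡ F →
      a * b * Δ * (rp * rq * ra * rb * rΔ) ≡ rq * rp * (F * F * F)
    e₁ rp rq ra rb rΔ a b Δ F a≡ b≡ Δ≡ = trans (i rp rq ra rb rΔ a b Δ) (cong₃ (λ x y z → rq * rp * (x * y * z)) a≡ b≡ Δ≡)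
      where
      i : ∀ rp rq ra rb rΔ a b Δ → a * b * Δ * (rp * rq * ra * rb * rΔ) ≡ rq * rp * (ra * a * (rb * b) * (rΔ * Δ))
      i = solve-∀
    e₂ : ∀ rp rq ra rb rΔ p q a b F → rp * p ≡ F → rq * q ≡ F → ra * a ≡ F → rb * b ≡ F →
      a * b * (p + q) * (rp * rq * ra * rb * rΔ) ≡ 1 * (F * F * F * rΔ * rq) + 1 * (F * F * F * rΔ * rp)
    e₂ rp rq ra rb rΔ p q a b F p≡ q≡ a≡ b≡ = trans (i rp rq ra rb rΔ p q a b) (cong₂ _+_
        (cong₃ (λ x y z → 1 * (x * y * z * rΔ * rq)) a≡ b≡ p≡)
        (cong₃ (λ x y z → 1 * (x * y * z * rΔ * rp)) a≡ b≡ q≡))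
      where
      i : ∀ rp rq ra rb rΔ p q a b → a * b * (p + q) * (rp * rq * ra * rb * rΔ)
        ≡ 1 * (ra * a * (rb * b) * (rp * p) * rΔ * rq) + 1 * (ra * a * (rb * b) * (rq * q) * rΔ * rp)
      i = solve-∀
    e₃ : ∀ rp rq ra rb rΔ p a F → rp * p ≡ F → ra * a ≡ F →
      p * a * (rp * rq * ra * rb * rΔ) ≡ F * F * rΔ * rb * rq * 1
    e₃ rp rq ra rb rΔ p a F p≡ a≡ = trans (i rp rq ra rb rΔ p a) (cong₂ (λ x y → x * y * rΔ * rb * rq * 1) p≡ a≡)
      where
      i : ∀ rp rq ra rb rΔ p a → p * a * (rp * rq * ra * rb * rΔ) ≡ rp * p * (ra * a) * rΔ * rb * rq * 1
      i = solve-∀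
    e₄ : ∀ rp rq ra rb rΔ q b F → rq * q ≡ F → rb * b ≡ F →
      q * b * (rp * rq * ra * rb * rΔ) ≡ F * F * rΔ * ra * rp * 1
    e₄ rp rq ra rb rΔ q b F q≡ b≡ = trans (i rp rq ra rb rΔ q b) (cong₂ (λ x y → x * y * rΔ * ra * rp * 1) q≡ b≡)
      where
      i : ∀ rp rq ra rb rΔ q b → q * b * (rp * rq * ra * rb * rΔ) ≡ rq * q * (rb * b) * rΔ * ra * rp * 1
      i = solve-∀
    e₅ : ∀ rp rq ra rb rΔ p q Δ F → rp * p ≡ F → rq * q ≡ F → rΔ * Δ ≡ F →
      p * q * Δ * (rp * rq * ra * rb * rΔ) ≡ rb * ra * (F * F * F)
    e₅ rp rq ra rb rΔ p q Δ F p≡ q≡ Δ≡ = trans (i rp rq ra rb rΔ p q Δ) (cong₃ (λ x y z → rb * ra * (x * y * z)) p≡ q≡ Δ≡)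
      where
      i : ∀ rp rq ra rb rΔ p q Δ → p * q * Δ * (rp * rq * ra * rb * rΔ) ≡ rb * ra * (rp * p * (rq * q) * (rΔ * Δ))
      i = solve-∀
    constants : (M_A ^ (p * a) * M_B ^ (q * b) * 𝒩 ^ (p * q * Δ)) ^ ρ
      ≡ (𝒩 ^ (r b * r a)) ^ F³ * (μ true A q * μ true B p)
    constants = begin
      (M_A ^ (p * a) * M_B ^ (q * b) * 𝒩 ^ (p * q * Δ)) ^ ρ                  ≡⟨ ^-distribʳ-* ρ (M_A ^ (p * a) * M_B ^ (q * b)) _ ⟩
      (M_A ^ (p * a) * M_B ^ (q * b)) ^ ρ * (𝒩 ^ (p * q * Δ)) ^ ρ            ≡⟨ *-comm _ ((𝒩 ^ (p * q * Δ)) ^ ρ) ⟩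
      (𝒩 ^ (p * q * Δ)) ^ ρ * (M_A ^ (p * a) * M_B ^ (q * b)) ^ ρ            ≡⟨ cong ((𝒩 ^ (p * q * Δ)) ^ ρ *_) (^-distribʳ-* ρ (M_A ^ (p * a)) _) ⟩
      (𝒩 ^ (p * q * Δ)) ^ ρ * ((M_A ^ (p * a)) ^ ρ * (M_B ^ (q * b)) ^ ρ)
        ≡⟨ cong₃ (λ x y z → x * (y * z))
             (^-^-≡ 𝒩 (p * q * Δ) ρ (r b * r a) F³ (e₅ (r p) (r q) (r a) (r b) (r Δ) p q Δ F rp rq rΔ))
             (^-^-≡ M_A (p * a) ρ (F * F * r Δ * r b * r q) 1 (e₃ (r p) (r q) (r a) (r b) (r Δ) p a F rp ra))
             (^-^-≡ M_B (q * b) ρ (F * F * r Δ * r a * r p) 1 (e₄ (r p) (r q) (r a) (r b) (r Δ) q b F rq rb)) ⟩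
      (𝒩 ^ (r b * r a)) ^ F³ * (μ true A q * μ true B p)                     ∎
      where open ≡-Reasoning

  edge-bound : ∀ σ τ A B p q .{{_ : NonZero p}} .{{_ : NonZero q}} →
    r p * p ≡ F → r q * q ≡ F →
    r (ind σ + p) * (ind σ + p) ≡ F → r (ind τ + q) * (ind τ + q) ≡ F → ind σ + p ≤ Δ → ind τ + q ≤ Δ →
    Bound (λ x → (T (shrink τ x A) (shrink σ x B) p q ^ (r q * r p)) ^ F³) (α τ q + α σ p)
      ((T A B (ind σ + p) (ind τ + q) ^ (r (ind τ + q) * r (ind σ + p))) ^ F³ * (μ τ A q * μ σ B p))
  edge-bound true  true  A B p q rp rq ra rb a≤Δ b≤Δ =
    bound-cong (λ x → refl) refl refl (edge-bound₂ A B p q rp rq ra rb (≤-trans (n≤1+n q) b≤Δ))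
  edge-bound true  false A B p q rp rq ra rb a≤Δ b≤Δ =
    bound-cong (λ x → refl) refl
      (cong (((T A B (suc p) q ^ (r q * r (suc p))) ^ F³) *_) (sym (*-identityˡ (μ true B p))))
      (edge-bound₁ A B p q rp rq ra b≤Δ)
  edge-bound false true  A B p q rp rq ra rb a≤Δ b≤Δ =
    bound-cong
      (λ x → cong (_^ F³) (cong₂ _^_ (T-sym B (restrict x A) q p) (*-comm (r p) (r q))))
      (sym (+-identityʳ (α true q)))
      (cong₂ _*_ (cong (_^ F³) (cong₂ _^_ (T-sym B A (suc q) p) (*-comm (r p) (r (suc q)))))
                 (sym (*-identityʳ (μ true A q))))
      (edge-bound₁ B A q p rq rp rb a≤Δ)
  edge-bound false false A B p q rp rq ra rb a≤Δ b≤Δ =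
    bound-cong (λ x → refl) refl (sym (*-identityʳ ((T A B p q ^ (r q * r p)) ^ F³)))
      (bound-const ((T A B p q ^ (r q * r p)) ^ F³))

-- Colourings of a graph, and conditioning on the colour of a vertex

∑-allFin-suc : ∀ n (f : Fin (suc n) → ℕ) → ∑ (allFin (suc n)) f ≡ f zero + ∑ (allFin n) (f ∘ suc)
∑-allFin-suc n f = cong (λ L → f zero + sum L) (trans (map-tabulate suc f) (sym (map-tabulate (λ i → i) (f ∘ suc))))

∏-allFin-suc : ∀ n (f : Fin (suc n) → ℕ) → ∏ (allFin (suc n)) f ≡ f zero * ∏ (allFin n) (f ∘ suc)
∏-allFin-suc n f = cong (λ L → f zero * product L) (trans (map-tabulate suc f) (sym (map-tabulate (λ i → i) (f ∘ suc))))

δ : ∀ {n} → Fin n → Fin n → ℕ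
δ u w = ind (does (u Fin.≟ w))

∑-δ : ∀ {n} (f : Fin n → ℕ) w → ∑ (allFin n) (λ u → f u * δ u w) ≡ f w
∑-δ {suc n} f zero = trans (∑-allFin-suc n _) (trans
  (cong₂ _+_ (*-identityʳ (f zero)) (trans (∑-cong (allFin n) (λ u → *-zeroʳ (f (suc u)))) (∑-zero (allFin n))))
  (+-identityʳ (f zero)))
∑-δ {suc n} f (suc w) = trans (∑-allFin-suc n _) (cong₂ _+_ (*-zeroʳ (f zero)) (∑-δ (f ∘ suc) w))

∏-δ : ∀ {n} (f : Fin n → ℕ) w → ∏ (allFin n) (λ u → f u ^ δ u w) ≡ f w
∏-δ {suc n} f zero = trans (∏-allFin-suc n (λ u → f u ^ δ u zero)) (trans
  (cong₂ _*_ (*-identityʳ (f zero)) (∏-one (allFin n)))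
  (*-identityʳ (f zero)))
∏-δ {suc n} f (suc w) = trans (∏-allFin-suc n (λ u → f u ^ δ u (suc w)))
  (trans (*-identityˡ (∏ (allFin n) (λ u → f (suc u) ^ δ u w))) (∏-δ (f ∘ suc) w))

ind≤1 : ∀ b → ind b ≤ 1
ind≤1 true  = ≤-refl
ind≤1 false = z≤n

term≤∑ : ∀ {n} (f : Fin n → ℕ) w → f w ≤ ∑ (allFin n) f
term≤∑ {n} f w = ≤-trans (≤-reflexive (sym (∑-δ f w)))
  (∑-mono (allFin n) (λ u → ≤-trans (*-monoʳ-≤ (f u) (ind≤1 _)) (≤-reflexive (*-identityʳ (f u)))))

maximum : ∀ {n} (f : Fin n → ℕ) → (∀ v → f v ≡ 0) ⊎ (∃ λ w → 1 ≤ f w × (∀ v → f v ≤ f w))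
maximum {zero}  f = inj₁ λ ()
maximum {suc n} f with maximum (f ∘ suc)
... | inj₁ all0 with f zero in f0
...   | zero  = inj₁ λ { zero → f0 ; (suc v) → all0 v }
...   | suc _ = inj₂ (zero , subst (1 ≤_) (sym f0) (s≤s z≤n) , λ { zero → ≤-refl ; (suc v) → subst (_≤ f zero) (sym (all0 v)) z≤n })
maximum {suc n} f | inj₂ (w , 1≤ , max) with ≤-total (f zero) (f (suc w))
... | inj₁ le = inj₂ (suc w , 1≤ , λ { zero → le ; (suc v) → max v })
... | inj₂ ge = inj₂ (zero , ≤-trans 1≤ ge , λ { zero → ≤-refl ; (suc v) → ≤-trans (max v) ge })

allᵇ-elim : ∀ {A : Set} (p : A → Bool) {L : List A} → allᵇ p L ≡ true → ∀ {x} → x ∈ L → p x ≡ true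
allᵇ-elim p {y ∷ L} eq x∈L with p y in py
allᵇ-elim p {y ∷ L} eq (here refl)  | true = py
allᵇ-elim p {y ∷ L} eq (there x∈L)  | true = allᵇ-elim p eq x∈L

allᵇ-intro : ∀ {A : Set} (p : A → Bool) (L : List A) → (∀ x → p x ≡ true) → allᵇ p L ≡ true
allᵇ-intro p []      all = refl
allᵇ-intro p (x ∷ L) all rewrite all x = allᵇ-intro p L all

ind-allᵇ : ∀ {A : Set} (p : A → Bool) (L : List A) → ind (allᵇ p L) ≡ ∏ L (ind ∘ p)
ind-allᵇ p []      = refl
ind-allᵇ p (x ∷ L) with p x
... | true  = trans (ind-allᵇ p L) (sym (*-identityˡ _))
... | false = refl

∈-allPairs : ∀ {n} (u v : Fin n) → (u , v) ∈ allPairs n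
∈-allPairs {n} u v = ∈-concatMap⁺ (λ u → map (u ,_) (allFin n)) (lose (∈-allFin u) (∈-map⁺ (u ,_) (∈-allFin v)))

∧-true : ∀ {a b} → a ∧ b ≡ true → a ≡ true × b ≡ true
∧-true {true} {true} _ = refl , refl

implies : ∀ {a b} → (a ≡ true → b ≡ true) → not a ∨ b ≡ true
implies {true}  f = f refl
implies {false} f = refl

implies⁻¹ : ∀ {a b} → not a ∨ b ≡ true → a ≡ true → b ≡ true
implies⁻¹ eq refl = eq

ind-mono : ∀ {a b} → (a ≡ true → b ≡ true) → ind a ≤ ind b
ind-mono {false} f = z≤n
ind-mono {true}  f = ≤-reflexive (cong ind (sym (f refl)))

filterᵇ-cong : ∀ {A : Set} {p q : A → Bool} → (∀ x → p x ≡ q x) → ∀ L → filterᵇ p L ≡ filterᵇ q L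
filterᵇ-cong eq []      = refl
filterᵇ-cong {p = p} {q} eq (x ∷ L) with p x | q x | eq x
... | true  | _ | refl = cong (x ∷_) (filterᵇ-cong eq L)
... | false | _ | refl = filterᵇ-cong eq L

filterᵇ-∧ : ∀ {A : Set} (p q : A → Bool) L → filterᵇ (λ x → p x ∧ q x) L ≡ filterᵇ q (filterᵇ p L)
filterᵇ-∧ p q [] = refl
filterᵇ-∧ p q (x ∷ L) with p x
... | false = filterᵇ-∧ p q L
... | true with q x
...   | true  = cong (x ∷_) (filterᵇ-∧ p q L)
...   | false = filterᵇ-∧ p q L

∑-allColourings-suc : ∀ {c} n (G : (Fin (suc n) → Fin c) → ℕ) →
  ∑ (allColourings (suc n)) G ≡ ∑ (allColourings n) (λ f → ∑ (allFin c) (λ x → G (x VF.∷ f)))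
∑-allColourings-suc {c} n G = trans (∑-concatMap (λ f → map (VF._∷ f) (allFin c)) (allColourings n) G)
  (∑-cong (allColourings n) (λ f → ∑-map (VF._∷ f) (allFin c) G))

∑-allColourings-∏ : ∀ {c} n (h : Fin n → Fin c → ℕ) →
  ∑ (allColourings n) (λ f → ∏ (allFin n) (λ v → h v (f v))) ≡ ∏ (allFin n) (λ v → ∑ (allFin c) (h v))
∑-allColourings-∏ zero h = refl
∑-allColourings-∏ {c} (suc n) h = begin
  ∑ (allColourings (suc n)) (λ f → ∏ (allFin (suc n)) (λ v → h v (f v)))
    ≡⟨ ∑-allColourings-suc n _ ⟩
  ∑ (allColourings n) (λ f → ∑ (allFin c) (λ x → ∏ (allFin (suc n)) (λ v → h v ((x VF.∷ f) v))))
    ≡⟨ ∑-cong (allColourings n) (λ f → trans (∑-cong (allFin c) (λ x → ∏-allFin-suc n (λ v → h v ((x VF.∷ f) v)))) (sym (*-distribʳ-∑ (rest f) (allFin c) (h zero)))) ⟩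
  ∑ (allColourings n) (λ f → ∑ (allFin c) (h zero) * ∏ (allFin n) (λ v → h (suc v) (f v)))
    ≡⟨ sym (*-distribˡ-∑ (∑ (allFin c) (h zero)) (allColourings n) rest) ⟩
  ∑ (allFin c) (h zero) * ∑ (allColourings n) (λ f → ∏ (allFin n) (λ v → h (suc v) (f v)))
    ≡⟨ cong (∑ (allFin c) (h zero) *_) (∑-allColourings-∏ n (h ∘ suc)) ⟩
  ∑ (allFin c) (h zero) * ∏ (allFin n) (λ v → ∑ (allFin c) (h (suc v)))
    ≡⟨ sym (∏-allFin-suc n (λ v → ∑ (allFin c) (h v))) ⟩
  ∏ (allFin (suc n)) (λ v → ∑ (allFin c) (h v)) ∎
  where
  open ≡-Reasoning
  rest : (Fin n → Fin c) → ℕ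
  rest f = ∏ (allFin n) (λ v → h (suc v) (f v))

module Colours {c : ℕ} (Ω∘ : Vec Bool c) where

  compatible : Fin c → Fin c → Bool
  compatible x y = not (does (x Fin.≟ y)) ∨ Vec.lookup Ω∘ x

  compatible-sym : ∀ x y → compatible x y ≡ compatible y x
  compatible-sym x y with x Fin.≟ y
  ... | yes refl rewrite dec-true (x Fin.≟ x) refl = refl
  ... | no  x≢y  rewrite dec-false (y Fin.≟ x) (x≢y ∘ sym) = refl

  -- Being incompatible means being the same non-looped colour, which is a transitive relation.
  compatible-cotrans : ∀ x y z → compatible x z ≡ true → compatible x y ≡ true ⊎ compatible z y ≡ true
  compatible-cotrans x y z xz with x Fin.≟ y
  ... | no _ = inj₁ refl
  ... | yes refl = inj₂ (trans (compatible-sym z x) xz)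

  open Biclique compatible compatible-sym public

  colours : (Fin c → Bool) → List (Fin c)
  colours p = filterᵇ p (allFin c)

  module _ {n : ℕ} where

    good : Adj n → (Fin n → Fin c → Bool) → (Fin n → Fin c) → Bool
    good adj P f = isSemiproper adj Ω∘ f ∧ allᵇ (λ v → P v (f v)) (allFin n)

    count : Adj n → (Fin n → Fin c → Bool) → ℕ
    count adj P = ∑ (allColourings n) (ind ∘ good adj P)

    good-elim : ∀ adj P f → good adj P f ≡ true →
      (∀ u v → adj u v ≡ true → compatible (f u) (f v) ≡ true) × (∀ v → P v (f v) ≡ true)
    good-elim adj P f eq with semi , resp ← ∧-true {isSemiproper adj Ω∘ f} eq =
      (λ u v → implies⁻¹ (allᵇ-elim _ semi (∈-allPairs u v))) , λ v → allᵇ-elim (λ v → P v (f v)) resp (∈-allFin v)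

    isSemiproper-intro : ∀ adj f → (∀ u v → adj u v ≡ true → compatible (f u) (f v) ≡ true) →
      isSemiproper adj Ω∘ f ≡ true
    isSemiproper-intro adj f semi = allᵇ-intro _ (allPairs n) λ { (u , v) → implies (semi u v) }

    good-intro : ∀ adj P f → (∀ u v → adj u v ≡ true → compatible (f u) (f v) ≡ true) →
      (∀ v → P v (f v) ≡ true) → good adj P f ≡ true
    good-intro adj P f semi resp = cong₂ _∧_ (isSemiproper-intro adj f semi) (allᵇ-intro _ (allFin n) resp)

    -- The edge conditions are dropped, which loses nothing in the edgeless base case.
    count≤∏ : ∀ adj P → count adj P ≤ ∏ (allFin n) (λ v → ∑ (colours (P v)) (const 1))
    count≤∏ adj P = begin
      count adj P                                                                ≤⟨ ∑-mono (allColourings n) (λ f → ind-mono (proj₂ ∘ ∧-true {isSemiproper adj Ω∘ f})) ⟩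
      ∑ (allColourings n) (λ f → ind (allᵇ (λ v → P v (f v)) (allFin n)))        ≡⟨ ∑-cong (allColourings n) (λ f → ind-allᵇ _ (allFin n)) ⟩
      ∑ (allColourings n) (λ f → ∏ (allFin n) (λ v → ind (P v (f v))))           ≡⟨ ∑-allColourings-∏ n (λ v x → ind (P v x)) ⟩
      ∏ (allFin n) (λ v → ∑ (allFin c) (ind ∘ P v))                              ≡⟨ ∏-cong (allFin n) (λ v → sym (trans (∑-filterᵇ (P v) (allFin c) _) (∑-cong (allFin c) (λ x → *-identityʳ _)))) ⟩
      ∏ (allFin n) (λ v → ∑ (colours (P v)) (const 1))                           ∎
      where open ≤-Reasoning

    isolate : Fin n → Adj n → Adj n
    isolate w adj u v = adj u v ∧ (not (does (u Fin.≟ w)) ∧ not (does (v Fin.≟ w)))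

    -- The vertex `w` is kept with a singleton list: the vertex set stays `Fin n`, and the isolated
    -- `w` contributes the factor 1.
    fix : Fin n → Adj n → (Fin n → Fin c → Bool) → Fin c → (Fin n → Fin c → Bool)
    fix w adj P x v y = if does (v Fin.≟ w) then does (y Fin.≟ x) else P v y ∧ (not (adj w v) ∨ compatible x y)

    -- A colouring `f` is found on the right at `x = f w`, where the lists of `fix` hold for it
    -- because of the edges that `isolate` deletes.
    count≤∑ : ∀ w adj P → count adj P ≤ ∑ (colours (P w)) (λ x → count (isolate w adj) (fix w adj P x))
    count≤∑ w adj P = begin
      count adj P                                                                              ≤⟨ ∑-mono (allColourings n) pointwise ⟩
      ∑ (allColourings n) (λ f → ∑ (allFin c) (λ x → ind (P w x) * ind (good′ x f)))           ≡⟨ ∑-cong (allColourings n) (λ f → sym (∑-filterᵇ (P w) (allFin c) _)) ⟩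
      ∑ (allColourings n) (λ f → ∑ (colours (P w)) (λ x → ind (good′ x f)))                    ≡⟨ ∑-swap (allColourings n) (colours (P w)) _ ⟩
      ∑ (colours (P w)) (λ x → count (isolate w adj) (fix w adj P x))                          ∎
      where
      open ≤-Reasoning
      good′ : Fin c → (Fin n → Fin c) → Bool
      good′ x = good (isolate w adj) (fix w adj P x)
      good⇒good′ : ∀ f → good adj P f ≡ true → good′ (f w) f ≡ true
      good⇒good′ f g with semi , resp ← good-elim adj P f g =
        good-intro (isolate w adj) (fix w adj P (f w)) f (λ u v uv → semi u v (proj₁ (∧-true uv))) resp′
        where
        resp′ : ∀ v → fix w adj P (f w) v (f v) ≡ true
        resp′ v with v Fin.≟ w
        ... | yes refl = dec-true (f v Fin.≟ f v) refl
        ... | no  _ rewrite resp v = implies (semi w v)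
      pointwise : ∀ f → ind (good adj P f) ≤ ∑ (allFin c) (λ x → ind (P w x) * ind (good′ x f))
      pointwise f with good adj P f in g
      ... | false = z≤n
      ... | true = ≤-trans (≤-reflexive (sym (cong₂ (λ a b → ind a * ind b)
        (proj₂ (good-elim adj P f g) w) (good⇒good′ f g)))) (term≤∑ (λ x → ind (P w x) * ind (good′ x f)) (f w))

^-exchange : ∀ x m n → (x ^ m) ^ n ≡ (x ^ n) ^ m
^-exchange x m n = trans (^-*-assoc x m n) (trans (cong (x ^_) (*-comm m n)) (sym (^-*-assoc x n m)))

-- A vertex is the first member of as many ordered pairs as it is the second, hence the factor 2.
-- This collects at each vertex the shares of its edges.
∑-incident : ∀ {n} (a : Fin n → Fin n → ℕ) → (∀ u v → a u v ≡ a v u) → ∀ (f : Fin n → ℕ) →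
  ∑ (allFin n) (λ u → ∑ (allFin n) (λ v → a u v * (f u + f v)))
    ≡ ∑ (allFin n) (λ v → 2 * (∑ (allFin n) (a v) * f v))
∑-incident {n} a a-sym f = begin
  ∑ V (λ u → ∑ V (λ v → a u v * (f u + f v)))
    ≡⟨ ∑-cong V (λ u → trans (∑-cong V (λ v → *-distribˡ-+ (a u v) (f u) (f v))) (∑-+ V (λ v → a u v * f u) (λ v → a u v * f v))) ⟩
  ∑ V (λ u → ∑ V (λ v → a u v * f u) + ∑ V (λ v → a u v * f v))
    ≡⟨ ∑-+ V (λ u → ∑ V (λ v → a u v * f u)) (λ u → ∑ V (λ v → a u v * f v)) ⟩
  ∑ V (λ u → ∑ V (λ v → a u v * f u)) + ∑ V (λ u → ∑ V (λ v → a u v * f v))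
    ≡⟨ cong (∑ V (λ u → ∑ V (λ v → a u v * f u)) +_)
         (trans (∑-swap V V (λ u v → a u v * f v)) (∑-cong V (λ v → ∑-cong V (λ u → cong (_* f v) (a-sym u v))))) ⟩
  ∑ V (λ u → ∑ V (λ v → a u v * f u)) + ∑ V (λ v → ∑ V (λ u → a v u * f v))
    ≡⟨ cong₂ _+_ collect collect ⟩
  ∑ V (λ v → ∑ V (a v) * f v) + ∑ V (λ v → ∑ V (a v) * f v)
    ≡⟨ sym (∑-+ V (λ v → ∑ V (a v) * f v) (λ v → ∑ V (a v) * f v)) ⟩
  ∑ V (λ v → ∑ V (a v) * f v + ∑ V (a v) * f v)
    ≡⟨ ∑-cong V (λ v → cong (∑ V (a v) * f v +_) (sym (+-identityʳ (∑ V (a v) * f v)))) ⟩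
  ∑ V (λ v → 2 * (∑ V (a v) * f v)) ∎
  where
  open ≡-Reasoning
  V = allFin n
  collect : ∑ V (λ u → ∑ V (λ v → a u v * f u)) ≡ ∑ V (λ v → ∑ V (a v) * f v)
  collect = ∑-cong V (λ u → sym (*-distribʳ-∑ (f u) V (a u)))

∏-incident : ∀ {n} (a : Fin n → Fin n → ℕ) → (∀ u v → a u v ≡ a v u) → ∀ (f : Fin n → ℕ) →
  ∏ (allFin n) (λ u → ∏ (allFin n) (λ v → (f u * f v) ^ a u v))
    ≡ ∏ (allFin n) (λ v → f v ^ (2 * ∑ (allFin n) (a v)))
∏-incident {n} a a-sym f = begin
  ∏ V (λ u → ∏ V (λ v → (f u * f v) ^ a u v))
    ≡⟨ ∏-cong V (λ u → trans (∏-cong V (λ v → ^-distribʳ-* (a u v) (f u) (f v))) (∏-* V (λ v → f u ^ a u v) (λ v → f v ^ a u v))) ⟩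
  ∏ V (λ u → ∏ V (λ v → f u ^ a u v) * ∏ V (λ v → f v ^ a u v))
    ≡⟨ ∏-* V (λ u → ∏ V (λ v → f u ^ a u v)) (λ u → ∏ V (λ v → f v ^ a u v)) ⟩
  ∏ V (λ u → ∏ V (λ v → f u ^ a u v)) * ∏ V (λ u → ∏ V (λ v → f v ^ a u v))
    ≡⟨ cong (∏ V (λ u → ∏ V (λ v → f u ^ a u v)) *_)
         (trans (∏-swap V V (λ u v → f v ^ a u v)) (∏-cong V (λ v → ∏-cong V (λ u → cong (f v ^_) (a-sym u v))))) ⟩
  ∏ V (λ u → ∏ V (λ v → f u ^ a u v)) * ∏ V (λ v → ∏ V (λ u → f v ^ a v u))
    ≡⟨ cong₂ _*_ collect collect ⟩
  ∏ V (λ v → f v ^ ∑ V (a v)) * ∏ V (λ v → f v ^ ∑ V (a v))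
    ≡⟨ sym (∏-* V (λ v → f v ^ ∑ V (a v)) (λ v → f v ^ ∑ V (a v))) ⟩
  ∏ V (λ v → f v ^ ∑ V (a v) * f v ^ ∑ V (a v))
    ≡⟨ ∏-cong V (λ v → trans (sym (^-distribˡ-+-* (f v) (∑ V (a v)) (∑ V (a v))))
         (cong (λ k → f v ^ (∑ V (a v) + k)) (sym (+-identityʳ (∑ V (a v)))))) ⟩
  ∏ V (λ v → f v ^ (2 * ∑ V (a v))) ∎
  where
  open ≡-Reasoning
  V = allFin n
  collect : ∏ V (λ u → ∏ V (λ v → f u ^ a u v)) ≡ ∏ V (λ v → f v ^ ∑ V (a v))
  collect = ∏-cong V (λ u → ∏-^-∑ V (f u) (a u))

isZero : ℕ → ℕ
isZero zero    = 1
isZero (suc _) = 0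

deg : ∀ {n} → Adj n → Fin n → ℕ
deg {n} adj v = ∑ (allFin n) (λ u → ind (adj v u))

deg≤n : ∀ {n} (adj : Adj n) v → deg adj v ≤ n
deg≤n {n} adj v = ≤-trans (∑-mono (allFin n) (λ u → ind≤1 (adj v u)))
  (≤-reflexive (trans (∑-one (allFin n)) (length-tabulate {n = n} (λ i → i))))

-- Deleting the edges at a vertex

module Isolate {n : ℕ} (adj : Adj n) (adj-sym : ∀ u v → adj u v ≡ adj v u) (adj-irrefl : ∀ v → adj v v ≡ false)
  {c : ℕ} (Ω∘ : Vec Bool c) (w : Fin n) where

  open Colours Ω∘

  adj′ : Adj n
  adj′ = isolate w adj

  adj′-sym : ∀ u v → adj′ u v ≡ adj′ v u
  adj′-sym u v = cong₂ _∧_ (adj-sym u v) (∧-comm (not (does (u Fin.≟ w))) _)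

  adj′-irrefl : ∀ v → adj′ v v ≡ false
  adj′-irrefl v rewrite adj-irrefl v = refl

  -- An edge survives unless it meets `w`. The pair of `w` with itself falls under both correction
  -- terms, which vanish there by irreflexivity.
  ind-split : ∀ u v → ind (adj u v) ≡ ind (adj′ u v) + (δ u w * ind (adj w v) + δ v w * ind (adj w u))
  ind-split u v with u Fin.≟ w | v Fin.≟ w
  ... | yes refl | yes refl rewrite adj-irrefl u = refl
  ... | yes refl | no _     rewrite ∧-zeroʳ (adj u v) = sym (trans (+-identityʳ _) (+-identityʳ _))
  ... | no _     | yes refl rewrite ∧-zeroʳ (adj u v) | adj-sym u v = sym (+-identityʳ _)
  ... | no _     | no _     rewrite ∧-identityʳ (adj u v) = sym (+-identityʳ _)

  deg′-w : deg adj′ w ≡ 0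
  deg′-w = trans (∑-cong (allFin n) (λ u → cong ind (lemma u))) (∑-zero (allFin n))
    where
    lemma : ∀ u → adj′ w u ≡ false
    lemma u rewrite dec-true (w Fin.≟ w) refl = ∧-zeroʳ (adj w u)

  deg-split : ∀ v → v ≢ w → deg adj v ≡ ind (adj w v) + deg adj′ v
  deg-split v v≢w = begin
    deg adj v                                                         ≡⟨ ∑-cong (allFin n) pointwise ⟩
    ∑ (allFin n) (λ u → ind (adj w v) * δ u w + ind (adj′ v u))       ≡⟨ ∑-+ (allFin n) (λ u → ind (adj w v) * δ u w) (λ u → ind (adj′ v u)) ⟩
    ∑ (allFin n) (λ u → ind (adj w v) * δ u w) + deg adj′ v           ≡⟨ cong (_+ deg adj′ v) (∑-δ (const (ind (adj w v))) w) ⟩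
    ind (adj w v) + deg adj′ v                                        ∎
    where
    open ≡-Reasoning
    pointwise : ∀ u → ind (adj v u) ≡ ind (adj w v) * δ u w + ind (adj′ v u)
    pointwise u = trans (ind-split v u) (trans
      (cong (λ z → ind (adj′ v u) + (ind z * ind (adj w u) + δ u w * ind (adj w v))) (dec-false (v Fin.≟ w) v≢w))
      (trans (+-comm (ind (adj′ v u)) _) (cong (_+ ind (adj′ v u)) (*-comm (δ u w) _))))

  deg-split-≤ : ∀ v → deg adj′ v + deg adj w * δ v w ≤ deg adj v
  deg-split-≤ v = by-cases (v Fin.≟ w)
    where
    open ≤-Reasoning
    by-cases : Dec (v ≡ w) → deg adj′ v + deg adj w * δ v w ≤ deg adj v
    by-cases (yes refl) = begin
      deg adj′ v + deg adj v * δ v v   ≡⟨ cong₂ (λ x y → x + deg adj v * ind y) deg′-w (dec-true (v Fin.≟ v) refl) ⟩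
      deg adj v * 1                    ≡⟨ *-identityʳ (deg adj v) ⟩
      deg adj v                        ∎
    by-cases (no v≢w) = begin
      deg adj′ v + deg adj w * δ v w   ≡⟨ cong (λ y → deg adj′ v + deg adj w * ind y) (dec-false (v Fin.≟ w) v≢w) ⟩
      deg adj′ v + deg adj w * 0       ≡⟨ cong (deg adj′ v +_) (*-zeroʳ (deg adj w)) ⟩
      deg adj′ v + 0                   ≡⟨ +-identityʳ (deg adj′ v) ⟩
      deg adj′ v                       ≤⟨ m≤n+m (deg adj′ v) (ind (adj w v)) ⟩
      ind (adj w v) + deg adj′ v       ≡⟨ sym (deg-split v v≢w) ⟩
      deg adj v                        ∎

  ∑-deg-decreases : ∑ (allFin n) (deg adj′) + deg adj w ≤ ∑ (allFin n) (deg adj)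
  ∑-deg-decreases = begin
    ∑ (allFin n) (deg adj′) + deg adj w                                     ≡⟨ cong (∑ (allFin n) (deg adj′) +_) (sym (∑-δ (const (deg adj w)) w)) ⟩
    ∑ (allFin n) (deg adj′) + ∑ (allFin n) (λ v → deg adj w * δ v w)        ≡⟨ sym (∑-+ (allFin n) (deg adj′) (λ v → deg adj w * δ v w)) ⟩
    ∑ (allFin n) (λ v → deg adj′ v + deg adj w * δ v w)                     ≤⟨ ∑-mono (allFin n) deg-split-≤ ⟩
    ∑ (allFin n) (deg adj)                                                  ∎
    where open ≤-Reasoning

  ∏-split : ∀ (g : Fin n → Fin n → ℕ) →
    ∏ (allFin n) (λ u → ∏ (allFin n) (λ v → g u v ^ ind (adj u v)))
      ≡ ∏ (allFin n) (λ u → ∏ (allFin n) (λ v → g u v ^ ind (adj′ u v)))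
        * ∏ (allFin n) (λ v → (g w v * g v w) ^ ind (adj w v))
  ∏-split g = begin
    ∏ V (λ u → ∏ V (λ v → g u v ^ ind (adj u v)))
      ≡⟨ ∏-cong V (λ u → trans (∏-cong V (λ v → pointwise u v)) (trans (∏-* V (λ v → g u v ^ ind (adj′ u v)) (λ v → h u v * k u v))
           (cong (∏ V (λ v → g u v ^ ind (adj′ u v)) *_) (∏-* V (h u) (k u))))) ⟩
    ∏ V (λ u → ∏ V (λ v → g u v ^ ind (adj′ u v)) * (∏ V (h u) * ∏ V (k u)))
      ≡⟨ trans (∏-* V (λ u → ∏ V (λ v → g u v ^ ind (adj′ u v))) (λ u → ∏ V (h u) * ∏ V (k u)))
           (cong (∏ V (λ u → ∏ V (λ v → g u v ^ ind (adj′ u v))) *_) (∏-* V (λ u → ∏ V (h u)) (λ u → ∏ V (k u)))) ⟩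
    rest * (∏ V (λ u → ∏ V (h u)) * ∏ V (λ u → ∏ V (k u)))
      ≡⟨ cong (rest *_) (cong₂ _*_
           (trans (∏-swap V V h) (∏-cong V (λ v → ∏-δ (λ u → g u v ^ ind (adj w v)) w)))
           (∏-cong V (λ u → ∏-δ (λ v → g u v ^ ind (adj w u)) w))) ⟩
    rest * (∏ V (λ v → g w v ^ ind (adj w v)) * ∏ V (λ v → g v w ^ ind (adj w v)))
      ≡⟨ cong (rest *_) (trans (sym (∏-* V (λ v → g w v ^ ind (adj w v)) (λ v → g v w ^ ind (adj w v))))
           (∏-cong V (λ v → sym (^-distribʳ-* (ind (adj w v)) (g w v) (g v w))))) ⟩
    rest * ∏ V (λ v → (g w v * g v w) ^ ind (adj w v)) ∎
    where
    open ≡-Reasoning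
    V = allFin n
    rest = ∏ V (λ u → ∏ V (λ v → g u v ^ ind (adj′ u v)))
    h k : Fin n → Fin n → ℕ
    h u v = (g u v ^ ind (adj w v)) ^ δ u w
    k u v = (g u v ^ ind (adj w u)) ^ δ v w
    pointwise : ∀ u v → g u v ^ ind (adj u v) ≡ g u v ^ ind (adj′ u v) * (h u v * k u v)
    pointwise u v = begin
      g u v ^ ind (adj u v)
        ≡⟨ cong (g u v ^_) (ind-split u v) ⟩
      g u v ^ (ind (adj′ u v) + (δ u w * ind (adj w v) + δ v w * ind (adj w u)))
        ≡⟨ ^-distribˡ-+-* (g u v) (ind (adj′ u v)) _ ⟩
      g u v ^ ind (adj′ u v) * g u v ^ (δ u w * ind (adj w v) + δ v w * ind (adj w u))
        ≡⟨ cong (g u v ^ ind (adj′ u v) *_) (trans (^-distribˡ-+-* (g u v) (δ u w * ind (adj w v)) _)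
             (cong₂ _*_ (split (δ u w) (ind (adj w v))) (split (δ v w) (ind (adj w u))))) ⟩
      g u v ^ ind (adj′ u v) * (h u v * k u v) ∎
      where
      split : ∀ i j → g u v ^ (i * j) ≡ (g u v ^ j) ^ i
      split i j = trans (sym (^-*-assoc (g u v) i j)) (^-exchange (g u v) i j)

  colours-fix-w : ∀ P x → ∑ (colours (fix w adj P x w)) (const 1) ≡ 1
  colours-fix-w P x = trans (∑-filterᵇ (fix w adj P x w) (allFin c) (const 1))
    (trans (∑-cong (allFin c) (λ y → pointwise y)) (∑-δ (const 1) x))
    where
    pointwise : ∀ y → ind (fix w adj P x w y) * 1 ≡ 1 * δ y x
    pointwise y rewrite dec-true (w Fin.≟ w) refl = *-comm (δ y x) 1

  colours-fix : ∀ P x v → v ≢ w → colours (fix w adj P x v) ≡ shrink (adj w v) x (colours (P v))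
  colours-fix P x v v≢w rewrite dec-false (v Fin.≟ w) v≢w with adj w v
  ... | true  = filterᵇ-∧ (P v) (compatible x) (allFin c)
  ... | false = filterᵇ-cong (λ y → ∧-identityʳ (P v y)) (allFin c)

-- Induction on the number of edges

-- With F = n !, the exponent 1 / d is represented by r d over the denominator F.
module Induction {n c : ℕ} (Ω∘ : Vec Bool c) (F : ℕ) (r : ℕ → ℕ) (F≢0 : NonZero F)
  (r-spec : ∀ d → 1 ≤ d → d ≤ n → r d * d ≡ F) where

  open Colours Ω∘

  V : List (Fin n)
  V = allFin n

  edgeFactor : Adj n → (Fin n → Fin c → Bool) → Fin n → Fin n → ℕ
  edgeFactor adj P u v =
    T (colours (P u)) (colours (P v)) (deg adj v) (deg adj u) ^ (r (deg adj u) * r (deg adj v))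

  -- The outer exponent is 1 at isolated vertices only: no edge factor accounts for their choice of
  -- colour.
  vertexFactor : Adj n → (Fin n → Fin c → Bool) → Fin n → ℕ
  vertexFactor adj P v = (∑ (colours (P v)) (const 1) ^ (2 * (F * F))) ^ isZero (deg adj v)

  -- Ordered pairs count every edge twice; this bounds the power 2 * F ^ 2 of the number of colourings.
  upper : Adj n → (Fin n → Fin c → Bool) → ℕ
  upper adj P = ∏ V (λ u → ∏ V (λ v → edgeFactor adj P u v ^ ind (adj u v))) * ∏ V (vertexFactor adj P)

  upper-^ : ∀ adj P k → upper adj P ^ k ≡
    ∏ V (λ u → ∏ V (λ v → (edgeFactor adj P u v ^ k) ^ ind (adj u v))) * ∏ V (λ v → vertexFactor adj P v ^ k)
  upper-^ adj P k = trans (^-distribʳ-* k edges-part (∏ V (vertexFactor adj P))) (cong₂ _*_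
    (trans (sym (∏-^ V (λ u → ∏ V (λ v → edgeFactor adj P u v ^ ind (adj u v))) k))
      (∏-cong V (λ u → trans (sym (∏-^ V (λ v → edgeFactor adj P u v ^ ind (adj u v)) k))
        (∏-cong V (λ v → ^-exchange (edgeFactor adj P u v) (ind (adj u v)) k)))))
    (sym (∏-^ V (vertexFactor adj P) k)))
    where edges-part = ∏ V (λ u → ∏ V (λ v → edgeFactor adj P u v ^ ind (adj u v)))

  module Step (adj : Adj n) (adj-sym : ∀ u v → adj u v ≡ adj v u) (adj-irrefl : ∀ v → adj v v ≡ false)
    (P : Fin n → Fin c → Bool) (w : Fin n) (1≤Δ : 1 ≤ deg adj w) (Δ-max : ∀ v → deg adj v ≤ deg adj w) where

    open Isolate adj adj-sym adj-irrefl Ω∘ w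

    d d′ : Fin n → ℕ
    d  = deg adj
    d′ = deg adj′

    Δ : ℕ
    Δ = d w

    Δ≢0 : NonZero Δ
    Δ≢0 = >-nonZero 1≤Δ

    L : Fin n → List (Fin c)
    L v = colours (P v)

    X : List (Fin c)
    X = L w

    P′ : Fin c → Fin n → Fin c → Bool
    P′ = fix w adj P

    σ : Fin n → Bool
    σ = adj w

    rΔ : r Δ * Δ ≡ F
    rΔ = r-spec Δ 1≤Δ (deg≤n adj w)

    -- This is 2 F^5/Δ, the entropy due from one neighbour of `w`; the 2 comes from ordered pairs.
    τ : ℕ
    τ = 2 * (F * (F * F * F) * r Δ)

    module _ (t : Fin c → ℕ) (S≢0 : NonZero (∑ X (λ x → t x ^ Δ))) where

      open Entropy X (λ x → t x ^ Δ)
      open Local compatible compatible-sym X t Δ Δ≢0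
      open Steps compatible compatible-sym compatible-cotrans X t Δ Δ≢0 S≢0 F r rΔ

      αᵥ μᵥ : Fin n → ℕ
      αᵥ v = α (σ v) (d′ v)
      μᵥ v = μ (σ v) (L v) (d′ v)

      adj′-elim : ∀ u v → adj′ u v ≡ true → u ≢ w × v ≢ w
      adj′-elim u v uv with u Fin.≟ w | v Fin.≟ w
      ... | yes _  | _      = contradiction (trans (sym uv) (∧-zeroʳ (adj u v))) λ ()
      ... | no _   | yes _  = contradiction (trans (sym uv) (∧-zeroʳ (adj u v))) λ ()
      ... | no u≢w | no v≢w = u≢w , v≢w

      1≤d′ : ∀ u v → adj′ u v ≡ true → 1 ≤ d′ u
      1≤d′ u v uv = ≤-trans (≤-reflexive (cong ind (sym uv))) (term≤∑ (λ v → ind (adj′ u v)) v)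

      r-d′ : ∀ v → 1 ≤ d′ v → r (d′ v) * d′ v ≡ F
      r-d′ v 1≤ = r-spec (d′ v) 1≤ (deg≤n adj′ v)

      adjacent-bound : ∀ u v → adj′ u v ≡ true →
        Bound (λ x → edgeFactor adj′ (P′ x) u v ^ F³) (αᵥ u + αᵥ v) (edgeFactor adj P u v ^ F³ * (μᵥ u * μᵥ v))
      adjacent-bound u v uv = bound-cong primed refl unprimed
        (edge-bound (σ v) (σ u) (L u) (L v) (d′ v) (d′ u) {{>-nonZero 1≤v}} {{>-nonZero 1≤u}}
          (r-d′ v 1≤v) (r-d′ u 1≤u) (r-sum v v≢w 1≤v) (r-sum u u≢w 1≤u) (sum≤Δ v v≢w) (sum≤Δ u u≢w))
        where
        u≢w = proj₁ (adj′-elim u v uv)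
        v≢w = proj₂ (adj′-elim u v uv)
        1≤u = 1≤d′ u v uv
        1≤v = 1≤d′ v u (trans (adj′-sym v u) uv)
        r-sum : ∀ v → v ≢ w → 1 ≤ d′ v → r (ind (σ v) + d′ v) * (ind (σ v) + d′ v) ≡ F
        r-sum v v≢w 1≤ = subst (λ k → r k * k ≡ F) (deg-split v v≢w)
          (r-spec (d v) (≤-trans 1≤ (≤-trans (m≤n+m (d′ v) (ind (σ v))) (≤-reflexive (sym (deg-split v v≢w))))) (deg≤n adj v))
        sum≤Δ : ∀ v → v ≢ w → ind (σ v) + d′ v ≤ Δ
        sum≤Δ v v≢w = ≤-trans (≤-reflexive (sym (deg-split v v≢w))) (Δ-max v)
        primed : ∀ x → (T (shrink (σ u) x (L u)) (shrink (σ v) x (L v)) (d′ v) (d′ u) ^ (r (d′ u) * r (d′ v))) ^ F³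
          ≡ edgeFactor adj′ (P′ x) u v ^ F³
        primed x = cong₂ (λ A B → (T A B (d′ v) (d′ u) ^ (r (d′ u) * r (d′ v))) ^ F³)
          (sym (colours-fix P x u u≢w)) (sym (colours-fix P x v v≢w))
        unprimed : (T (L u) (L v) (ind (σ v) + d′ v) (ind (σ u) + d′ u) ^ (r (ind (σ u) + d′ u) * r (ind (σ v) + d′ v))) ^ F³ * (μᵥ u * μᵥ v)
          ≡ edgeFactor adj P u v ^ F³ * (μᵥ u * μᵥ v)
        unprimed = cong₂ (λ a b → (T (L u) (L v) a b ^ (r b * r a)) ^ F³ * (μᵥ u * μᵥ v))
          (sym (deg-split v v≢w)) (sym (deg-split u u≢w))

      pair-bound : ∀ u v → Bound (λ x → (edgeFactor adj′ (P′ x) u v ^ F³) ^ ind (adj′ u v))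
        (ind (adj′ u v) * (αᵥ u + αᵥ v)) ((edgeFactor adj P u v ^ F³ * (μᵥ u * μᵥ v)) ^ ind (adj′ u v))
      pair-bound u v = by-cases (adj′ u v) refl
        where
        by-cases : ∀ b → adj′ u v ≡ b → Bound (λ x → (edgeFactor adj′ (P′ x) u v ^ F³) ^ ind b)
          (ind b * (αᵥ u + αᵥ v)) ((edgeFactor adj P u v ^ F³ * (μᵥ u * μᵥ v)) ^ ind b)
        by-cases false _  = bound-const 1
        by-cases true  uv = bound-cong (λ x → sym (^-identityʳ (edgeFactor adj′ (P′ x) u v ^ F³)))
          (sym (*-identityˡ (αᵥ u + αᵥ v))) (sym (^-identityʳ (edgeFactor adj P u v ^ F³ * (μᵥ u * μᵥ v))))
          (adjacent-bound u v uv)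

      -- The part of the final bound due at `v`: both ordered factors of its edge to `w`, if there
      -- is one, and its own factor.
      K : Fin n → ℕ
      K v = (T X (L v) (d v) Δ ^ (F³ * r Δ * r (d v))) ^ (2 * ind (σ v)) * vertexFactor adj P v ^ F³

      -- The vertex factor settles the balance: `s` and `J` complete the shares carried by the
      -- `d′ v` remaining edges to the entropy and the factor due at `v`.
      VertexBound : Fin n → Set
      VertexBound v = ∃₂ λ s J → Bound (λ x → vertexFactor adj′ (P′ x) v ^ F³) s J
        × s + 2 * (d′ v * αᵥ v) ≡ ind (σ v) * τ
        × J * μᵥ v ^ (2 * d′ v) ≡ K v

      non-neighbour : ∀ v → σ v ≡ false →
        (∀ x → vertexFactor adj′ (P′ x) v ^ F³ ≡ vertexFactor adj P v ^ F³) → VertexBound v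
      non-neighbour v σv constant = 0 , J , bound-cong (λ x → sym (constant x)) refl refl (bound-const J) ,
        trans (cong (λ b → 2 * (d′ v * α b (d′ v))) σv)
          (trans (cong (2 *_) (*-zeroʳ (d′ v))) (cong (λ b → ind b * τ) (sym σv))) ,
        trans (cong (λ b → J * μ b (L v) (d′ v) ^ (2 * d′ v)) σv)
          (trans (cong (J *_) (^-zeroˡ (2 * d′ v))) (trans (*-comm J 1)
            (cong (λ b → (T X (L v) (d v) Δ ^ (F³ * r Δ * r (d v))) ^ (2 * ind b) * J) (sym σv))))
        where J = vertexFactor adj P v ^ F³

      -- Both factors of `w` are 1: before the removal its degree is positive, and afterwards its
      -- list is a singleton.
      vertex-bound-w : VertexBound w
      vertex-bound-w = non-neighbour w (adj-irrefl w) λ x → trans (cong (_^ F³) (factor′ x)) (sym (cong (_^ F³) (factor (d w) 1≤Δ)))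
        where
        factor′ : ∀ x → vertexFactor adj′ (P′ x) w ≡ 1
        factor′ x = trans (cong (λ s → (s ^ (2 * (F * F))) ^ isZero (d′ w)) (colours-fix-w P x))
          (trans (cong (_^ isZero (d′ w)) (^-zeroˡ (2 * (F * F)))) (^-zeroˡ (isZero (d′ w))))
        factor : ∀ k → 1 ≤ k → (∑ (L w) (const 1) ^ (2 * (F * F))) ^ isZero k ≡ 1
        factor (suc k) _ = refl

      vertex-bound-far : ∀ v → v ≢ w → σ v ≡ false → VertexBound v
      vertex-bound-far v v≢w σv = non-neighbour v σv λ x →
        cong₂ (λ Q k → ((∑ Q (const 1) ^ (2 * (F * F))) ^ isZero k) ^ F³)
          (trans (colours-fix P x v v≢w) (cong (λ s → shrink s x (L v)) σv))
          (sym (trans (deg-split v v≢w) (cong (λ s → ind s + d′ v) σv)))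

      vertex-bound-near : ∀ v → v ≢ w → σ v ≡ true → VertexBound v
      vertex-bound-near v v≢w σv = by-cases (d′ v) refl
        where
        d≡ : d v ≡ suc (d′ v)
        d≡ = trans (deg-split v v≢w) (cong (λ s → ind s + d′ v) σv)
        Q = L v
        K≡ : ∀ k → d′ v ≡ k → K v ≡ (T X Q (suc k) Δ ^ (F³ * r Δ * r (suc k))) ^ 2
        K≡ k dk = trans (cong₂ (λ a b → (T X Q a Δ ^ (F³ * r Δ * r a)) ^ (2 * ind b) * ((∑ Q (const 1) ^ (2 * (F * F))) ^ isZero a) ^ F³)
            (trans d≡ (cong suc dk)) σv)
          (trans (cong ((T X Q (suc k) Δ ^ (F³ * r Δ * r (suc k))) ^ 2 *_) (^-zeroˡ F³)) (*-identityʳ _))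
        by-cases : ∀ k → d′ v ≡ k → VertexBound v
        -- Here `w` was the only neighbour of `v`. No edge is left to carry shares, so the new
        -- vertex factor carries all of `τ` by `bound-restrict`.
        by-cases zero dk = τ , T X Q 1 Δ ^ τ ,
          bound-cong (λ x → sym (primed x)) (*-identityˡ τ) refl (bound-^ τ (bound-restrict Q)) ,
          trans (cong₂ (λ a b → τ + 2 * (a * b)) dk (refl {x = αᵥ v})) (trans (+-identityʳ τ) (trans (sym (*-identityˡ τ)) (cong (λ b → ind b * τ) (sym σv)))) ,
          trans (cong (λ a → T X Q 1 Δ ^ τ * μᵥ v ^ (2 * a)) dk) (trans (*-identityʳ (T X Q 1 Δ ^ τ)) (trans total (sym (K≡ zero dk))))
          where
          r1 : r 1 ≡ F
          r1 = trans (sym (*-identityʳ (r 1))) (r-spec 1 ≤-refl (≤-trans (≤-trans (s≤s z≤n) (≤-reflexive (sym d≡))) (deg≤n adj v)))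
          e₁ : ∀ F rΔ Δ → Δ * (2 * (F * (F * F * F) * rΔ)) ≡ 2 * (F * (rΔ * Δ)) * (F * F * F)
          e₁ = solve-∀
          e₂ : ∀ F rΔ → 2 * (F * (F * F * F) * rΔ) ≡ F * F * F * rΔ * F * 2
          e₂ = solve-∀
          primed : ∀ x → vertexFactor adj′ (P′ x) v ^ F³ ≡ (∑ (restrict x Q) (const 1) ^ Δ) ^ τ
          primed x = trans
            (cong₂ (λ M k → ((∑ M (const 1) ^ (2 * (F * F))) ^ isZero k) ^ F³)
              (trans (colours-fix P x v v≢w) (cong (λ s → shrink s x Q) σv)) dk)
            (trans (cong (_^ F³) (^-identityʳ (∑ (restrict x Q) (const 1) ^ (2 * (F * F)))))
              (trans (^-*-assoc (∑ (restrict x Q) (const 1)) (2 * (F * F)) F³)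
                (trans (cong (∑ (restrict x Q) (const 1) ^_) (sym (trans (e₁ F (r Δ) Δ) (cong (λ z → 2 * (F * z) * (F * F * F)) rΔ))))
                  (sym (^-*-assoc (∑ (restrict x Q) (const 1)) Δ τ)))))
          total : T X Q 1 Δ ^ τ ≡ (T X Q 1 Δ ^ (F³ * r Δ * r 1)) ^ 2
          total = trans (cong (T X Q 1 Δ ^_) (trans (e₂ F (r Δ)) (cong (λ z → F * F * F * r Δ * z * 2) (sym r1))))
            (sym (^-*-assoc (T X Q 1 Δ) (F³ * r Δ * r 1) 2))
        -- The vertex factor is 1, and the `suc k` remaining edges carry exactly the total since
        -- `r (suc k) * suc k` is `F`.
        by-cases (suc k) dk = 0 , 1 ,
          bound-cong (λ x → sym (trans (cong (λ a → ((∑ (colours (P′ x v)) (const 1) ^ (2 * (F * F))) ^ isZero a) ^ F³) dk) (^-zeroˡ F³)))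
            refl refl (bound-const 1) ,
          trans (cong₂ (λ a b → 2 * (a * (ind b * (F³ * r Δ * r a)))) dk σv)
            (trans (e₁ (r (suc k)) (suc k) (r Δ) F³) (trans (cong (λ z → 1 * (2 * (z * F³ * r Δ))) rk) (cong (λ b → ind b * τ) (sym σv)))) ,
          trans (*-identityˡ (μᵥ v ^ (2 * d′ v))) (trans (cong₂ (λ a b → μ b Q a ^ (2 * a)) dk σv)
            (trans total (sym (K≡ (suc k) dk))))
          where
          rk : r (suc k) * suc k ≡ F
          rk = subst (λ a → r a * a ≡ F) dk (r-d′ v (≤-trans (s≤s z≤n) (≤-reflexive (sym dk))))
          M = T X Q (suc (suc k)) Δ
          e₁ : ∀ rk k rΔ G → 2 * (k * (1 * (G * rΔ * rk))) ≡ 1 * (2 * (rk * k * G * rΔ))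
          e₁ = solve-∀
          e₂ : ∀ rk k rΔ F ra → F * F * rΔ * ra * rk * 1 * (2 * k) ≡ F * F * (rk * k) * rΔ * ra * 2
          e₂ = solve-∀
          total : μ true Q (suc k) ^ (2 * suc k) ≡ (M ^ (F³ * r Δ * r (suc (suc k)))) ^ 2
          total = trans (cong (_^ (2 * suc k)) (^-*-assoc M (F * F * r Δ * r (suc (suc k)) * r (suc k)) 1))
            (trans (^-*-assoc M (F * F * r Δ * r (suc (suc k)) * r (suc k) * 1) (2 * suc k))
              (trans (cong (M ^_) (trans (e₂ (r (suc k)) (suc k) (r Δ) F (r (suc (suc k)))) (cong (λ z → F * F * z * r Δ * r (suc (suc k)) * 2) rk)))
                (sym (^-*-assoc M (F³ * r Δ * r (suc (suc k))) 2))))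

      vertex-bound : ∀ v → VertexBound v
      vertex-bound v = by-cases (v Fin.≟ w) (σ v) refl
        where
        by-cases : Dec (v ≡ w) → ∀ b → σ v ≡ b → VertexBound v
        by-cases (yes v≡w) _     _  = subst VertexBound (sym v≡w) vertex-bound-w
        by-cases (no v≢w)  true  σv = vertex-bound-near v v≢w σv
        by-cases (no v≢w)  false σv = vertex-bound-far v v≢w σv

      -- All pair bounds and vertex bounds are multiplied. The `Δ` neighbours contribute entropy `τ`
      -- each, in total the power to which `step` raises the sum over colours, as `bound-weights`
      -- requires.
      upper-bound : Bound (λ x → upper adj′ (P′ x) ^ F³) (2 * (F * F) * F³) (upper adj P ^ F³)
      upper-bound = bound-cong (λ x → sym (upper-^ adj′ (P′ x) F³)) exponent constants
        (bound-* (bound-∏ V (λ u → bound-∏ V (pair-bound u)))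
                 (bound-∏ V (λ v → proj₁ (proj₂ (proj₂ (vertex-bound v))))))
        where
        open ≡-Reasoning
        s J : Fin n → ℕ
        s v = proj₁ (vertex-bound v)
        J v = proj₁ (proj₂ (vertex-bound v))
        exponent : ∑ V (λ u → ∑ V (λ v → ind (adj′ u v) * (αᵥ u + αᵥ v))) + ∑ V s ≡ 2 * (F * F) * F³
        exponent = begin
          ∑ V (λ u → ∑ V (λ v → ind (adj′ u v) * (αᵥ u + αᵥ v))) + ∑ V s
            ≡⟨ cong (_+ ∑ V s) (∑-incident (λ u v → ind (adj′ u v)) (λ u v → cong ind (adj′-sym u v)) αᵥ) ⟩
          ∑ V (λ v → 2 * (d′ v * αᵥ v)) + ∑ V s
            ≡⟨ trans (+-comm _ (∑ V s)) (sym (∑-+ V s (λ v → 2 * (d′ v * αᵥ v)))) ⟩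
          ∑ V (λ v → s v + 2 * (d′ v * αᵥ v))
            ≡⟨ ∑-cong V (λ v → proj₁ (proj₂ (proj₂ (proj₂ (vertex-bound v))))) ⟩
          ∑ V (λ v → ind (σ v) * τ)
            ≡⟨ sym (*-distribʳ-∑ τ V (λ v → ind (σ v))) ⟩
          Δ * τ
            ≡⟨ e₁ Δ (r Δ) F ⟩
          2 * (F * (r Δ * Δ)) * F³
            ≡⟨ cong (λ z → 2 * (F * z) * F³) rΔ ⟩
          2 * (F * F) * F³ ∎
          where
          e₁ : ∀ Δ rΔ F → Δ * (2 * (F * (F * F * F) * rΔ)) ≡ 2 * (F * (rΔ * Δ)) * (F * F * F)
          e₁ = solve-∀
        g : Fin n → Fin n → ℕ
        g u v = edgeFactor adj P u v ^ F³
        rest : ℕ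
        rest = ∏ V (λ u → ∏ V (λ v → g u v ^ ind (adj′ u v)))
        M : Fin n → ℕ
        M v = T X (L v) (d v) Δ ^ (F³ * r Δ * r (d v))
        g-w : ∀ v → g w v * g v w ≡ M v * M v
        g-w v = cong₂ _*_
          (trans (^-*-assoc (T X (L v) (d v) Δ) (r Δ * r (d v)) F³) (cong (T X (L v) (d v) Δ ^_) (e₁ (r Δ) (r (d v)) F³)))
          (trans (cong (λ z → (z ^ (r (d v) * r Δ)) ^ F³) (T-sym (L v) X Δ (d v)))
            (trans (^-*-assoc (T X (L v) (d v) Δ) (r (d v) * r Δ) F³) (cong (T X (L v) (d v) Δ ^_) (e₂ (r Δ) (r (d v)) F³))))
          where
          e₁ : ∀ x y z → x * y * z ≡ z * x * y
          e₁ = solve-∀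
          e₂ : ∀ x y z → y * x * z ≡ z * x * y
          e₂ = solve-∀
        square : ∀ x k → (x * x) ^ k ≡ x ^ (2 * k)
        square x k = trans (^-distribʳ-* k x x) (trans (sym (^-distribˡ-+-* x k k)) (cong (λ j → x ^ (k + j)) (sym (+-identityʳ k))))
        pairs : ∏ V (λ u → ∏ V (λ v → (g u v * (μᵥ u * μᵥ v)) ^ ind (adj′ u v))) ≡ rest * ∏ V (λ v → μᵥ v ^ (2 * d′ v))
        pairs = begin
          ∏ V (λ u → ∏ V (λ v → (g u v * (μᵥ u * μᵥ v)) ^ ind (adj′ u v)))
            ≡⟨ ∏-cong V (λ u → trans (∏-cong V (λ v → ^-distribʳ-* (ind (adj′ u v)) (g u v) (μᵥ u * μᵥ v)))
                 (∏-* V (λ v → g u v ^ ind (adj′ u v)) (λ v → (μᵥ u * μᵥ v) ^ ind (adj′ u v)))) ⟩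
          ∏ V (λ u → ∏ V (λ v → g u v ^ ind (adj′ u v)) * ∏ V (λ v → (μᵥ u * μᵥ v) ^ ind (adj′ u v)))
            ≡⟨ ∏-* V (λ u → ∏ V (λ v → g u v ^ ind (adj′ u v))) (λ u → ∏ V (λ v → (μᵥ u * μᵥ v) ^ ind (adj′ u v))) ⟩
          rest * ∏ V (λ u → ∏ V (λ v → (μᵥ u * μᵥ v) ^ ind (adj′ u v)))
            ≡⟨ cong (rest *_) (∏-incident (λ u v → ind (adj′ u v)) (λ u v → cong ind (adj′-sym u v)) μᵥ) ⟩
          rest * ∏ V (λ v → μᵥ v ^ (2 * d′ v)) ∎
        constants : ∏ V (λ u → ∏ V (λ v → (g u v * (μᵥ u * μᵥ v)) ^ ind (adj′ u v))) * ∏ V J ≡ upper adj P ^ F³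
        constants = begin
          ∏ V (λ u → ∏ V (λ v → (g u v * (μᵥ u * μᵥ v)) ^ ind (adj′ u v))) * ∏ V J
            ≡⟨ cong (_* ∏ V J) pairs ⟩
          rest * ∏ V (λ v → μᵥ v ^ (2 * d′ v)) * ∏ V J
            ≡⟨ trans (*-assoc rest _ (∏ V J)) (cong (rest *_) (trans (*-comm _ (∏ V J)) (sym (∏-* V J (λ v → μᵥ v ^ (2 * d′ v)))))) ⟩
          rest * ∏ V (λ v → J v * μᵥ v ^ (2 * d′ v))
            ≡⟨ cong (rest *_) (∏-cong V (λ v → proj₂ (proj₂ (proj₂ (proj₂ (vertex-bound v)))))) ⟩
          rest * ∏ V K
            ≡⟨ cong (rest *_) (∏-* V (λ v → M v ^ (2 * ind (σ v))) (λ v → vertexFactor adj P v ^ F³)) ⟩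
          rest * (∏ V (λ v → M v ^ (2 * ind (σ v))) * ∏ V (λ v → vertexFactor adj P v ^ F³))
            ≡⟨ sym (*-assoc rest _ _) ⟩
          rest * ∏ V (λ v → M v ^ (2 * ind (σ v))) * ∏ V (λ v → vertexFactor adj P v ^ F³)
            ≡⟨ cong (λ z → rest * z * ∏ V (λ v → vertexFactor adj P v ^ F³))
                 (∏-cong V (λ v → sym (trans (cong (_^ ind (σ v)) (g-w v)) (square (M v) (ind (σ v)))))) ⟩
          rest * ∏ V (λ v → (g w v * g v w) ^ ind (σ v)) * ∏ V (λ v → vertexFactor adj P v ^ F³)
            ≡⟨ cong (_* ∏ V (λ v → vertexFactor adj P v ^ F³)) (sym (∏-split g)) ⟩
          ∏ V (λ u → ∏ V (λ v → g u v ^ ind (adj u v))) * ∏ V (λ v → vertexFactor adj P v ^ F³)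
            ≡⟨ sym (upper-^ adj P F³) ⟩
          upper adj P ^ F³ ∎

    step : (∀ x → count adj′ (P′ x) ^ (2 * (F * F)) ≤ upper adj′ (P′ x)) →
      count adj P ^ (2 * (F * F)) ≤ upper adj P
    step ih = ^-cancelˡ-≤ (F * F * F) {{F³≢0}} (begin
      (count adj P ^ (2 * (F * F))) ^ (F * F * F)                  ≡⟨ ^-*-assoc (count adj P) (2 * (F * F)) (F * F * F) ⟩
      count adj P ^ D                                              ≤⟨ ^-monoˡ-≤ D (count≤∑ w adj P) ⟩
      ∑ X (λ x → count adj′ (P′ x)) ^ D                            ≤⟨ ∑-by-entropy X (λ x → count adj′ (P′ x)) Δ D (upper adj P ^ (F * F * F))
                                                                        (λ x → upper adj′ (P′ x) ^ (F * F * F)) {{Δ≢0}} {{D≢0}} raised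
                                                                        (λ t {{S≢0}} → upper-bound t S≢0) ⟩
      upper adj P ^ (F * F * F)                                    ∎)
      where
      open ≤-Reasoning
      D = 2 * (F * F) * (F * F * F)
      F²≢0 : NonZero (F * F)
      F²≢0 = m*n≢0 F F {{F≢0}} {{F≢0}}
      F³≢0 : NonZero (F * F * F)
      F³≢0 = m*n≢0 (F * F) F {{F²≢0}} {{F≢0}}
      D≢0 : NonZero D
      D≢0 = m*n≢0 (2 * (F * F)) (F * F * F) {{m*n≢0 2 (F * F) {{_}} {{F²≢0}}}} {{F³≢0}}
      raised : ∀ x → count adj′ (P′ x) ^ D ≤ upper adj′ (P′ x) ^ (F * F * F)
      raised x = ≤-trans (≤-reflexive (sym (^-*-assoc (count adj′ (P′ x)) (2 * (F * F)) (F * F * F)))) (^-monoˡ-≤ (F * F * F) (ih x))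

  edgeless : ∀ adj P → (∀ v → deg adj v ≡ 0) → count adj P ^ (2 * (F * F)) ≤ upper adj P
  edgeless adj P d≡0 = begin
    count adj P ^ (2 * (F * F))                                        ≤⟨ ^-monoˡ-≤ (2 * (F * F)) (count≤∏ adj P) ⟩
    ∏ V (λ v → ∑ (colours (P v)) (const 1)) ^ (2 * (F * F))            ≡⟨ sym (∏-^ V (λ v → ∑ (colours (P v)) (const 1)) (2 * (F * F))) ⟩
    ∏ V (λ v → ∑ (colours (P v)) (const 1) ^ (2 * (F * F)))            ≡⟨ ∏-cong V (λ v → sym (trans (cong (λ k → (∑ (colours (P v)) (const 1) ^ (2 * (F * F))) ^ isZero k) (d≡0 v)) (^-identityʳ _))) ⟩
    ∏ V (vertexFactor adj P)                                           ≡⟨ sym (*-identityˡ _) ⟩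
    1 * ∏ V (vertexFactor adj P)                                       ≡⟨ cong (_* ∏ V (vertexFactor adj P)) (sym edges-one) ⟩
    upper adj P                                                        ∎
    where
    open ≤-Reasoning
    no-edge : ∀ u v → ind (adj u v) ≡ 0
    no-edge u v = n≤0⇒n≡0 (≤-trans (term≤∑ (λ v → ind (adj u v)) v) (≤-reflexive (d≡0 u)))
    edges-one : ∏ V (λ u → ∏ V (λ v → edgeFactor adj P u v ^ ind (adj u v))) ≡ 1
    edges-one = trans (∏-cong V (λ u → trans (∏-cong V (λ v → cong (edgeFactor adj P u v ^_) (no-edge u v))) (∏-one V))) (∏-one V)

  -- The measure is the sum of the degrees, which drops by at least the positive degree of `w`. The
  -- lists `P` stay general because they change with the colour of `w`.
  count≤upper : ∀ k adj → ∑ V (deg adj) ≤ k → (∀ u v → adj u v ≡ adj v u) → (∀ v → adj v v ≡ false) →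
    ∀ P → count adj P ^ (2 * (F * F)) ≤ upper adj P
  count≤upper k adj ∑d≤k adj-sym adj-irrefl P with maximum (deg adj)
  ... | inj₁ d≡0 = edgeless adj P d≡0
  ... | inj₂ (w , 1≤Δ , Δ-max) = descend k ∑d≤k
    where
    open Isolate adj adj-sym adj-irrefl Ω∘ w
    descend : ∀ k → ∑ V (deg adj) ≤ k → count adj P ^ (2 * (F * F)) ≤ upper adj P
    descend zero    le = contradiction (≤-trans 1≤Δ (≤-trans (m≤n+m (deg adj w) _) (≤-trans ∑-deg-decreases le))) λ ()
    descend (suc k) le = Step.step adj adj-sym adj-irrefl P w 1≤Δ Δ-max
      (λ x → count≤upper k adj′ (+-cancelʳ-≤ 1 _ _ (≤-trans (+-monoʳ-≤ _ 1≤Δ) (≤-trans ∑-deg-decreases (≤-trans le (≤-reflexive (+-comm 1 k))))))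
        adj′-sym adj′-irrefl (fix w adj P x))

-- Comparison with N and with the list of edges

length-filterᵇ : ∀ {A : Set} (p : A → Bool) L → length (filterᵇ p L) ≡ ∑ L (ind ∘ p)
length-filterᵇ p L = trans (sym (∑-one (filterᵇ p L)))
  (trans (∑-filterᵇ p L (const 1)) (∑-cong L (λ x → *-identityʳ (ind (p x)))))

∏-filterᵇ : ∀ {A : Set} (p : A → Bool) (L : List A) (f : A → ℕ) → ∏ (filterᵇ p L) f ≡ ∏ L (λ x → f x ^ ind (p x))
∏-filterᵇ p []      f = refl
∏-filterᵇ p (x ∷ L) f with p x
... | true  = cong₂ _*_ (sym (^-identityʳ (f x))) (∏-filterᵇ p L f)
... | false = trans (∏-filterᵇ p L f) (sym (*-identityˡ _))

∏-allPairs : ∀ {n} (f : Fin n × Fin n → ℕ) → ∏ (allPairs n) f ≡ ∏ (allFin n) (λ u → ∏ (allFin n) (λ v → f (u , v)))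
∏-allPairs {n} f = go (allFin n)
  where
  ∏-map : ∀ u L → product (map f (map (u ,_) L)) ≡ ∏ L (λ v → f (u , v))
  ∏-map u []      = refl
  ∏-map u (v ∷ L) = cong (f (u , v) *_) (∏-map u L)
  go : ∀ L → ∏ (concatMap (λ u → map (u ,_) (allFin n)) L) f ≡ ∏ L (λ u → ∏ (allFin n) (λ v → f (u , v)))
  go []      = refl
  go (u ∷ L) = trans (cong product (map-++ f (map (u ,_) (allFin n)) _))
    (trans (product-++ (map f (map (u ,_) (allFin n))) _) (cong₂ _*_ (∏-map u (allFin n)) (go L)))

inFirst-↑ˡ : ∀ {a} b (k : Fin a) → inFirst a {b} (k ↑ˡ b) ≡ true
inFirst-↑ˡ b zero    = refl
inFirst-↑ˡ b (suc k) = inFirst-↑ˡ b k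

inFirst-↑ʳ : ∀ a {b} (k : Fin b) → inFirst a {b} (a ↑ʳ k) ≡ false
inFirst-↑ʳ zero    k = refl
inFirst-↑ʳ (suc a) k = inFirst-↑ʳ a k

front : ∀ {c} a b → (Fin (a + b) → Fin c) → List (Fin c)
front a b f = tabulate (λ i → f (i ↑ˡ b))

back : ∀ {c} a b → (Fin (a + b) → Fin c) → List (Fin c)
back a b f = tabulate (λ j → f (a ↑ʳ j))

∑-allColourings-back : ∀ {c} b (G : List (Fin c) → ℕ) →
  ∑ (allColourings b) (G ∘ back 0 b) ≡ ∑ (tuples b (allFin c)) G
∑-allColourings-back zero    G = refl
∑-allColourings-back {c} (suc b) G = begin
  ∑ (allColourings (suc b)) (G ∘ back 0 (suc b))                                            ≡⟨ ∑-allColourings-suc b (G ∘ back 0 (suc b)) ⟩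
  ∑ (allColourings b) (λ f → ∑ (allFin c) (λ x → G (x ∷ back 0 b f)))                       ≡⟨ ∑-allColourings-back b (λ zs → ∑ (allFin c) (λ x → G (x ∷ zs))) ⟩
  ∑ (tuples b (allFin c)) (λ zs → ∑ (allFin c) (λ x → G (x ∷ zs)))                          ≡⟨ sym (∑-tuples-suc b (allFin c) G) ⟩
  ∑ (tuples (suc b) (allFin c)) G                                                           ∎
  where open ≡-Reasoning

∑-allColourings-+ : ∀ {c} a b (G : List (Fin c) → List (Fin c) → ℕ) →
  ∑ (allColourings (a + b)) (λ f → G (front a b f) (back a b f))
    ≡ ∑ (tuples a (allFin c)) (λ ys → ∑ (tuples b (allFin c)) (G ys))
∑-allColourings-+ zero b G = trans (∑-allColourings-back b (G [])) (sym (+-identityʳ _))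
∑-allColourings-+ {c} (suc a) b G = begin
  ∑ (allColourings (suc a + b)) (λ f → G (front (suc a) b f) (back (suc a) b f))
    ≡⟨ ∑-allColourings-suc (a + b) (λ f → G (front (suc a) b f) (back (suc a) b f)) ⟩
  ∑ (allColourings (a + b)) (λ f → ∑ (allFin c) (λ x → G (x ∷ front a b f) (back a b f)))
    ≡⟨ ∑-allColourings-+ a b (λ ys zs → ∑ (allFin c) (λ x → G (x ∷ ys) zs)) ⟩
  ∑ (tuples a (allFin c)) (λ ys → ∑ (tuples b (allFin c)) (λ zs → ∑ (allFin c) (λ x → G (x ∷ ys) zs)))
    ≡⟨ ∑-cong (tuples a (allFin c)) (λ ys → ∑-swap (tuples b (allFin c)) (allFin c) (λ zs x → G (x ∷ ys) zs)) ⟩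
  ∑ (tuples a (allFin c)) (λ ys → ∑ (allFin c) (λ x → ∑ (tuples b (allFin c)) (G (x ∷ ys))))
    ≡⟨ sym (∑-tuples-suc a (allFin c) (λ ys → ∑ (tuples b (allFin c)) (G ys))) ⟩
  ∑ (tuples (suc a) (allFin c)) (λ ys → ∑ (tuples b (allFin c)) (G ys)) ∎
  where open ≡-Reasoning

module _ {c : ℕ} (Ω∘ : Subset c) where

  open Colours Ω∘

  countColourings≡count : ∀ n (adj : Adj n) Ωs → countColourings n adj Ω∘ Ωs ≡ count adj (λ v → lookup (Ωs v))
  countColourings≡count n adj Ωs = length-filterᵇ _ (allColourings n)

  -- `R` stands for the list condition inside `N`. One direction suffices, since `N` occurs only in
  -- the upper bound.
  T≤∑-good : ∀ A B a b (R : (Fin (a + b) → Fin c) → Fin (a + b) → Bool) →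
    (∀ f i → R f i ≡ lookup (if inFirst a {b} i then A else B) (f i)) →
    T (colours (lookup A)) (colours (lookup B)) a b
      ≤ length (filterᵇ (λ f → isSemiproper (Kbip a b) Ω∘ f ∧ allᵇ (R f) (allFin (a + b))) (allColourings (a + b)))
  T≤∑-good A B a b R R≡ = begin
    T P Q a b
      ≡⟨ ∑-cong (tuples a P) (λ ys → trans (∑-^ b Q (λ z → ∏ ys (E z))) (∑-tuples-filterᵇ b q Ω (λ zs → ∏ zs (λ z → ∏ ys (E z))))) ⟩
    ∑ (tuples a P) (λ ys → ∑ (tuples b Ω) (λ zs → ∏ zs (ind ∘ q) * ∏ zs (λ z → ∏ ys (E z))))
      ≡⟨ trans (∑-tuples-filterᵇ a p Ω _) (∑-cong (tuples a Ω) (λ ys → *-distribˡ-∑ (∏ ys (ind ∘ p)) (tuples b Ω) _)) ⟩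
    ∑ (tuples a Ω) (λ ys → ∑ (tuples b Ω) (G ys))
      ≡⟨ sym (∑-allColourings-+ a b G) ⟩
    ∑ (allColourings (a + b)) (λ f → G (front a b f) (back a b f))
      ≤⟨ ∑-mono (allColourings (a + b)) (λ f → ≤-trans (≤-reflexive (G≡ (front a b f) (back a b f))) (ind-mono (is-good f))) ⟩
    ∑ (allColourings (a + b)) (ind ∘ fine)
      ≡⟨ sym (length-filterᵇ fine (allColourings (a + b))) ⟩
    length (filterᵇ fine (allColourings (a + b))) ∎
    where
    open ≤-Reasoning
    fine : (Fin (a + b) → Fin c) → Bool
    fine f = isSemiproper (Kbip a b) Ω∘ f ∧ allᵇ (R f) (allFin (a + b))
    p = lookup A
    q = lookup B
    P = colours p
    Q = colours q
    Ω = allFin c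
    G : List (Fin c) → List (Fin c) → ℕ
    G ys zs = ∏ ys (ind ∘ p) * (∏ zs (ind ∘ q) * ∏ zs (λ z → ∏ ys (E z)))
    Gᵇ : List (Fin c) → List (Fin c) → Bool
    Gᵇ ys zs = allᵇ p ys ∧ (allᵇ q zs ∧ allᵇ (λ z → allᵇ (compatible z) ys) zs)
    ind-∧ : ∀ x y → ind x * ind y ≡ ind (x ∧ y)
    ind-∧ true  y = *-identityˡ (ind y)
    ind-∧ false y = refl
    G≡ : ∀ ys zs → G ys zs ≡ ind (Gᵇ ys zs)
    G≡ ys zs = trans
      (cong₂ _*_ (sym (ind-allᵇ p ys)) (trans
        (cong₂ _*_ (sym (ind-allᵇ q zs)) (trans
          (∏-cong zs (λ z → sym (ind-allᵇ (compatible z) ys))) (sym (ind-allᵇ (λ z → allᵇ (compatible z) ys) zs))))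
        (ind-∧ (allᵇ q zs) _)))
      (ind-∧ (allᵇ p ys) _)
    data Side (i : Fin (a + b)) : Set where
      left  : ∀ k → k ↑ˡ b ≡ i → Side i
      right : ∀ k → a ↑ʳ k ≡ i → Side i
    side : ∀ i → Side i
    side i with splitAt a i in eq
    ... | inj₁ k = left k (splitAt⁻¹-↑ˡ eq)
    ... | inj₂ k = right k (splitAt⁻¹-↑ʳ eq)
    is-good : ∀ f → Gᵇ (front a b f) (back a b f) ≡ true → fine f ≡ true
    is-good f g = cong₂ _∧_ (isSemiproper-intro (Kbip a b) f (λ i j → edge i j (side i) (side j)))
      (allᵇ-intro (R f) (allFin (a + b)) (λ i → list i (side i)))
      where
      g₁ = ∧-true {allᵇ p (front a b f)} g
      g₂ = ∧-true {allᵇ q (back a b f)} (proj₂ g₁)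
      list : ∀ i → Side i → R f i ≡ true
      list i (left k refl)  = trans (R≡ f i) (trans (cong (λ x → lookup (if x then A else B) (f i)) (inFirst-↑ˡ b k))
        (allᵇ-elim p (proj₁ g₁) (∈-tabulate⁺ k)))
      list i (right k refl) = trans (R≡ f i) (trans (cong (λ x → lookup (if x then A else B) (f i)) (inFirst-↑ʳ a k))
        (allᵇ-elim q (proj₁ g₂) (∈-tabulate⁺ k)))
      across : ∀ k l → compatible (f (a ↑ʳ l)) (f (k ↑ˡ b)) ≡ true
      across k l = allᵇ-elim (compatible (f (a ↑ʳ l)))
        (allᵇ-elim (λ z → allᵇ (compatible z) (front a b f)) (proj₂ g₂) (∈-tabulate⁺ l)) (∈-tabulate⁺ k)
      same-side : ∀ i j x → inFirst a {b} i ≡ x → inFirst a {b} j ≡ x → Kbip a b i j ≡ true → compatible (f i) (f j) ≡ true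
      same-side i j x ix jx ij rewrite ix | jx with x
      same-side i j x ix jx () | true
      same-side i j x ix jx () | false
      edge : ∀ i j → Side i → Side j → Kbip a b i j ≡ true → compatible (f i) (f j) ≡ true
      edge i j (left k refl)  (left l refl)  ij = same-side i j true (inFirst-↑ˡ b k) (inFirst-↑ˡ b l) ij
      edge i j (right k refl) (right l refl) ij = same-side i j false (inFirst-↑ʳ a k) (inFirst-↑ʳ a l) ij
      edge i j (left k refl)  (right l refl) ij = trans (compatible-sym (f i) (f j)) (across k l)
      edge i j (right k refl) (left l refl)  ij = across l k

T≤N : ∀ {c} (Ω∘ A B : Subset c) a b → let open Colours Ω∘ in
  T (colours (lookup A)) (colours (lookup B)) a b ≤ N Ω∘ A B a b
-- The colour lists in N are chosen by a function local to its definition, which has no name outside: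
-- the left-hand side below is found by unification with the unfolded N.
N-lists : ∀ {c} (Ω∘ A B : Subset c) a b (f : Fin (a + b) → Fin c) i → _ ≡ lookup (if inFirst a {b} i then A else B) (f i)
T≤N Ω∘ A B a b = T≤∑-good Ω∘ A B a b _ (N-lists Ω∘ A B a b)
N-lists Ω∘ A B a b f i with inFirst a {b} i
... | true  = refl
... | false = refl

-- Exact exponents, unordered edges, and the theorem

-- Every degree from 1 to `n` divides `n !`, so the quotient is exact there; the value at 0 is a
-- default.
quotient : ℕ → ℕ → ℕ
quotient m zero    = 0
quotient m (suc d) = m / suc d

quotient-! : ∀ n d → 1 ≤ d → d ≤ n → quotient (n !) d * d ≡ n !
quotient-! n (suc d) _ d≤n = m/n*n≡m (∣-trans (m∣m*n (d !)) (m≤n⇒m!∣n! d≤n))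

<ᵇ-exclusive : ∀ m n → m ≢ n → ind (m <ᵇ n) + ind (n <ᵇ m) ≡ 1
<ᵇ-exclusive zero    zero    m≢n = contradiction refl m≢n
<ᵇ-exclusive zero    (suc n) _   = refl
<ᵇ-exclusive (suc m) zero    _   = refl
<ᵇ-exclusive (suc m) (suc n) m≢n = <ᵇ-exclusive m n (m≢n ∘ cong suc)

upward : ∀ {n} → Adj n → Fin n → Fin n → Bool
upward adj u v = adj u v ∧ (toℕ u <ᵇ toℕ v)

-- Each edge is two ordered pairs, exactly one of them upward. This links the ordered products of
-- the induction to `edges`.
∏-adj-square : ∀ {n} (adj : Adj n) → (∀ u v → adj u v ≡ adj v u) → (∀ v → adj v v ≡ false) →
  ∀ (y : Fin n → Fin n → ℕ) → (∀ u v → y u v ≡ y v u) →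
  ∏ (allFin n) (λ u → ∏ (allFin n) (λ v → y u v ^ ind (adj u v)))
    ≡ ∏ (allFin n) (λ u → ∏ (allFin n) (λ v → y u v ^ ind (upward adj u v))) ^ 2
∏-adj-square {n} adj adj-sym adj-irrefl y y-sym = begin
  ∏ V (λ u → ∏ V (λ v → y u v ^ ind (adj u v)))
    ≡⟨ ∏-cong V (λ u → trans (∏-cong V (λ v → trans (cong (y u v ^_) (split u v))
         (^-distribˡ-+-* (y u v) (ind (upward adj u v)) (ind (upward adj v u)))))
         (∏-* V (λ v → y u v ^ ind (upward adj u v)) (λ v → y u v ^ ind (upward adj v u)))) ⟩
  ∏ V (λ u → ∏ V (λ v → y u v ^ ind (upward adj u v)) * ∏ V (λ v → y u v ^ ind (upward adj v u)))
    ≡⟨ ∏-* V (λ u → ∏ V (λ v → y u v ^ ind (upward adj u v))) (λ u → ∏ V (λ v → y u v ^ ind (upward adj v u))) ⟩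
  Z * ∏ V (λ u → ∏ V (λ v → y u v ^ ind (upward adj v u)))
    ≡⟨ cong (Z *_) (trans (∏-swap V V (λ u v → y u v ^ ind (upward adj v u)))
         (∏-cong V (λ v → ∏-cong V (λ u → cong (_^ ind (upward adj v u)) (y-sym u v))))) ⟩
  Z * Z
    ≡⟨ cong (Z *_) (sym (*-identityʳ Z)) ⟩
  Z ^ 2 ∎
  where
  open ≡-Reasoning
  V = allFin n
  Z = ∏ V (λ u → ∏ V (λ v → y u v ^ ind (upward adj u v)))
  split : ∀ u v → ind (adj u v) ≡ ind (upward adj u v) + ind (upward adj v u)
  split u v rewrite adj-sym v u with adj u v in uv
  ... | false = refl
  ... | true  = sym (<ᵇ-exclusive (toℕ u) (toℕ v) λ u≡v → contradiction
    (trans (sym uv) (trans (cong (λ x → adj x v) (toℕ-injective u≡v)) (adj-irrefl v))) λ ())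

-- `D` is a common multiple of the products d_u d_v over the edges and `k u v` is D/(d_u d_v): for
-- positive `D`, this is the D-th power of the inequality with roots.
theorem4p1 : (c n : ℕ) (Ω∘ : Subset c) (adj : Adj n)
    → (∀ u v → adj u v ≡ adj v u)
    → (∀ v → adj v v ≡ false)
    → (∀ v → degree adj v ≥ 1)
    → (Ωs : Fin n → Subset c)
    → (D : ℕ) (k : Fin n → Fin n → ℕ)
    → (∀ u v → adj u v ≡ true → k u v * (degree adj u * degree adj v) ≡ D)
    → countColourings n adj Ω∘ Ωs ^ D
    ≤ product (map (λ { (u , v) → N Ω∘ (Ωs u) (Ωs v) (degree adj v) (degree adj u) ^ k u v })
    (edges adj))
theorem4p1 c n Ω∘ adj adj-sym adj-irrefl degree≥1 Ωs D k k-spec =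
  -- The induction has the exponents F^2/(d_u d_v) and the theorem D/(d_u d_v); they are compared at
  -- the common power `D * (F * F)`.
  ^-cancelˡ-≤ (F * F) {{F²≢0}} (begin
    (count# ^ D) ^ (F * F)
      ≡⟨ ^-exchange count# D (F * F) ⟩
    (count# ^ (F * F)) ^ D
      ≤⟨ ^-monoˡ-≤ D (^-cancelˡ-≤ 2 squared) ⟩
    Z ^ D
      ≡⟨ power-inside y D ⟩
    ∏ V (λ u → ∏ V (λ v → (y u v ^ D) ^ ind (upward adj u v)))
      ≤⟨ ∏-mono V (λ u → ∏-mono V (λ v → edge u v)) ⟩
    ∏ V (λ u → ∏ V (λ v → (Nₑ u v ^ (F * F)) ^ ind (upward adj u v)))
      ≡⟨ sym (power-inside Nₑ (F * F)) ⟩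
    ∏ V (λ u → ∏ V (λ v → Nₑ u v ^ ind (upward adj u v))) ^ (F * F)
      ≡⟨ cong (_^ (F * F)) (sym (trans (∏-filterᵇ _ (allPairs n) _) (∏-allPairs {n} _))) ⟩
    product (map (λ { (u , v) → N Ω∘ (Ωs u) (Ωs v) (degree adj v) (degree adj u) ^ k u v }) (edges adj)) ^ (F * F) ∎)
  where
  open ≤-Reasoning
  open Colours Ω∘
  F = n !
  r = quotient (n !)
  F≢0 : NonZero F
  F≢0 = n !≢0
  F²≢0 : NonZero (F * F)
  F²≢0 = m*n≢0 F F {{F≢0}} {{F≢0}}
  open Induction {n} {c} Ω∘ F r F≢0 (quotient-! n)
  count# = countColourings n adj Ω∘ Ωs
  P : Fin n → Fin c → Bool
  P v = lookup (Ωs v)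
  degree≡deg : ∀ v → degree adj v ≡ deg adj v
  degree≡deg v = length-filterᵇ (adj v) (allFin n)
  1≤deg : ∀ v → 1 ≤ deg adj v
  1≤deg v = ≤-trans (degree≥1 v) (≤-reflexive (degree≡deg v))
  r-deg : ∀ v → r (deg adj v) * deg adj v ≡ F
  r-deg v = quotient-! n (deg adj v) (1≤deg v) (deg≤n adj v)
  y : Fin n → Fin n → ℕ
  y = edgeFactor adj P
  Nₑ : Fin n → Fin n → ℕ
  Nₑ u v = N Ω∘ (Ωs u) (Ωs v) (degree adj v) (degree adj u) ^ k u v
  Z = ∏ V (λ u → ∏ V (λ v → y u v ^ ind (upward adj u v)))
  power-inside : ∀ (g : Fin n → Fin n → ℕ) m →
    ∏ V (λ u → ∏ V (λ v → g u v ^ ind (upward adj u v))) ^ m ≡ ∏ V (λ u → ∏ V (λ v → (g u v ^ m) ^ ind (upward adj u v)))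
  power-inside g m = trans (sym (∏-^ V (λ u → ∏ V (λ v → g u v ^ ind (upward adj u v))) m))
    (∏-cong V (λ u → trans (sym (∏-^ V (λ v → g u v ^ ind (upward adj u v)) m))
      (∏-cong V (λ v → ^-exchange (g u v) (ind (upward adj u v)) m))))
  y-sym : ∀ u v → y u v ≡ y v u
  y-sym u v = cong₂ _^_ (T-sym (colours (P u)) (colours (P v)) (deg adj v) (deg adj u)) (*-comm (r (deg adj u)) _)
  vertices-one : ∏ V (vertexFactor adj P) ≡ 1
  vertices-one = trans (∏-cong V (λ v → one (deg adj v) (1≤deg v) _)) (∏-one V)
    where
    one : ∀ d → 1 ≤ d → ∀ x → x ^ isZero d ≡ 1
    one (suc d) _ x = refl
  squared : (count# ^ (F * F)) ^ 2 ≤ Z ^ 2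
  squared = begin
    (count# ^ (F * F)) ^ 2             ≡⟨ trans (^-*-assoc count# (F * F) 2) (cong (count# ^_) (*-comm (F * F) 2)) ⟩
    count# ^ (2 * (F * F))             ≡⟨ cong (_^ (2 * (F * F))) (countColourings≡count Ω∘ n adj Ωs) ⟩
    count adj P ^ (2 * (F * F))        ≤⟨ count≤upper (∑ V (deg adj)) adj ≤-refl adj-sym adj-irrefl P ⟩
    upper adj P                        ≡⟨ trans (cong (∏ V (λ u → ∏ V (λ v → y u v ^ ind (adj u v))) *_) vertices-one) (*-identityʳ _) ⟩
    ∏ V (λ u → ∏ V (λ v → y u v ^ ind (adj u v)))  ≡⟨ ∏-adj-square adj adj-sym adj-irrefl y y-sym ⟩
    Z ^ 2                              ∎
  exponents≡ : ∀ u v → adj u v ≡ true → r (deg adj u) * r (deg adj v) * D ≡ k u v * (F * F)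
  exponents≡ u v uv = trans (cong (r (deg adj u) * r (deg adj v) *_)
      (trans (sym (k-spec u v uv)) (cong₂ (λ a b → k u v * (a * b)) (degree≡deg u) (degree≡deg v))))
    (trans (e (r (deg adj u)) (r (deg adj v)) (k u v) (deg adj u) (deg adj v))
      (cong₂ (λ a b → k u v * (a * b)) (r-deg u) (r-deg v)))
    where
    e : ∀ ru rv k du dv → ru * rv * (k * (du * dv)) ≡ k * (ru * du * (rv * dv))
    e = solve-∀
  adjacent : ∀ u v → adj u v ≡ true → y u v ^ D ≤ Nₑ u v ^ (F * F)
  adjacent u v uv = begin
    y u v ^ D                          ≡⟨ ^-*-assoc Tₑ (r (deg adj u) * r (deg adj v)) D ⟩
    Tₑ ^ (r (deg adj u) * r (deg adj v) * D)  ≡⟨ cong (Tₑ ^_) (exponents≡ u v uv) ⟩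
    Tₑ ^ (k u v * (F * F))             ≡⟨ sym (^-*-assoc Tₑ (k u v) (F * F)) ⟩
    (Tₑ ^ k u v) ^ (F * F)             ≤⟨ ^-monoˡ-≤ (F * F) (^-monoˡ-≤ (k u v) Tₑ≤N) ⟩
    Nₑ u v ^ (F * F)                   ∎
    where
    Tₑ = T (colours (P u)) (colours (P v)) (deg adj v) (deg adj u)
    Tₑ≤N : Tₑ ≤ N Ω∘ (Ωs u) (Ωs v) (degree adj v) (degree adj u)
    Tₑ≤N = subst₂ (λ a b → Tₑ ≤ N Ω∘ (Ωs u) (Ωs v) a b) (sym (degree≡deg v)) (sym (degree≡deg u))
      (T≤N Ω∘ (Ωs u) (Ωs v) (deg adj v) (deg adj u))
  edge : ∀ u v → (y u v ^ D) ^ ind (upward adj u v) ≤ (Nₑ u v ^ (F * F)) ^ ind (upward adj u v)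
  edge u v with adj u v in uv
  ... | false = ≤-refl
  ... | true  = ^-monoˡ-≤ (ind (toℕ u <ᵇ toℕ v)) (adjacent u v uv)
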